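{- Let $G$ be a finite graph (loopless, multiple edges allowed) that contains $4$ pairwise edge-disjoint spanning trees. Then $G$ is $\mathbb{Z}_3$-connected.
   Context: Graphs are finite, have no loops, and may have multiple edges. For an orientation $D$ of $G$, $d_D^+(v)$ and $d_D^-(v)$ denote the out-degree and in-degree of the vertex $v$. A zero-sum function of $G$ is a map $\beta: V(G)\to\mathbb{Z}_3$ with $\sum_{v\in V(G)}\beta(v)=0$ in $\mathbb{Z}_3$. A $\beta$-orientation of $G$ is an orientation $D$ of $G$ with $d_D^+(v)-d_D^-(v)=\beta(v)$ in $\mathbb{Z}_3$ for every $v\in V(G)$. $G$ is $\mathbb{Z}_3$-connected if it admits a $\beta$-orientation for every zero-sum function $\beta$ of $G$. -}

module Defs where

open import Data.Fin using (Fin; zero; toℕ; fromℕ<; _≟_)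
open import Data.Fin.Subset using (Subset; Empty; _∈_; _∩_)
open import Data.Integer using (ℤ; _⊖_)
open import Data.Integer.DivMod using (n%ℕd<d)
open import Data.List using (List; []; _∷_)
open import Data.List.Relation.Unary.Unique.Propositional using (Unique)
open import Data.Nat using (ℕ; _+_)
open import Data.Nat.DivMod using (_mod_)
open import Data.Product using (∃; _×_; _,_; proj₁; proj₂)
open import Data.Sum using (_⊎_)
open import Data.Vec using (count; allFin)
open import Data.Vec.Functional using (foldr)
open import Relation.Binary.Construct.Closure.ReflexiveTransitive using (Star; ε; _◅_)
open import Relation.Binary.PropositionalEquality using (_≡_; _≢_)
open import Relation.Nullary using (¬_)

ℤ₃ : Set
ℤ₃ = Fin 3

infixl 6 _+₃_

_+₃_ : ℤ₃ → ℤ₃ → ℤ₃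
a +₃ b = (toℕ a + toℕ b) mod 3

residue : ℤ → ℤ₃
residue i = fromℕ< (n%ℕd<d i 3)

-- Edges are labelled, so that distinct edges may have the same ends.  The
-- order in which `ends` lists the two ends of an edge carries no meaning:
-- swapping them changes neither `loopless` nor `Joins` below.
record Graph : Set where
  field
    order    : ℕ
    size     : ℕ
    ends     : Fin size → Fin order × Fin order
    loopless : ∀ e → proj₁ (ends e) ≢ proj₂ (ends e)

module _ (G : Graph) where
  open Graph G

  Vertex : Set
  Vertex = Fin order

  Edge : Set
  Edge = Fin size

  EdgeSet : Set
  EdgeSet = Subset size

  Joins : Edge → Vertex → Vertex → Set
  Joins e u v = ends e ≡ (u , v) ⊎ ends e ≡ (v , u)

  Step : EdgeSet → Vertex → Vertex → Set
  Step S u v = ∃ λ e → e ∈ S × Joins e u v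

  Walk : EdgeSet → Vertex → Vertex → Set
  Walk S = Star (Step S)

  edges : ∀ {S u v} → Walk S u v → List Edge
  edges ε             = []
  edges ((e , _) ◅ w) = e ∷ edges w

  -- The final vertex is omitted, so that for a closed walk the common first
  -- and last vertex is listed once.
  vertices : ∀ {S u v} → Walk S u v → List Vertex
  vertices ε               = []
  vertices {u = u} (_ ◅ w) = u ∷ vertices w

  -- Distinctness of the edges rules out traversing one edge back and forth,
  -- while two parallel edges do form a cycle (of length 2).
  IsCycle : ∀ {S v} → Walk S v v → Set
  IsCycle w = edges w ≢ [] × Unique (edges w) × Unique (vertices w)

  Connected : EdgeSet → Set
  Connected S = ∀ u v → Walk S u v

  Acyclic : EdgeSet → Set
  Acyclic S = ∀ {v} (w : Walk S v v) → ¬ IsCycle w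

  -- A spanning subgraph is given by its edge set; its vertex set is all of
  -- `Vertex`.
  IsSpanningTree : EdgeSet → Set
  IsSpanningTree S = Connected S × Acyclic S

  EdgeDisjoint : EdgeSet → EdgeSet → Set
  EdgeDisjoint S T = Empty (S ∩ T)

  record Orientation : Set where
    field
      tail  : Edge → Vertex
      head  : Edge → Vertex
      joins : ∀ e → Joins e (tail e) (head e)

    outdeg : Vertex → ℕ
    outdeg v = count (λ e → tail e ≟ v) (allFin size)

    indeg : Vertex → ℕ
    indeg v = count (λ e → head e ≟ v) (allFin size)

  IsZeroSum : (Vertex → ℤ₃) → Set
  IsZeroSum β = foldr _+₃_ zero β ≡ zero

  IsβOrientation : (Vertex → ℤ₃) → Orientation → Set
  IsβOrientation β D = ∀ v → residue (outdeg v ⊖ indeg v) ≡ β v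
    where open Orientation D

  ℤ₃-Connected : Set
  ℤ₃-Connected = ∀ β → IsZeroSum β → ∃ λ D → IsβOrientation β D

{-# OPTIONS --safe #-}
module Submission where

-- Let T₁, …, T₄ be the trees.  If some cut has at most five edges, then every
-- tree crosses it once, except that one of them may cross it twice, so on one
-- side B of the cut every tree stays connected.  If B has at least two vertices,
-- contract B, orient, and then orient the edges inside B.  If B is a single
-- vertex v, lift the two edges at v of the tree that has two of them (if there
-- is one), and delete v: at least three edges at v remain, and they can be
-- oriented so as to take any value modulo 3.
--
-- Otherwise every cut has at least six edges, and the theorem of Lovász,
-- Thomassen, Wu and Zhang applies, with an isolated vertex z added.  In that
-- theorem the edges at z are oriented in advance, z has degree at most
-- 4 + |τ(z)|, and every set A of other vertices (apart from the set of all of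
-- them) sends out at least 4 + |τ(A)| edges.  In an induction, sets A of several
-- vertices that attain the bound are contracted, as are parallel edges; edges
-- are lifted at vertices above the bound and at vertices of degree 4; and an
-- edge is oriented and deleted when this brings its two ends closer to their
-- values.  In what is left all values have the same sign, say positive, and all
-- edges at z leave z.  Then an edge from z to x is replaced by two edges from x
-- to z, which is the same modulo 3, and an edge xy is oriented to x and deleted.

open import Defs
open import Data.Bool using (Bool; T; true; false; not; _∧_; _∨_; _xor_; if_then_else_)
open import Data.Bool.Properties as Bool using ()
open import Data.Empty using (⊥; ⊥-elim)
open import Data.Fin using (Fin; zero; suc; toℕ; fromℕ<)
open import Data.Fin.Patterns using (0F; 1F; 2F)
open import Data.Fin.Properties as Fin using (all?; any?; toℕ-fromℕ<; toℕ-injective)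
import Data.Fin.Subset as Sub
import Data.Fin.Subset.Properties as Sub
open import Data.Integer as ℤ using (_⊖_; _%ℕ_; -[1+_])
open import Data.Integer.DivMod using (n%ℕd<d)
open import Data.Integer.Properties using ([1+m]⊖[1+n]≡m⊖n)
open import Data.List using (List; []; _∷_; _++_; map; concat; length; filter; allFin; tabulate)
open import Data.List.Membership.Propositional using (_∈_)
open import Data.List.Membership.Propositional.Properties using (∈-filter⁺; ∈-allFin)
open import Data.List.Properties
  using (++-assoc; ++-identityʳ; length-map; map-++; map-tabulate; tabulate-cong)
open import Data.List.Relation.Binary.Pointwise as Pointwise using (Pointwise; []; _∷_)
open import Data.List.Relation.Unary.All as All using (All; []; _∷_)
import Data.List.Relation.Unary.All.Properties as All
open import Data.List.Relation.Unary.AllPairs using (AllPairs; []; _∷_)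
import Data.List.Relation.Unary.AllPairs.Properties as AllPairs
open import Data.List.Relation.Unary.Any using (here; there)
open import Data.Nat
  using (ℕ; zero; suc; _+_; _∸_; _%_; _≤_; _<_; z≤n; s≤s; s≤s⁻¹; _<?_; _≤ᵇ_; _≡ᵇ_; pred)
open import Data.Nat.DivMod using ([m+n]%n≡m%n)
open import Data.Nat.Properties as ℕ using ()
open import Data.Product using (∃; _×_; _,_; proj₁; proj₂)
open import Data.Sum using (_⊎_; inj₁; inj₂)
open import Data.Unit using (⊤; tt)
import Data.Vec as Vec
open import Data.Vec.Functional using (foldr)
import Data.Vec.Properties as Vec
open import Function using (_∘_; id)
open import Relation.Binary.Construct.Closure.ReflexiveTransitive using (ε; _◅_)
open import Relation.Binary.PropositionalEquality
open import Relation.Nullary using (Dec; yes; no; does; ¬_; contradiction; ¬?; _×-dec_; _⊎-dec_)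
open import Relation.Nullary.Decidable
  using (True; toWitness; map′; dec-true; dec-false; decidable-stable)

-- The threshold of six is where the two cases meet. A cut of at most five edges leaves four trees a
-- surplus of at most one crossing, while a cut of d ≥ 6 edges always satisfies 4 + |τ| ≤ d, because
-- |τ| is at most 3, and at most 2 when d is even.
--
-- Contracting a set, and later its complement, calls for prescribed values that are additive over
-- vertex sets and zero in total. Hence a demand is a list of arcs and not a function: the value of
-- a set S is the net outflow of S, maps of vertices act on arcs, and the zero sum is automatic. All
-- graphs of an induction live on one type `Fin n`, with the actual vertices singled out by a subset
-- X; a contraction is then a map from `Fin n` to itself, and cuts are pulled back along it.
--
-- The upper bound at z closes the induction: if A attains its lower bound, then contracting the
-- complement of A to z turns this equality into the bound at z. The bound also gives z degree at
-- most 7, whereas two sets that partition the other vertices, with no edge between them, would send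
-- at least 8 edges to z. This excludes the degenerate configurations.

private variable
  V W : Set
  n   : ℕ
  X   : Fin n → Bool

-- Arithmetic modulo 3 and the degree bounds

-₃_ : ℤ₃ → ℤ₃
-₃ 0F = 0F
-₃ 1F = 2F
-₃ 2F = 1F

infix 8 -₃_

-₃-involutive : ∀ a → -₃ (-₃ a) ≡ a
-₃-involutive 0F = refl
-₃-involutive 1F = refl
-₃-involutive 2F = refl

opaque
  -- A sealed copy of `_+₃_`, so that sums keep their shape in goals instead of unfolding to
  -- `_mod_`.
  _⊕_ : ℤ₃ → ℤ₃ → ℤ₃
  _⊕_ = _+₃_

infixl 6 _⊕_

opaque
  unfolding _⊕_

  ⊕-comm : ∀ a b → a ⊕ b ≡ b ⊕ a
  ⊕-comm = toWitness {a? = all? λ a → all? λ b → _ Fin.≟ _} _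

  ⊕-assoc : ∀ a b c → (a ⊕ b) ⊕ c ≡ a ⊕ (b ⊕ c)
  ⊕-assoc = toWitness {a? = all? λ a → all? λ b → all? λ c → _ Fin.≟ _} _

  ⊕-identityˡ : ∀ a → 0F ⊕ a ≡ a
  ⊕-identityˡ = toWitness {a? = all? λ a → _ Fin.≟ _} _

  ⊕-identityʳ : ∀ a → a ⊕ 0F ≡ a
  ⊕-identityʳ = toWitness {a? = all? λ a → _ Fin.≟ _} _

  ⊕-inverseˡ : ∀ a → -₃ a ⊕ a ≡ 0F
  ⊕-inverseˡ = toWitness {a? = all? λ a → _ Fin.≟ _} _

  ⊕-inverseʳ : ∀ a → a ⊕ -₃ a ≡ 0F
  ⊕-inverseʳ = toWitness {a? = all? λ a → _ Fin.≟ _} _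

  -₃-⊕ : ∀ a b → -₃ (a ⊕ b) ≡ -₃ a ⊕ -₃ b
  -₃-⊕ = toWitness {a? = all? λ a → all? λ b → _ Fin.≟ _} _

⊕-zeroˡ⇒neg : ∀ a b → a ⊕ b ≡ 0F → b ≡ -₃ a
⊕-zeroˡ⇒neg a b p = begin
  b                   ≡⟨ ⊕-identityˡ b ⟨
  0F ⊕ b             ≡⟨ cong (_⊕ b) (⊕-inverseˡ a) ⟨
  (-₃ a ⊕ a) ⊕ b    ≡⟨ ⊕-assoc (-₃ a) a b ⟩
  -₃ a ⊕ (a ⊕ b)    ≡⟨ cong (-₃ a ⊕_) p ⟩
  -₃ a ⊕ 0F          ≡⟨ ⊕-identityʳ _ ⟩
  -₃ a                ∎
  where open ≡-Reasoning

opaque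
  unfolding _⊕_

  ⊕-swap : ∀ a b c → a ⊕ (b ⊕ c) ≡ b ⊕ (a ⊕ c)
  ⊕-swap = toWitness {a? = all? λ a → all? λ b → all? λ c → _ Fin.≟ _} _

  ⊕-interchange : ∀ a b c d → (a ⊕ b) ⊕ (c ⊕ d) ≡ (a ⊕ c) ⊕ (b ⊕ d)
  ⊕-interchange = toWitness {a? = all? λ a → all? λ b → all? λ c → all? λ d → _ Fin.≟ _} _

+-interchange : ∀ a b c d → (a + b) + (c + d) ≡ (a + c) + (b + d)
+-interchange a b c d = begin
  (a + b) + (c + d) ≡⟨ ℕ.+-assoc a b (c + d) ⟩
  a + (b + (c + d)) ≡⟨ cong (a +_) (ℕ.+-comm b (c + d)) ⟩
  a + ((c + d) + b) ≡⟨ cong (a +_) (ℕ.+-assoc c d b) ⟩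
  a + (c + (d + b)) ≡⟨ cong (λ x → a + (c + x)) (ℕ.+-comm d b) ⟩
  a + (c + (b + d)) ≡⟨ ℕ.+-assoc a c (b + d) ⟨
  (a + c) + (b + d) ∎
  where open ≡-Reasoning

+-swap : ∀ a b c → a + (b + c) ≡ b + (a + c)
+-swap a b c = trans (sym (ℕ.+-assoc a b c)) (trans (cong (_+ c) (ℕ.+-comm a b)) (ℕ.+-assoc b a c))

-- Lovász, Thomassen, Wu and Zhang compare the degree d of a vertex (or of a
-- vertex set) with 4 + |τ|, where τ ∈ {0, ±1, ±2, ±3} is congruent to the
-- prescribed value h modulo 3 and to d modulo 2.  `good d h` says
-- 4 + |τ| ≤ d, and `small d h` says d ≤ 4 + |τ|.
good : ℕ → ℤ₃ → Bool
good 4 0F = true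
good 5 1F = true
good 5 2F = true
good (suc (suc (suc (suc (suc (suc _)))))) _ = true
good _ _ = false

small : ℕ → ℤ₃ → Bool
small 6 0F = false
small 7 1F = false
small 7 2F = false
small (suc (suc (suc (suc (suc (suc (suc (suc _)))))))) _ = false
small _ _ = true

-- Whether d edges with prescribed value h stay good when an outgoing (up) or
-- an incoming (dn) edge is removed.
up dn : ℕ → ℤ₃ → Bool
up d h = good (pred d) (1F ⊕ h)
dn d h = good (pred d) (2F ⊕ h)

_⊃_ : Bool → Bool → Bool
true  ⊃ b = b
false ⊃ _ = true

infixr 4 _⊃_

modus : ∀ {a b} → (a ⊃ b) ≡ true → a ≡ true → b ≡ true
modus p refl = p

⊃-true : ∀ a → (a ⊃ true) ≡ true
⊃-true true = refl
⊃-true false = refl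

-- From degree 8 on, `good` and `small` are constant, so a relation between them only needs checking
-- for degrees 0 to 7.
below8 : (f : ℕ → ℤ₃ → Bool) →
  {True (all? λ (d : Fin 8) → all? λ h → f (toℕ d) h Bool.≟ true)} →
  (∀ d h → f (8 + d) h ≡ true) → ∀ d h → f d h ≡ true
below8 f {c} large d h with d <? 8
... | yes d<8 = subst (λ d → f d h ≡ true) (toℕ-fromℕ< d<8) (toWitness c (fromℕ< d<8) h)
... | no d≮8 = subst (λ d → f d h ≡ true) (ℕ.m+[n∸m]≡n (ℕ.≮⇒≥ d≮8)) (large (d ∸ 8) h)

-- Sums over lists

total : (V → ℕ) → List V → ℕ
total f []      = 0
total f (x ∷ L) = f x + total f L

total₃ : (V → ℤ₃) → List V → ℤ₃
total₃ f []      = 0F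
total₃ f (x ∷ L) = f x ⊕ total₃ f L

total-cong : ∀ {f g : V → ℕ} {L} → All (λ x → f x ≡ g x) L → total f L ≡ total g L
total-cong []       = refl
total-cong (p ∷ ps) = cong₂ _+_ p (total-cong ps)

total₃-cong : ∀ {f g : V → ℤ₃} {L} → All (λ x → f x ≡ g x) L → total₃ f L ≡ total₃ g L
total₃-cong []       = refl
total₃-cong (p ∷ ps) = cong₂ _⊕_ p (total₃-cong ps)

total-+ : ∀ (f g : V → ℕ) L → total (λ x → f x + g x) L ≡ total f L + total g L
total-+ f g []      = refl
total-+ f g (x ∷ L) = trans (cong (f x + g x +_) (total-+ f g L)) (+-interchange (f x) (g x) _ _)

total₃-+ : ∀ (f g : V → ℤ₃) L → total₃ (λ x → f x ⊕ g x) L ≡ total₃ f L ⊕ total₃ g L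
total₃-+ f g []      = sym (⊕-identityˡ 0F)
total₃-+ f g (x ∷ L) = trans (cong (f x ⊕ g x ⊕_) (total₃-+ f g L)) (⊕-interchange (f x) (g x) _ _)

total₃-- : ∀ (f : V → ℤ₃) L → total₃ (λ x → -₃ f x) L ≡ -₃ total₃ f L
total₃-- f []      = refl
total₃-- f (x ∷ L) = trans (cong (-₃ f x ⊕_) (total₃-- f L)) (sym (-₃-⊕ (f x) _))

total-++ : ∀ (f : V → ℕ) L M → total f (L ++ M) ≡ total f L + total f M
total-++ f []      M = refl
total-++ f (x ∷ L) M = trans (cong (f x +_) (total-++ f L M)) (sym (ℕ.+-assoc (f x) _ _))

total₃-++ : ∀ (f : V → ℤ₃) L M → total₃ f (L ++ M) ≡ total₃ f L ⊕ total₃ f M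
total₃-++ f []      M = sym (⊕-identityˡ _)
total₃-++ f (x ∷ L) M = trans (cong (f x ⊕_) (total₃-++ f L M)) (sym (⊕-assoc (f x) _ _))

total-map : ∀ (f : W → ℕ) (π : V → W) L → total f (map π L) ≡ total (f ∘ π) L
total-map f π []      = refl
total-map f π (x ∷ L) = cong (f (π x) +_) (total-map f π L)

total₃-map : ∀ (f : W → ℤ₃) (π : V → W) L → total₃ f (map π L) ≡ total₃ (f ∘ π) L
total₃-map f π []      = refl
total₃-map f π (x ∷ L) = cong (f (π x) ⊕_) (total₃-map f π L)

total-0 : ∀ (f : V → ℕ) {L} → All (λ x → f x ≡ 0) L → total f L ≡ 0
total-0 f []       = refl
total-0 f (p ∷ ps) = cong₂ _+_ p (total-0 f ps)

total₃-0 : ∀ (f : V → ℤ₃) {L} → All (λ x → f x ≡ 0F) L → total₃ f L ≡ 0F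
total₃-0 f []       = refl
total₃-0 f (p ∷ ps) = trans (cong₂ _⊕_ p (total₃-0 f ps)) (⊕-identityˡ 0F)

total-sum : ∀ {f g h k : V → ℕ} {L} → All (λ x → f x + g x ≡ h x + k x) L →
  total f L + total g L ≡ total h L + total k L
total-sum {f = f} {g} {h} {k} {L} p =
  trans (sym (total-+ f g L)) (trans (total-cong p) (total-+ h k L))

-- Edges, cuts and net outflow

Arc : Set → Set
Arc V = V × V

-- Edges to be oriented, and edges whose orientation is prescribed.
data Link (V : Set) : Set where
  free fixed : V → V → Link V

cross : Bool → Bool → ℕ
cross a b = if a xor b then 1 else 0

-- The contribution of an arc to the outflow of a set, given the membership of its tail and of its
-- head; `2F` stands for -1.
flow : Bool → Bool → ℤ₃
flow true  false = 1F
flow false true  = 2F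
flow _     _     = 0F

Subset : Set → Set
Subset V = V → Bool

out : Subset V → Arc V → ℤ₃
out S (u , v) = flow (S u) (S v)

crossing freeCrossing fixedCrossing : Subset V → Link V → ℕ
crossing S (free u v)  = cross (S u) (S v)
crossing S (fixed u v) = cross (S u) (S v)
freeCrossing S (free u v)  = cross (S u) (S v)
freeCrossing S (fixed u v) = 0
fixedCrossing S (free u v)  = 0
fixedCrossing S (fixed u v) = cross (S u) (S v)

fixedOut : Subset V → Link V → ℤ₃
fixedOut S (free u v)  = 0F
fixedOut S (fixed u v) = flow (S u) (S v)

net : List (Arc V) → Subset V → ℤ₃
net K S = total₃ (out S) K

cut freeCut fixedCut : List (Link V) → Subset V → ℕ
cut L S = total (crossing S) L
freeCut L S = total (freeCrossing S) L
fixedCut L S = total (fixedCrossing S) L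

fixedNet : List (Link V) → Subset V → ℤ₃
fixedNet L S = total₃ (fixedOut S) L

-- A free edge counts twice so that `reverse-arc`, which trades a fixed and a free edge for two
-- fixed ones, still lowers the weight.
weigh : Link V → ℕ
weigh (free u v)  = 2
weigh (fixed u v) = 1

weight : List (Link V) → ℕ
weight = total weigh

mapArc : (V → W) → Arc V → Arc W
mapArc π (u , v) = π u , π v

mapEdge : (V → W) → Link V → Link W
mapEdge π (free u v)  = free (π u) (π v)
mapEdge π (fixed u v) = fixed (π u) (π v)

net-map : ∀ (π : V → W) K S → net (map (mapArc π) K) S ≡ net K (S ∘ π)
net-map π K S = total₃-map (out S) (mapArc π) K

crossing-map : ∀ (π : V → W) S e → crossing S (mapEdge π e) ≡ crossing (S ∘ π) e
crossing-map π S (free u v)  = refl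
crossing-map π S (fixed u v) = refl

fixedOut-map : ∀ (π : V → W) S e → fixedOut S (mapEdge π e) ≡ fixedOut (S ∘ π) e
fixedOut-map π S (free u v)  = refl
fixedOut-map π S (fixed u v) = refl

cut-map : ∀ (π : V → W) L S → cut (map (mapEdge π) L) S ≡ cut L (S ∘ π)
cut-map π L S = trans (total-map (crossing S) (mapEdge π) L)
  (total-cong (All.universal (crossing-map π S) L))

fixedNet-map : ∀ (π : V → W) L S → fixedNet (map (mapEdge π) L) S ≡ fixedNet L (S ∘ π)
fixedNet-map π L S = trans (total₃-map (fixedOut S) (mapEdge π) L)
  (total₃-cong (All.universal (fixedOut-map π S) L))

cut≡free+fixed : ∀ L (S : Subset V) → cut L S ≡ freeCut L S + fixedCut L S
cut≡free+fixed L S = trans (total-cong (All.universal split L)) (total-+ _ _ L)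
  where
  split : ∀ e → crossing S e ≡ freeCrossing S e + fixedCrossing S e
  split (free u v)  = sym (ℕ.+-identityʳ _)
  split (fixed u v) = refl

flow-neg : ∀ a b → flow b a ≡ -₃ flow a b
flow-neg true  true  = refl
flow-neg true  false = refl
flow-neg false true  = refl
flow-neg false false = refl

flow-not : ∀ a b → flow (not a) (not b) ≡ -₃ flow a b
flow-not true  true  = refl
flow-not true  false = refl
flow-not false true  = refl
flow-not false false = refl

flow-refl : ∀ a → flow a a ≡ 0F
flow-refl true  = refl
flow-refl false = refl

opaque
  unfolding _⊕_

  flow-trans : ∀ a b c → flow a b ⊕ flow b c ≡ flow a c
  flow-trans true  true  true  = refl
  flow-trans true  true  false = refl
  flow-trans true  false true  = refl
  flow-trans true  false false = refl
  flow-trans false true  true  = refl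
  flow-trans false true  false = refl
  flow-trans false false true  = refl
  flow-trans false false false = refl

cross-sym : ∀ a b → cross a b ≡ cross b a
cross-sym true  true  = refl
cross-sym true  false = refl
cross-sym false true  = refl
cross-sym false false = refl

cross-refl : ∀ a → cross a a ≡ 0
cross-refl true  = refl
cross-refl false = refl

cross-0 : ∀ a b → cross a b ≡ 0 → a ≡ b
cross-0 true  true  p = refl
cross-0 false false p = refl

cross-not : ∀ a b → cross (not a) (not b) ≡ cross a b
cross-not true  true  = refl
cross-not true  false = refl
cross-not false true  = refl
cross-not false false = refl

net-not : ∀ K (S : Subset V) → net K (not ∘ S) ≡ -₃ net K S
net-not K S = trans (total₃-cong (All.universal (λ (u , v) → flow-not (S u) (S v)) K))
  (total₃-- (out S) K)

cut-not : ∀ L (S : Subset V) → cut L (not ∘ S) ≡ cut L S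
cut-not L S = total-cong (All.universal eq L)
  where
  eq : ∀ e → crossing (not ∘ S) e ≡ crossing S e
  eq (free u v)  = cross-not (S u) (S v)
  eq (fixed u v) = cross-not (S u) (S v)

-- Rearranging edge lists

infix 4 _⟶_

-- Graphs are edge lists, read up to order and up to the direction in which a free edge is listed.
-- Cuts, values and solvability are invariant under these moves, so the edge in question can be
-- assumed to come first.
data _⟶_ {V : Set} : List (Link V) → List (Link V) → Set where
  done : ∀ {L} → L ⟶ L
  keep : ∀ {L M} e → L ⟶ M → e ∷ L ⟶ e ∷ M
  swap : ∀ {L} e f → e ∷ f ∷ L ⟶ f ∷ e ∷ L
  flip : ∀ {L} u v → free u v ∷ L ⟶ free v u ∷ L
  _⟫_  : ∀ {L M N} → L ⟶ M → M ⟶ N → L ⟶ N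

infixr 5 _⟫_

total-⟶ : ∀ {f : Link V → ℕ} → (∀ u v → f (free u v) ≡ f (free v u)) →
  ∀ {L M} → L ⟶ M → total f L ≡ total f M
total-⟶ f-sym done       = refl
total-⟶ {f = f} f-sym (keep e r) = cong (f e +_) (total-⟶ f-sym r)
total-⟶ {f = f} f-sym (swap e g) = +-swap (f e) (f g) _
total-⟶ {f = f} f-sym (flip {L} u v) = cong (_+ total f L) (f-sym u v)
total-⟶ f-sym (r ⟫ s)    = trans (total-⟶ f-sym r) (total-⟶ f-sym s)

cut-⟶ : ∀ (S : Subset V) {L M} → L ⟶ M → cut L S ≡ cut M S
cut-⟶ S = total-⟶ (λ u v → cross-sym (S u) (S v))

freeCut-⟶ : ∀ (S : Subset V) {L M} → L ⟶ M → freeCut L S ≡ freeCut M S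
freeCut-⟶ S = total-⟶ (λ u v → cross-sym (S u) (S v))

weight-⟶ : ∀ {L M : List (Link V)} → L ⟶ M → weight L ≡ weight M
weight-⟶ = total-⟶ (λ u v → refl)

fixedNet-⟶ : ∀ (S : Subset V) {L M} → L ⟶ M → fixedNet L S ≡ fixedNet M S
fixedNet-⟶ S done       = refl
fixedNet-⟶ S (keep e r) = cong (fixedOut S e ⊕_) (fixedNet-⟶ S r)
fixedNet-⟶ S (swap e g) = ⊕-swap (fixedOut S e) (fixedOut S g) _
fixedNet-⟶ S (flip u v) = refl
fixedNet-⟶ S (r ⟫ s)    = trans (fixedNet-⟶ S r) (fixedNet-⟶ S s)

All-⟶ : ∀ {P : Link V → Set} → (∀ {u v} → P (free u v) → P (free v u)) →
  ∀ {L M} → L ⟶ M → All P L → All P M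
All-⟶ P-sym done       ps           = ps
All-⟶ P-sym (keep e r) (p ∷ ps)     = p ∷ All-⟶ P-sym r ps
All-⟶ P-sym (swap e f) (p ∷ q ∷ ps) = q ∷ p ∷ ps
All-⟶ P-sym (flip u v) (p ∷ ps)     = P-sym p ∷ ps
All-⟶ P-sym (r ⟫ s)    ps           = All-⟶ P-sym s (All-⟶ P-sym r ps)

-- Orientations that meet a demand

data Orients {V : Set} : Link V → Arc V → Set where
  forth : ∀ {u v} → Orients (free u v) (u , v)
  back  : ∀ {u v} → Orients (free u v) (v , u)
  given : ∀ {u v} → Orients (fixed u v) (u , v)

Oriented : List (Link V) → List (Arc V) → Set
Oriented = Pointwise Orients

orientation-⟶ : ∀ {L M : List (Link V)} {O} → L ⟶ M → Oriented M O →
  ∃ λ O′ → Oriented L O′ × (∀ S → net O′ S ≡ net O S)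
orientation-⟶ done o = _ , o , λ S → refl
orientation-⟶ (keep e r) (o ∷ os) with orientation-⟶ r os
... | O , os′ , eq = _ , o ∷ os′ , λ S → cong (_ ⊕_) (eq S)
orientation-⟶ (swap e f) (o ∷ p ∷ os) = _ , p ∷ o ∷ os , λ S → ⊕-swap (out S _) (out S _) _
orientation-⟶ (flip u v) (forth ∷ os) = _ , back ∷ os , λ S → refl
orientation-⟶ (flip u v) (back ∷ os)  = _ , forth ∷ os , λ S → refl
orientation-⟶ (r ⟫ s) os with orientation-⟶ s os
... | O , os′ , eq with orientation-⟶ r os′
... | O′ , os″ , eq′ = O′ , os″ , λ S → trans (eq′ S) (eq S)

⁅_⁆ : Fin n → Subset (Fin n)
⁅ v ⁆ w = does (v Fin.≟ w)

-- The demand H consists of arcs that have to cancel the orientation modulo 3.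
record Solvable (L : List (Link (Fin n))) (H : List (Arc (Fin n))) : Set where
  constructor solved
  field
    arcs    : List (Arc (Fin n))
    orients : Oriented L arcs
    meets   : ∀ v → net arcs ⁅ v ⁆ ⊕ net H ⁅ v ⁆ ≡ 0F

solvable-⟶ : ∀ {L M : List (Link (Fin n))} {H} → L ⟶ M → Solvable M H → Solvable L H
solvable-⟶ r (solved O os eq) with orientation-⟶ r os
... | O′ , os′ , eq′ = solved O′ os′ λ v → trans (cong (_⊕ _) (eq′ ⁅ v ⁆)) (eq v)

solvable-orient : ∀ {e a} {L : List (Link (Fin n))} {H} → Orients e a →
  Solvable L (a ∷ H) → Solvable (e ∷ L) H
solvable-orient {a = a} {H = H} o (solved O os eq) = solved _ (o ∷ os) λ v →
  trans (trans (cong (_⊕ net H ⁅ v ⁆) (⊕-comm (out ⁅ v ⁆ a) _)) (⊕-assoc (net O ⁅ v ⁆) _ _)) (eq v)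

solvable-demand : ∀ {L : List (Link (Fin n))} {H K} → (∀ v → net H ⁅ v ⁆ ≡ net K ⁅ v ⁆) →
  Solvable L H → Solvable L K
solvable-demand h (solved O os eq) = solved O os λ v → trans (cong (_ ⊕_) (sym (h v))) (eq v)

-- Allows any edge at v to be listed as seen from v, so that lifting treats free and prescribed
-- edges alike.
data Kind : Set where
  free outward inward : Kind

spoke : V → Kind → V → Link V
spoke v free    w = free v w
spoke v outward w = fixed v w
spoke v inward  w = fixed w v

-- The edge that replaces `free v w` and `spoke v k u` when they are lifted.
lifted : Kind → V → V → Link V
lifted free    w u = free w u
lifted outward w u = fixed w u
lifted inward  w u = fixed u w

-- Routing the arc between w and u through v changes no net outflow, since `flow` telescopes. A
-- prescribed spoke keeps its direction, and the free edge is turned so as to continue it.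
solvable-lift : ∀ {v w u : Fin n} k {L H} → Solvable (lifted k w u ∷ L) H →
  Solvable (free v w ∷ spoke v k u ∷ L) H
solvable-lift {v = v} {w} {u} k {L} {H} (solved (c ∷ O) (o ∷ os) eq) = lift k o eq
  where
  through : ∀ (x y : Fin _) i → flow (⁅ i ⁆ x) (⁅ i ⁆ v) ⊕ (flow (⁅ i ⁆ v) (⁅ i ⁆ y) ⊕ net O ⁅ i ⁆)
    ≡ flow (⁅ i ⁆ x) (⁅ i ⁆ y) ⊕ net O ⁅ i ⁆
  through x y i = trans (sym (⊕-assoc (flow (⁅ i ⁆ x) (⁅ i ⁆ v)) _ _))
    (cong (_⊕ net O ⁅ i ⁆) (flow-trans (⁅ i ⁆ x) (⁅ i ⁆ v) (⁅ i ⁆ y)))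
  through′ : ∀ (x y : Fin _) i → flow (⁅ i ⁆ v) (⁅ i ⁆ y) ⊕ (flow (⁅ i ⁆ x) (⁅ i ⁆ v) ⊕ net O ⁅ i ⁆)
    ≡ flow (⁅ i ⁆ x) (⁅ i ⁆ y) ⊕ net O ⁅ i ⁆
  through′ x y i = trans (⊕-swap (flow (⁅ i ⁆ v) (⁅ i ⁆ y)) _ _) (through x y i)
  lift : ∀ k {c} → Orients (lifted k w u) c → (∀ i → net (c ∷ O) ⁅ i ⁆ ⊕ net H ⁅ i ⁆ ≡ 0F) →
    Solvable (free v w ∷ spoke v k u ∷ L) H
  lift free    forth eq = solved _ (back ∷ forth ∷ os) λ i → trans (cong (_⊕ _) (through w u i)) (eq i)
  lift free    back  eq = solved _ (forth ∷ back ∷ os) λ i → trans (cong (_⊕ _) (through′ u w i)) (eq i)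
  lift outward given eq = solved _ (back ∷ given ∷ os) λ i → trans (cong (_⊕ _) (through w u i)) (eq i)
  lift inward  given eq = solved _ (forth ∷ given ∷ os) λ i → trans (cong (_⊕ _) (through′ u w i)) (eq i)

-- Bringing a chosen edge to the front

⁅⁆-refl : ∀ (v : Fin n) → ⁅ v ⁆ v ≡ true
⁅⁆-refl v = dec-true (v Fin.≟ v) refl

⁅⁆-≢ : ∀ {v w : Fin n} → v ≢ w → ⁅ v ⁆ w ≡ false
⁅⁆-≢ {v = v} {w} v≢w = dec-false (v Fin.≟ w) v≢w

⁅⁆-true : ∀ {v w : Fin n} → ⁅ v ⁆ w ≡ true → v ≡ w
⁅⁆-true {v = v} {w} p with v Fin.≟ w
... | yes v≡w = v≡w

extractBy : ∀ (f : Link V → ℕ) L → 0 < total f L → ∃ λ e → ∃ λ M → L ⟶ e ∷ M × 0 < f e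
extractBy f (e ∷ L) p with f e in eq
... | suc k = e , L , done , subst (0 <_) (sym eq) (s≤s z≤n)
... | zero with extractBy f L p
... | e′ , M , r , q = e′ , e ∷ M , keep e r ⟫ swap e e′ , q

cross-⁅⁆ : ∀ (v a b : Fin n) → 0 < cross (⁅ v ⁆ a) (⁅ v ⁆ b) → (v ≡ a × v ≢ b) ⊎ (v ≡ b × v ≢ a)
cross-⁅⁆ v a b p with v Fin.≟ a | v Fin.≟ b
... | yes v≡a | no v≢b = inj₁ (v≡a , v≢b)
... | no v≢a | yes v≡b = inj₂ (v≡b , v≢a)

extractSpoke : ∀ (v : Fin n) L → 0 < cut L ⁅ v ⁆ →
  ∃ λ k → ∃ λ w → ∃ λ M → L ⟶ spoke v k w ∷ M × v ≢ w
extractSpoke v L p with extractBy (crossing ⁅ v ⁆) L p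
... | free a b , M , r , q with cross-⁅⁆ v a b q
... | inj₁ (refl , v≢b) = free , b , M , r , v≢b
... | inj₂ (refl , v≢a) = free , a , M , r ⟫ flip a v , v≢a
extractSpoke v L p | fixed a b , M , r , q with cross-⁅⁆ v a b q
... | inj₁ (refl , v≢b) = outward , b , M , r , v≢b
... | inj₂ (refl , v≢a) = inward , a , M , r , v≢a

extractFree : ∀ (v : Fin n) L → 0 < freeCut L ⁅ v ⁆ →
  ∃ λ w → ∃ λ M → L ⟶ free v w ∷ M × v ≢ w
extractFree v L p with extractBy (freeCrossing ⁅ v ⁆) L p
... | free a b , M , r , q with cross-⁅⁆ v a b q
... | inj₁ (refl , v≢b) = b , M , r , v≢b
... | inj₂ (refl , v≢a) = a , M , r ⟫ flip a v , v≢a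

joining : Fin n → Fin n → Link (Fin n) → ℕ
joining u w (free a b) = if (⁅ u ⁆ a ∧ ⁅ w ⁆ b) ∨ (⁅ u ⁆ b ∧ ⁅ w ⁆ a) then 1 else 0
joining u w (fixed a b) = 0

multiplicity : List (Link (Fin n)) → Fin n → Fin n → ℕ
multiplicity L u w = total (joining u w) L

multiplicity-⟶ : ∀ (u w : Fin n) {L M} → L ⟶ M → multiplicity L u w ≡ multiplicity M u w
multiplicity-⟶ u w = total-⟶ λ a b →
  cong (if_then 1 else 0) (Bool.∨-comm (⁅ u ⁆ a ∧ ⁅ w ⁆ b) (⁅ u ⁆ b ∧ ⁅ w ⁆ a))

joining-refl : ∀ (u w : Fin n) → joining u w (free u w) ≡ 1
joining-refl u w rewrite ⁅⁆-refl u | ⁅⁆-refl w = refl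

joining-≤1 : ∀ (u w : Fin n) e → joining u w e ≤ 1
joining-≤1 u w (free a b) with (⁅ u ⁆ a ∧ ⁅ w ⁆ b) ∨ (⁅ u ⁆ b ∧ ⁅ w ⁆ a)
... | true  = s≤s z≤n
... | false = z≤n
joining-≤1 u w (fixed a b) = z≤n

extractJoining : ∀ (u w : Fin n) L → 0 < multiplicity L u w → ∃ λ M → L ⟶ free u w ∷ M
extractJoining u w L p with extractBy (joining u w) L p
... | free a b , M , r , q with u Fin.≟ a | w Fin.≟ b | u Fin.≟ b | w Fin.≟ a
... | yes refl | yes refl | _        | _        = M , r
... | yes refl | no _     | yes refl | yes refl = M , r
... | no _     | _        | yes refl | yes refl = M , r ⟫ flip a b
extractJoining u w L p | free a b , M , r , () | yes refl | no _ | yes refl | no _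
extractJoining u w L p | free a b , M , r , () | yes refl | no _ | no _     | _
extractJoining u w L p | free a b , M , r , () | no _ | _ | yes refl | no _
extractJoining u w L p | free a b , M , r , () | no _ | _ | no _     | _

-- Consequences of the degree bounds

opaque
  unfolding _⊕_

  -- Degree and 4 + |τ| have the same parity, so a degree that is not `small` exceeds 4 + |τ| by at
  -- least 2. That pays for two edges lost at equal value, and also for one edge lost in either
  -- direction, which raises |τ| by at most 1.
  slack⇒good⁻² : ∀ d h → small (2 + d) h ≡ false → good d h ≡ true
  slack⇒good⁻² d h p = modus (below8 (λ d h → not (small (2 + d) h) ⊃ good d h) (λ d h → refl) d h) (cong not p)

  slack⇒good⁻¹₁ : ∀ d h → small (suc d) h ≡ false → good d (1F ⊕ h) ≡ true
  slack⇒good⁻¹₁ d h p = modus (below8 (λ d h → not (small (suc d) h) ⊃ good d (1F ⊕ h)) (λ d h → refl) d h) (cong not p)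

  slack⇒good⁻¹₂ : ∀ d h → small (suc d) h ≡ false → good d (2F ⊕ h) ≡ true
  slack⇒good⁻¹₂ d h p = modus (below8 (λ d h → not (small (suc d) h) ⊃ good d (2F ⊕ h)) (λ d h → refl) d h) (cong not p)

  -- One edge fewer lowers |τ| by at most 1, so the upper bound survives.
  small⁻¹₂ : ∀ d h → small (suc d) h ≡ true → small d (2F ⊕ h) ≡ true
  small⁻¹₂ d h = modus (below8 (λ d h → small (suc d) h ⊃ small d (2F ⊕ h)) (λ d h → refl) d h)

  -- Here d = 4 + |τ| with τ ≠ 0, and an edge removed in the direction that moves τ towards 0 lowers
  -- both sides by 1.
  tight⇒up∨dn : ∀ d h → good d h ≡ true → small d h ≡ true → d ≢ 4 → up d h ∨ dn d h ≡ true
  tight⇒up∨dn 4 h g s d≢4 = contradiction refl d≢4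
  tight⇒up∨dn 5 1F g s d≢4 = refl
  tight⇒up∨dn 5 2F g s d≢4 = refl
  tight⇒up∨dn 6 1F g s d≢4 = refl
  tight⇒up∨dn 6 2F g s d≢4 = refl
  tight⇒up∨dn 7 0F g s d≢4 = refl
  tight⇒up∨dn 7 1F g () d≢4
  tight⇒up∨dn 7 2F g () d≢4
  tight⇒up∨dn (suc (suc (suc (suc (suc (suc (suc (suc d)))))))) h g () d≢4

  -- Modulo 3, subtracting 1 is adding 1 twice. The first addition leaves 4 + |τ| at most d - 1, by
  -- `up`; the second raises it by at most 1.
  up⇒good : ∀ d h → good d h ≡ true → up d h ≡ true → good d (2F ⊕ h) ≡ true
  up⇒good d h g = modus (modus (below8 (λ d h → good d h ⊃ up d h ⊃ good d (2F ⊕ h))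
    (λ d h → refl) d h) g)

good⇒slack⁺² : ∀ d h → good d h ≡ true → small (2 + d) h ≡ false
good⇒slack⁺² d h p = trans (sym (Bool.not-involutive _)) (cong not
  (modus (below8 (λ d h → good d h ⊃ not (small (2 + d) h)) (λ d h → refl) d h) p))

≤ᵇ-true : ∀ {m k} → (m ≤ᵇ k) ≡ true → m ≤ k
≤ᵇ-true {m} {k} p = ℕ.≤ᵇ⇒≤ m k (subst (λ b → T b) (sym p) _)

slack⇒6≤ : ∀ d h → small d h ≡ false → 6 ≤ d
slack⇒6≤ d h p = ≤ᵇ-true (modus (below8 (λ d h → not (small d h) ⊃ (6 ≤ᵇ d)) (λ d h → refl) d h) (cong not p))

good⇒4≤ : ∀ d h → good d h ≡ true → 4 ≤ d
good⇒4≤ d h p = ≤ᵇ-true (modus (below8 (λ d h → good d h ⊃ (4 ≤ᵇ d)) (λ d h → refl) d h) p)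

small⇒≤7 : ∀ d h → small d h ≡ true → d ≤ 7
small⇒≤7 d h p = ≤ᵇ-true (modus (below8 (λ d h → small d h ⊃ (d ≤ᵇ 7)) (λ d h → refl) d h) p)

6≤⇒good : ∀ d h → 6 ≤ d → good d h ≡ true
6≤⇒good _ h (s≤s (s≤s (s≤s (s≤s (s≤s (s≤s p)))))) = refl

≟-sound : ∀ {a b : Bool} → does (a Bool.≟ b) ≡ true → a ≡ b
≟-sound {a} {b} p with a Bool.≟ b
... | yes q = q

good-neg : ∀ d h → good d h ≡ good d (-₃ h)
good-neg d h = ≟-sound (below8 (λ d h → does (good d h Bool.≟ good d (-₃ h))) (λ d h → refl) d h)

small-neg : ∀ d h → small d h ≡ small d (-₃ h)
small-neg d h = ≟-sound (below8 (λ d h → does (small d h Bool.≟ small d (-₃ h))) (λ d h → refl) d h)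

∧-true : ∀ {a b} → a ∧ b ≡ true → a ≡ true × b ≡ true
∧-true {true} {true} _ = refl , refl

∧-intro : ∀ {a b} → a ≡ true → b ≡ true → a ∧ b ≡ true
∧-intro refl refl = refl

true≢false : ∀ {a} → a ≡ true → a ≡ false → ⊥
true≢false refl ()

≢-by : ∀ (S : Subset V) {v w} → S v ≡ true → S w ≡ false → v ≢ w
≢-by S p q refl = true≢false p q

-- Vertex sets

infixr 6 _∪_

_∪_ : Subset V → Subset V → Subset V
(S ∪ T) v = S v ∨ T v

opaque
  unfolding _⊕_

  flow-∨ : ∀ a b a′ b′ → a ∧ a′ ≡ false → b ∧ b′ ≡ false →
    flow (a ∨ a′) (b ∨ b′) ≡ flow a b ⊕ flow a′ b′
  flow-∨ true  true  false false p q = refl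
  flow-∨ true  false false true  p q = refl
  flow-∨ true  false false false p q = refl
  flow-∨ false true  true  false p q = refl
  flow-∨ false true  false false p q = refl
  flow-∨ false false true  true  p q = refl
  flow-∨ false false true  false p q = refl
  flow-∨ false false false true  p q = refl
  flow-∨ false false false false p q = refl

net-∪ : ∀ K (S T : Subset V) → (∀ v → S v ∧ T v ≡ false) → net K (S ∪ T) ≡ net K S ⊕ net K T
net-∪ K S T p = trans
  (total₃-cong (All.universal (λ (u , v) → flow-∨ (S u) (S v) (T u) (T v) (p u) (p v)) K))
  (total₃-+ (out S) (out T) K)

net-ext : ∀ K {S T : Subset V} → (∀ v → S v ≡ T v) → net K S ≡ net K T
net-ext K p = total₃-cong (All.universal (λ (u , v) → cong₂ flow (p u) (p v)) K)

cut-ext : ∀ L {S T : Subset V} → (∀ v → S v ≡ T v) → cut L S ≡ cut L T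
cut-ext L {S} {T} p = total-cong (All.universal eq L)
  where
  eq : ∀ e → crossing S e ≡ crossing T e
  eq (free u v)  = cong₂ cross (p u) (p v)
  eq (fixed u v) = cong₂ cross (p u) (p v)

ArcIn : Subset V → Arc V → Set
ArcIn S (u , v) = S u ≡ true × S v ≡ true

net-agree : ∀ {X S T : Subset V} {K} → All (ArcIn X) K → (∀ v → X v ≡ true → S v ≡ T v) →
  net K S ≡ net K T
net-agree p q = total₃-cong (All.map (λ (xu , xv) → cong₂ flow (q _ xu) (q _ xv)) p)

net-const : ∀ {X S : Subset V} {K} b → All (ArcIn X) K → (∀ v → X v ≡ true → S v ≡ b) → net K S ≡ 0F
net-const {K = K} b p q = trans (net-agree {T = λ _ → b} p q)
  (total₃-0 (out λ _ → b) (All.universal (λ _ → flow-refl b) K))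

net-++ : ∀ (K M : List (Arc V)) S → net (K ++ M) S ≡ net K S ⊕ net M S
net-++ K M S = total₃-++ (out S) K M

∨-∧-distinct : ∀ {u w : Fin n} → u ≢ w → ∀ v → ⁅ u ⁆ v ∧ ⁅ w ⁆ v ≡ false
∨-∧-distinct {u = u} {w} u≢w v with u Fin.≟ v | w Fin.≟ v
... | yes refl | yes refl = contradiction refl u≢w
... | yes _    | no _     = refl
... | no _     | _        = refl

card : Subset (Fin n) → ℕ
card S = Sub.∣ Vec.tabulate S ∣

card-< : ∀ {S T : Subset (Fin n)} → (∀ v → S v ≡ true → T v ≡ true) →
  ∀ v → T v ≡ true → S v ≡ false → card S < card T
card-< {S = S} {T} S⊆T v Tv Sv = Sub.p⊂q⇒∣p∣<∣q∣ {p = Vec.tabulate S} {Vec.tabulate T}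
  ( (λ {x} x∈S → Vec.lookup⇒[]= x _ (trans (Vec.lookup∘tabulate T x)
      (S⊆T x (trans (sym (Vec.lookup∘tabulate S x)) (Vec.[]=⇒lookup x∈S)))))
  , v , Vec.lookup⇒[]= v _ (trans (Vec.lookup∘tabulate T v) Tv)
  , λ v∈S → true≢false (trans (sym (Vec.lookup∘tabulate S v)) (Vec.[]=⇒lookup v∈S)) Sv )

-- The search runs over Boolean vectors, and a function is recovered from its table only up to
-- pointwise equality, which `P` therefore has to respect.
findSubset : ∀ {P : Subset (Fin n) → Set} → (∀ {S T} → (∀ v → S v ≡ T v) → P S → P T) →
  (∀ S → Dec (P S)) → Dec (∃ P)
findSubset {P = P} resp P? = map′ (λ (p , q) → _ , q)
  (λ (S , q) → Vec.tabulate S , resp (λ v → sym (Vec.lookup∘tabulate S v)) q)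
  (Sub.anySubset? (λ p → P? (Vec.lookup p)))

-- Contraction of a vertex set

⟶-shift : ∀ (I : List (Link V)) {R} e → e ∷ I ++ R ⟶ I ++ e ∷ R
⟶-shift []      e = done
⟶-shift (f ∷ I) e = swap e f ⟫ keep f (⟶-shift I e)

inside : Subset V → Link V → Bool
inside S (free u v)  = S u ∧ S v
inside S (fixed u v) = false

splitInside : ∀ (S : Subset V) L → ∃ λ I → ∃ λ R → L ⟶ I ++ R ×
  All (λ e → inside S e ≡ true) I × All (λ e → inside S e ≡ false) R
splitInside S [] = [] , [] , done , [] , []
splitInside S (e ∷ L) with splitInside S L | inside S e in eq
... | I , R , r , ins , outs | true  = e ∷ I , R , keep e r , eq ∷ ins , outs
... | I , R , r , ins , outs | false = I , e ∷ R , keep e r ⟫ ⟶-shift I e , ins , eq ∷ outs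

anyOrientation : ∀ (L : List (Link V)) → ∃ λ O → Oriented L O
anyOrientation []              = [] , []
anyOrientation (free u v ∷ L)  = let O , os = anyOrientation L in _ , forth ∷ os
anyOrientation (fixed u v ∷ L) = let O , os = anyOrientation L in _ , given ∷ os

orientation-inside : ∀ {S : Subset V} {I O} → Oriented I O → All (λ e → inside S e ≡ true) I →
  All (ArcIn S) O
orientation-inside []           []       = []
orientation-inside (forth ∷ os) (p ∷ ps) = ∧-true p ∷ orientation-inside os ps
orientation-inside (back ∷ os)  (p ∷ ps) = (let a , b = ∧-true p in b , a) ∷ orientation-inside os ps

cut-inside : ∀ {S T : Subset V} {I} b → All (λ e → inside S e ≡ true) I → (∀ v → S v ≡ true → T v ≡ b) →
  cut I T ≡ 0
cut-inside {S = S} {T} b p q = total-0 _ (All.map (λ {e} → eq e) p)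
  where
  eq : ∀ e → inside S e ≡ true → crossing T e ≡ 0
  eq (free u v) p with ∧-true {S u} p
  ... | Su , Sv = trans (cong₂ cross (q u Su) (q v Sv)) (cross-refl b)

orientation-unmap : ∀ (π : V → W) R {O} → Oriented (map (mapEdge π) R) O →
  ∃ λ O′ → Oriented R O′ × O ≡ map (mapArc π) O′
orientation-unmap π [] [] = [] , [] , refl
orientation-unmap π (free u v ∷ R) (forth ∷ os) with orientation-unmap π R os
... | O , os′ , refl = _ , forth ∷ os′ , refl
orientation-unmap π (free u v ∷ R) (back ∷ os) with orientation-unmap π R os
... | O , os′ , refl = _ , back ∷ os′ , refl
orientation-unmap π (fixed u v ∷ R) (given ∷ os) with orientation-unmap π R os
... | O , os′ , refl = _ , given ∷ os′ , refl

orientation-++ : ∀ {I R : List (Link V)} {O P} → Oriented I O → Oriented R P →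
  Oriented (I ++ R) (O ++ P)
orientation-++ = Pointwise.++⁺

collapse : Subset V → V → V → V
collapse A a v = if A v then a else v

collapse-in : ∀ (A : Subset V) a {v} → A v ≡ true → collapse A a v ≡ a
collapse-in A a p rewrite p = refl

collapse-out : ∀ (A : Subset V) a {v} → A v ≡ false → collapse A a v ≡ v
collapse-out A a p rewrite p = refl

⁅⁆-collapse-out : ∀ (A : Subset (Fin n)) {a v} → A a ≡ true → A v ≡ false →
  ∀ w → ⁅ v ⁆ (collapse A a w) ≡ ⁅ v ⁆ w
⁅⁆-collapse-out A Aa Av w with A w in eq
... | false = refl
... | true  = trans (⁅⁆-≢ (≢-sym (≢-by A Aa Av))) (sym (⁅⁆-≢ (≢-sym (≢-by A eq Av))))

⁅⁆-collapse-in : ∀ (A : Subset (Fin n)) {a} → A a ≡ true → ∀ w → ⁅ a ⁆ (collapse A a w) ≡ A w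
⁅⁆-collapse-in A {a} Aa w with A w in eq
... | true  = ⁅⁆-refl a
... | false = ⁅⁆-≢ (≢-by A Aa eq)

-- An orientation of R that meets the demand H once A has been contracted.
record Outer (A : Subset (Fin n)) (R : List (Link (Fin n))) (H : List (Arc (Fin n))) : Set where
  field
    arcs    : List (Arc (Fin n))
    orients : Oriented R arcs
    outside : ∀ v → A v ≡ false → net arcs ⁅ v ⁆ ⊕ net H ⁅ v ⁆ ≡ 0F
    across  : net arcs A ⊕ net H A ≡ 0F

-- Along `collapse A a` the singleton of a pulls back to A, and the singleton of a vertex outside A
-- to itself.
expand : ∀ (A : Subset (Fin n)) {a R H} → A a ≡ true →
  Solvable (map (mapEdge (collapse A a)) R) (map (mapArc (collapse A a)) H) → Outer A R H
expand A {a} {R} {H} Aa (solved O os eq) with orientation-unmap (collapse A a) R os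
... | O′ , os′ , refl = record
  { arcs    = O′
  ; orients = os′
  ; outside = λ v Av → trans (sym (cong₂ _⊕_ (pull O′ (⁅⁆-collapse-out A Aa Av)) (pull H (⁅⁆-collapse-out A Aa Av)))) (eq v)
  ; across  = trans (sym (cong₂ _⊕_ (pull O′ (⁅⁆-collapse-in A Aa)) (pull H (⁅⁆-collapse-in A Aa)))) (eq a)
  }
  where
  pull : ∀ K {S T} → (∀ w → S (collapse A a w) ≡ T w) → net (map (mapArc (collapse A a)) K) S ≡ net K T
  pull K p = trans (net-map (collapse A a) K _) (net-ext K p)

-- Arcs inside A do not affect a vertex outside A, so `outer` settles those vertices and only the
-- vertices of A remain.
solvable-split : ∀ (A : Subset (Fin n)) {L I R H} → L ⟶ I ++ R → All (λ e → inside A e ≡ true) I →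
  (outer : Outer A R H) → ∀ {O} → Oriented I O →
  (∀ v → A v ≡ true → net O ⁅ v ⁆ ⊕ (net (Outer.arcs outer) ⁅ v ⁆ ⊕ net H ⁅ v ⁆) ≡ 0F) → Solvable L H
solvable-split A {H = H} r ins outer {O} os eq = solvable-⟶ r (solved (O ++ arcs) (orientation-++ os orients) balance)
  where
  open Outer outer
  balance : ∀ v → net (O ++ arcs) ⁅ v ⁆ ⊕ net H ⁅ v ⁆ ≡ 0F
  balance v = trans (cong (_⊕ net H ⁅ v ⁆) (net-++ O arcs ⁅ v ⁆))
    (trans (⊕-assoc (net O ⁅ v ⁆) _ _) (sum v))
    where
    sum : ∀ v → net O ⁅ v ⁆ ⊕ (net arcs ⁅ v ⁆ ⊕ net H ⁅ v ⁆) ≡ 0F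
    sum v with A v in Av
    ... | true  = eq v Av
    ... | false = trans (cong₂ _⊕_ (net-const false (orientation-inside os ins)
                    (λ w Aw → ⁅⁆-≢ (≢-sym (≢-by A Aw Av)))) (outside v Av)) (⊕-identityˡ 0F)

opaque
  unfolding _⊕_

  -- Two edges contribute 2, 0 or -2 at an end, which are all residues modulo 3.
  fix₂ : ∀ (u w : V) c → ∃ λ a → ∃ λ b → Orients (free u w) a × Orients (free u w) b ×
    (∀ S → S u ≡ true → S w ≡ false → out S a ⊕ (out S b ⊕ c) ≡ 0F)
  fix₂ u w 0F = _ , _ , forth , back , λ S p q → lemma S p q
    where
    lemma : ∀ S → S u ≡ true → S w ≡ false → out S (u , w) ⊕ (out S (w , u) ⊕ 0F) ≡ 0F
    lemma S p q rewrite p | q = refl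
  fix₂ u w 1F = _ , _ , forth , forth , λ S p q → lemma S p q
    where
    lemma : ∀ S → S u ≡ true → S w ≡ false → out S (u , w) ⊕ (out S (u , w) ⊕ 1F) ≡ 0F
    lemma S p q rewrite p | q = refl
  fix₂ u w 2F = _ , _ , back , back , λ S p q → lemma S p q
    where
    lemma : ∀ S → S u ≡ true → S w ≡ false → out S (w , u) ⊕ (out S (w , u) ⊕ 2F) ≡ 0F
    lemma S p q rewrite p | q = refl

  fix₃ : ∀ (v a b c : V) h → ∃ λ x → ∃ λ y → ∃ λ w →
    Orients (free v a) x × Orients (free v b) y × Orients (free v c) w ×
    (∀ S → S v ≡ true → S a ≡ false → S b ≡ false → S c ≡ false → out S x ⊕ (out S y ⊕ (out S w ⊕ h)) ≡ 0F)
  fix₃ v a b c 0F = _ , _ , _ , forth , forth , forth , lemma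
    where
    lemma : ∀ S → S v ≡ true → S a ≡ false → S b ≡ false → S c ≡ false →
      out S (v , a) ⊕ (out S (v , b) ⊕ (out S (v , c) ⊕ 0F)) ≡ 0F
    lemma S p q r s rewrite p | q | r | s = refl
  fix₃ v a b c 1F = _ , _ , _ , forth , back , back , lemma
    where
    lemma : ∀ S → S v ≡ true → S a ≡ false → S b ≡ false → S c ≡ false →
      out S (v , a) ⊕ (out S (b , v) ⊕ (out S (c , v) ⊕ 1F)) ≡ 0F
    lemma S p q r s rewrite p | q | r | s = refl
  fix₃ v a b c 2F = _ , _ , _ , forth , forth , back , lemma
    where
    lemma : ∀ S → S v ≡ true → S a ≡ false → S b ≡ false → S c ≡ false →
      out S (v , a) ⊕ (out S (v , b) ⊕ (out S (c , v) ⊕ 2F)) ≡ 0F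
    lemma S p q r s rewrite p | q | r | s = refl

-- Two parallel edges take every value at one of their ends, so they can be
-- contracted.
solvable-parallel : ∀ {u w : Fin n} {L M I R H} → u ≢ w → L ⟶ free u w ∷ free u w ∷ M → M ⟶ I ++ R →
  All (λ e → inside (⁅ u ⁆ ∪ ⁅ w ⁆) e ≡ true) I →
  Solvable (map (mapEdge (collapse (⁅ u ⁆ ∪ ⁅ w ⁆) u)) R) (map (mapArc (collapse (⁅ u ⁆ ∪ ⁅ w ⁆) u)) H) →
  Solvable L H
solvable-parallel {u = u} {w} {I = I} {R} {H} u≢w r s ins sol =
  solvable-split A (r ⟫ keep _ (keep _ s)) (uw ∷ uw ∷ ins) outer (oa ∷ ob ∷ os) balance
  where
  A = ⁅ u ⁆ ∪ ⁅ w ⁆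
  Au : A u ≡ true
  Au = cong (_∨ ⁅ w ⁆ u) (⁅⁆-refl u)
  Aw : A w ≡ true
  Aw = trans (cong (⁅ u ⁆ w ∨_) (⁅⁆-refl w)) (Bool.∨-zeroʳ _)
  uw : inside A (free u w) ≡ true
  uw = ∧-intro Au Aw
  outer = expand A Au sol
  open Outer outer
  O = proj₁ (anyOrientation I)
  os = proj₂ (anyOrientation I)
  fixing = fix₂ u w (net O ⁅ u ⁆ ⊕ (net arcs ⁅ u ⁆ ⊕ net H ⁅ u ⁆))
  a = proj₁ fixing
  b = proj₁ (proj₂ fixing)
  oa = proj₁ (proj₂ (proj₂ fixing))
  ob = proj₁ (proj₂ (proj₂ (proj₂ fixing)))
  fix = proj₂ (proj₂ (proj₂ (proj₂ fixing)))
  K = a ∷ b ∷ O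
  sum : Subset (Fin _) → ℤ₃
  sum S = net K S ⊕ (net arcs S ⊕ net H S)
  sum-u : sum ⁅ u ⁆ ≡ 0F
  sum-u = trans (⊕-assoc (out ⁅ u ⁆ a) _ _) (trans (cong (out ⁅ u ⁆ a ⊕_) (⊕-assoc (out ⁅ u ⁆ b) _ _))
    (fix ⁅ u ⁆ (⁅⁆-refl u) (⁅⁆-≢ u≢w)))
  sum-A : sum A ≡ 0F
  sum-A = trans (cong₂ _⊕_ (net-const true (orientation-inside (oa ∷ ob ∷ os) (uw ∷ uw ∷ ins)) (λ _ p → p)) across)
    (⊕-identityˡ 0F)
  sum-∪ : sum A ≡ sum ⁅ u ⁆ ⊕ sum ⁅ w ⁆
  sum-∪ = trans (cong₂ _⊕_ (net-∪ K _ _ d) (trans (cong₂ _⊕_ (net-∪ arcs _ _ d) (net-∪ H _ _ d))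
    (⊕-interchange (net arcs ⁅ u ⁆) _ _ _))) (⊕-interchange (net K ⁅ u ⁆) _ _ _)
    where d = ∨-∧-distinct u≢w
  -- The pair is balanced as a whole and u has been balanced by the two parallel edges, so w is
  -- balanced too.
  sum-w : sum ⁅ w ⁆ ≡ 0F
  sum-w = trans (sym (⊕-identityˡ _)) (trans (cong (_⊕ sum ⁅ w ⁆) (sym sum-u)) (trans (sym sum-∪) sum-A))
  balance : ∀ v → A v ≡ true → sum ⁅ v ⁆ ≡ 0F
  balance v p with u Fin.≟ v | w Fin.≟ v
  ... | yes refl | _        = sum-u
  ... | no _     | yes refl = sum-w

opaque
  unfolding _⊕_

  ones : ℕ → ℤ₃
  ones zero    = 0F
  ones (suc d) = 1F ⊕ ones d

  -- If all d edges at z leave it, then τ is congruent to -d modulo 6, and d ≤ 4 + |τ| forces d ≤ 5.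
  -- Up to degree 6 the bound fails only for degree 6 and value 0, but d = 5 comes with value 1.
  small⁺¹ : ∀ d h → ones d ⊕ h ≡ 0F → small d h ≡ true → small (suc d) h ≡ true
  small⁺¹ d h p s with ⊕-zeroˡ⇒neg (ones d) h p
  ... | refl = modus (below8 (λ d h → small d (-₃ ones d) ⊃ small (suc d) (-₃ ones d)) (λ d h → refl) d h) s

  ones-zero : ones 0 ≡ 0F
  ones-zero = refl

  ones-suc : ∀ d → ones (suc d) ≡ 1F ⊕ ones d
  ones-suc d = refl

  1+1≡2 : 1F ⊕ 1F ≡ 2F
  1+1≡2 = refl

  2+2≡1 : ∀ a → 2F ⊕ (2F ⊕ a) ≡ 1F ⊕ a
  2+2≡1 0F = refl
  2+2≡1 1F = refl
  2+2≡1 2F = refl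

Uniform : Subset V → Link V → Set
Uniform P (free x y)  = P x ≡ P y
Uniform P (fixed x y) = ⊤

findEdge : ∀ {P : Link V → Set} → (∀ e → Dec (P e)) → ∀ L →
  (∃ λ e → ∃ λ M → L ⟶ e ∷ M × P e) ⊎ All (¬_ ∘ P) L
findEdge P? [] = inj₂ []
findEdge P? (e ∷ L) with P? e | findEdge P? L
... | yes p | _                      = inj₁ (e , L , done , p)
... | no _  | inj₁ (f , M , r , p)   = inj₁ (f , e ∷ M , keep e r ⟫ swap e f , p)
... | no ¬p | inj₂ ps                = inj₂ (¬p ∷ ps)

total≡0⇒All : ∀ (f : V → ℕ) {L} → total f L ≡ 0 → All (λ x → f x ≡ 0) L
total≡0⇒All f {[]}    p = []
total≡0⇒All f {x ∷ L} p = ℕ.m+n≡0⇒m≡0 (f x) p ∷ total≡0⇒All f (ℕ.m+n≡0⇒n≡0 (f x) p)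

-- Lifting, prescribing and mirroring edges

crossing-spoke : ∀ (S : Subset V) v k u → crossing S (spoke v k u) ≡ cross (S v) (S u)
crossing-spoke S v free    u = refl
crossing-spoke S v outward u = refl
crossing-spoke S v inward  u = cross-sym (S u) (S v)

crossing-lifted : ∀ (S : Subset V) k w u → crossing S (lifted k w u) ≡ cross (S w) (S u)
crossing-lifted S free    w u = refl
crossing-lifted S outward w u = refl
crossing-lifted S inward  w u = cross-sym (S u) (S w)

fixedOut-lifted : ∀ (S : Subset V) k {v w} u → S v ≡ S w →
  fixedOut S (spoke v k u) ≡ fixedOut S (lifted k w u)
fixedOut-lifted S free    u p = refl
fixedOut-lifted S outward u p = cong (λ b → flow b (S u)) p
fixedOut-lifted S inward  u p = cong (flow (S u)) p

weigh-lifted : ∀ k (v w u : V) → weigh (lifted k w u) ≡ weigh (spoke v k u)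
weigh-lifted free    v w u = refl
weigh-lifted outward v w u = refl
weigh-lifted inward  v w u = refl

cut-lift : ∀ (S : Subset V) {v w} k {u M} →
  cut (free v w ∷ spoke v k u ∷ M) S ≡ cut (lifted k w u ∷ M) S
  ⊎ ((S v ≡ false × S w ≡ true × S u ≡ true) ⊎ (S v ≡ true × S w ≡ false × S u ≡ false))
    × cut (free v w ∷ spoke v k u ∷ M) S ≡ 2 + cut (lifted k w u ∷ M) S
cut-lift S {v} {w} k {u} {M} rewrite crossing-spoke S v k u | crossing-lifted S k w u
  with S v | S w | S u
... | true  | true  | true  = inj₁ refl
... | true  | true  | false = inj₁ refl
... | true  | false | true  = inj₁ refl
... | true  | false | false = inj₂ (inj₂ (refl , refl , refl) , refl)
... | false | true  | true  = inj₂ (inj₁ (refl , refl , refl) , refl)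
... | false | true  | false = inj₁ refl
... | false | false | true  = inj₁ refl
... | false | false | false = inj₁ refl

toFixed : Arc V → Link V
toFixed (u , v) = fixed u v

cut-oriented : ∀ (π : V → V) {R O} S → Oriented R O → cut (map toFixed (map (mapArc π) O)) S ≡ cut R (S ∘ π)
cut-oriented π S []           = refl
cut-oriented π S (forth ∷ os) = cong (_ +_) (cut-oriented π S os)
cut-oriented π S (_∷_ {x = free u v} back os) = cong₂ _+_ (cross-sym (S (π v)) (S (π u))) (cut-oriented π S os)
cut-oriented π S (given ∷ os) = cong (_ +_) (cut-oriented π S os)

fixedNet-toFixed : ∀ (K : List (Arc V)) S → fixedNet (map toFixed K) S ≡ net K S
fixedNet-toFixed K S = total₃-map (fixedOut S) toFixed K

orientation-toFixed : ∀ {K O : List (Arc V)} → Oriented (map toFixed K) O → O ≡ K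
orientation-toFixed {K = []} [] = refl
orientation-toFixed {K = _ ∷ _} (given ∷ os) = cong (_ ∷_) (orientation-toFixed os)

orientation-++⁻ : ∀ (I : List (Link V)) {K O} → Oriented (I ++ map toFixed K) O →
  ∃ λ P → Oriented I P × O ≡ P ++ K
orientation-++⁻ []      os       = [] , [] , orientation-toFixed os
orientation-++⁻ (e ∷ I) (o ∷ os) = let P , ps , eq = orientation-++⁻ I os in _ , o ∷ ps , cong (_ ∷_) eq

inside-agree : ∀ {S T A : Subset V} {I} → All (λ e → inside A e ≡ true) I → (∀ v → A v ≡ true → S v ≡ T v) →
  cut I S ≡ cut I T
inside-agree {S = S} {T} {A} p q = total-cong (All.map (λ {e} → eq e) p)
  where
  eq : ∀ e → inside A e ≡ true → crossing S e ≡ crossing T e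
  eq (free u v) p with ∧-true {A u} p
  ... | Au , Av = cong₂ cross (q u Au) (q v Av)

fixedNet-inside : ∀ {A : Subset V} {I} S → All (λ e → inside A e ≡ true) I → fixedNet I S ≡ 0F
fixedNet-inside {A = A} S p = total₃-0 (fixedOut S) (All.map (λ {e} → eq e) p)
  where
  eq : ∀ e → inside A e ≡ true → fixedOut S e ≡ 0F
  eq (free u v) p = refl

cut-lifted-in : ∀ {V : Set} (T : Subset V) k₁ k₂ {w₁ u₁ w₂ u₂ M} → T w₁ ≡ true → T u₁ ≡ true → T w₂ ≡ true → T u₂ ≡ true →
  cut (lifted k₁ w₁ u₁ ∷ lifted k₂ w₂ u₂ ∷ M) T ≡ cut M T
cut-lifted-in T k₁ k₂ {w₁} {u₁} {w₂} {u₂} {M} p q p′ q′ = trans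
  (cong₂ (λ a b → a + (b + cut M T)) (crossing-lifted T k₁ w₁ u₁) (crossing-lifted T k₂ w₂ u₂))
  (trans (cong₂ (λ a b → a + (b + cut M T)) (cong₂ cross p q) (cong₂ cross p′ q′)) refl)

cut-spokes-in : ∀ {V : Set} (T : Subset V) k₁ k₂ {v w₁ u₁ w₂ u₂ M} → T v ≡ true →
  T w₁ ≡ true → T u₁ ≡ true → T w₂ ≡ true → T u₂ ≡ true →
  cut (free v w₁ ∷ spoke v k₁ u₁ ∷ free v w₂ ∷ spoke v k₂ u₂ ∷ M) T ≡ cut M T
cut-spokes-in T k₁ k₂ {v} {w₁} {u₁} {w₂} {u₂} {M} t p q p′ q′ = cong₂ _+_ (cong₂ cross t p)
  (cong₂ _+_ (trans (crossing-spoke T v k₁ u₁) (cong₂ cross t q))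
    (cong₂ _+_ (cong₂ cross t p′) (cong (_+ cut M T) (trans (crossing-spoke T v k₂ u₂) (cong₂ cross t q′)))))

mirror : Link V → Link V
mirror (free u v)  = free u v
mirror (fixed u v) = fixed v u

flipArc : Arc V → Arc V
flipArc (u , v) = v , u

crossing-mirror : ∀ (S : Subset V) e → crossing S (mirror e) ≡ crossing S e
crossing-mirror S (free u v)  = refl
crossing-mirror S (fixed u v) = cross-sym (S v) (S u)

fixedOut-mirror : ∀ (S : Subset V) e → fixedOut S (mirror e) ≡ -₃ fixedOut S e
fixedOut-mirror S (free u v)  = refl
fixedOut-mirror S (fixed u v) = flow-neg (S u) (S v)

cut-mirror : ∀ (L : List (Link V)) S → cut (map mirror L) S ≡ cut L S
cut-mirror L S = trans (total-map (crossing S) mirror L) (total-cong (All.universal (crossing-mirror S) L))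

weight-mirror : ∀ (L : List (Link V)) → weight (map mirror L) ≡ weight L
weight-mirror L = trans (total-map weigh mirror L) (total-cong (All.universal eq L))
  where
  eq : ∀ e → weigh (mirror e) ≡ weigh e
  eq (free u v)  = refl
  eq (fixed u v) = refl

fixedNet-mirror : ∀ (L : List (Link V)) S → fixedNet (map mirror L) S ≡ -₃ fixedNet L S
fixedNet-mirror L S = trans (total₃-map (fixedOut S) mirror L)
  (trans (total₃-cong (All.universal (fixedOut-mirror S) L)) (total₃-- (fixedOut S) L))

net-flip : ∀ (K : List (Arc V)) S → net (map flipArc K) S ≡ -₃ net K S
net-flip K S = trans (total₃-map (out S) flipArc K)
  (trans (total₃-cong (All.universal (λ (u , v) → flow-neg (S u) (S v)) K)) (total₃-- (out S) K))

solvable-mirror : ∀ {n} {L : List (Link (Fin n))} {H} → Solvable (map mirror L) (map flipArc H) → Solvable L H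
solvable-mirror {L = L} {H} (solved O os eq) = solved (map flipArc O) (unmirror L os) λ v → begin
  net (map flipArc O) ⁅ v ⁆ ⊕ net H ⁅ v ⁆           ≡⟨ cong₂ _⊕_ (net-flip O ⁅ v ⁆) (flipped v) ⟩
  -₃ net O ⁅ v ⁆ ⊕ -₃ net (map flipArc H) ⁅ v ⁆     ≡⟨ -₃-⊕ (net O ⁅ v ⁆) _ ⟨
  -₃ (net O ⁅ v ⁆ ⊕ net (map flipArc H) ⁅ v ⁆)      ≡⟨ cong -₃_ (eq v) ⟩
  0F                                                ∎
  where
  open ≡-Reasoning
  flipped : ∀ v → net H ⁅ v ⁆ ≡ -₃ net (map flipArc H) ⁅ v ⁆
  flipped v = trans (sym (-₃-involutive _)) (cong -₃_ (sym (net-flip H ⁅ v ⁆)))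
  unmirror : ∀ L {O} → Oriented (map mirror L) O → Oriented L (map flipArc O)
  unmirror []              []           = []
  unmirror (free u v ∷ L)  (forth ∷ os) = back ∷ unmirror L os
  unmirror (free u v ∷ L)  (back ∷ os)  = forth ∷ unmirror L os
  unmirror (fixed u v ∷ L) (given ∷ os) = given ∷ unmirror L os

opaque
  unfolding _⊕_

  up-neg : ∀ d h → up d (-₃ h) ≡ dn d h
  up-neg d h = trans (good-neg (pred d) (1F ⊕ -₃ h)) (cong (good (pred d)) (eq h))
    where
    eq : ∀ h → -₃ (1F ⊕ -₃ h) ≡ 2F ⊕ h
    eq 0F = refl
    eq 1F = refl
    eq 2F = refl

-- Sets of several vertices, and removal of a vertex

Meets Twice : Subset (Fin n) → Subset (Fin n) → Set
Meets X A = ∃ λ v → X v ≡ true × A v ≡ true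
Twice X A = ∃ λ v → ∃ λ w → X v ≡ true × X w ≡ true × A v ≡ true × A w ≡ true × v ≢ w

one-or-twice : ∀ {n} {X A : Subset (Fin n)} x → X x ≡ true → A x ≡ true → Twice X A ⊎ (∀ v → X v ≡ true → A v ≡ ⁅ x ⁆ v)
one-or-twice {X = X} {A} x Xx Ax with any? (λ v → (X v Bool.≟ true) ×-dec (A v Bool.≟ true) ×-dec ¬? (x Fin.≟ v))
... | yes (v , Xv , Av , x≢v) = inj₁ (x , v , Xx , Xv , Ax , Av , x≢v)
... | no none = inj₂ agree
  where
  agree : ∀ v → X v ≡ true → A v ≡ ⁅ x ⁆ v
  agree v Xv with x Fin.≟ v
  ... | yes refl = Ax
  ... | no x≢v with A v in Av
  ... | true  = contradiction (v , Xv , Av , x≢v) none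
  ... | false = refl

twice? : ∀ (X A : Subset (Fin n)) → Dec (Twice X A)
twice? X A = any? λ v → any? λ w → (X v Bool.≟ true) ×-dec (X w Bool.≟ true) ×-dec
  (A v Bool.≟ true) ×-dec (A w Bool.≟ true) ×-dec ¬? (v Fin.≟ w)

infixl 7 _∖_

_∖_ : Subset (Fin n) → Fin n → Subset (Fin n)
(A ∖ v) w = A w ∧ not (⁅ v ⁆ w)

∖-self : ∀ (A : Subset (Fin n)) v → (A ∖ v) v ≡ false
∖-self A v = trans (cong (λ b → A v ∧ not b) (⁅⁆-refl v)) (Bool.∧-zeroʳ _)

∖-≢ : ∀ (A : Subset (Fin n)) {v w} → v ≢ w → (A ∖ v) w ≡ A w
∖-≢ A v≢w = trans (cong (λ b → A _ ∧ not b) (⁅⁆-≢ v≢w)) (Bool.∧-identityʳ _)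

∖-true : ∀ (A : Subset (Fin n)) {v w} → (A ∖ v) w ≡ true → A w ≡ true × v ≢ w
∖-true A {v} {w} p = proj₁ (∧-true p) , λ { refl → true≢false (proj₂ (∧-true {A w} p)) (cong not (⁅⁆-refl v)) }

∖-intro : ∀ (A : Subset (Fin n)) {v w} → A w ≡ true → v ≢ w → (A ∖ v) w ≡ true
∖-intro A Aw v≢w = trans (∖-≢ A v≢w) Aw

∖-card : ∀ (A : Subset (Fin n)) {v} → A v ≡ true → card (A ∖ v) < card A
∖-card A {v} Av = card-< (λ w p → proj₁ (∖-true A {v} p)) v Av (∖-self A v)

net-collapse-out : ∀ H (A : Subset (Fin n)) v {p} → A p ≡ false → net (map (mapArc (collapse ⁅ v ⁆ p)) H) A ≡ net H (A ∖ v)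
net-collapse-out H A v {p} Ap = trans (net-map (collapse ⁅ v ⁆ p) H A) (net-ext H eq)
  where
  eq : ∀ w → A (collapse ⁅ v ⁆ p w) ≡ (A ∖ v) w
  eq w with v Fin.≟ w
  ... | yes refl = trans Ap (sym (Bool.∧-zeroʳ _))
  ... | no _     = sym (Bool.∧-identityʳ _)

-- The preimage of p is the pair of p and v, in which v contributes 0.
net-collapse : ∀ H {v p : Fin n} → p ≢ v → net H ⁅ v ⁆ ≡ 0F →
  ∀ i → net (map (mapArc (collapse ⁅ v ⁆ p)) H) ⁅ i ⁆ ≡ net H ⁅ i ⁆
net-collapse H {v} {p} p≢v met i with p Fin.≟ i
... | yes refl = trans (net-map (collapse ⁅ v ⁆ p) H ⁅ p ⁆) (trans (net-ext H eq)
  (trans (net-∪ H ⁅ p ⁆ ⁅ v ⁆ (∨-∧-distinct p≢v)) (trans (cong (net H ⁅ p ⁆ ⊕_) met) (⊕-identityʳ _))))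
  where
  eq : ∀ w → ⁅ p ⁆ (collapse ⁅ v ⁆ p w) ≡ (⁅ p ⁆ ∪ ⁅ v ⁆) w
  eq w with v Fin.≟ w
  ... | yes refl = trans (⁅⁆-refl p) (sym (Bool.∨-zeroʳ _))
  ... | no _     = sym (Bool.∨-identityʳ _)
... | no p≢i with v Fin.≟ i
... | yes refl = trans (net-collapse-out H ⁅ v ⁆ v (⁅⁆-≢ (≢-sym p≢i)))
  (trans (net-ext H {T = λ _ → false} (λ w → Bool.∧-inverseʳ (⁅ v ⁆ w)))
    (trans (total₃-0 (out λ _ → false) (All.universal (λ _ → refl) H)) (sym met)))
... | no v≢i = trans (net-collapse-out H ⁅ i ⁆ v (⁅⁆-≢ (≢-sym p≢i))) (net-ext H eq)
  where
  eq : ∀ w → (⁅ i ⁆ ∖ v) w ≡ ⁅ i ⁆ w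
  eq w with v Fin.≟ w
  ... | yes refl = trans (Bool.∧-zeroʳ _) (sym (⁅⁆-≢ (≢-sym v≢i)))
  ... | no _     = Bool.∧-identityʳ _

within : Subset (Fin n) → Fin n → Subset (Fin n) → Subset (Fin n)
within A a X w = X w ∧ (not (A w) ∨ ⁅ a ⁆ w)

-- The vertices that are left after A has been contracted to a.
module Within {n : ℕ} {X A : Subset (Fin n)} {a : Fin n} (Xa : X a ≡ true) (Aa : A a ≡ true) where

  π : Fin n → Fin n
  π = collapse A a

  X₁ : Subset (Fin n)
  X₁ = within A a X

  X₁-π : ∀ {v} → X v ≡ true → X₁ (π v) ≡ true
  X₁-π {v} Xv with A v in Av
  ... | true  = ∧-intro Xa (trans (cong (not (A a) ∨_) (⁅⁆-refl a)) (Bool.∨-zeroʳ _))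
  ... | false = ∧-intro Xv (cong (λ b → not b ∨ ⁅ a ⁆ v) Av)

  π≢π : ∀ {u v} → u ≢ v → A u ∧ A v ≡ false → π u ≢ π v
  π≢π {u} {v} u≢v p with A u in Au | A v in Av
  ... | true  | false = ≢-by A Aa Av
  ... | false | true  = ≢-sym (≢-by A Aa Au)
  ... | false | false = u≢v

  X₁⊆X : ∀ {v} → X₁ v ≡ true → X v ≡ true
  X₁⊆X p = proj₁ (∧-true p)

  X₁-fixed : ∀ {v} → X₁ v ≡ true → π v ≡ v
  X₁-fixed {v} p with A v
  ... | false = refl
  ... | true  = ⁅⁆-true (proj₂ (∧-true p))

  const-on-A : ∀ (S : Subset (Fin n)) {v} → A v ≡ true → S (π v) ≡ S a
  const-on-A S Av = cong S (collapse-in A a Av)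

  X₁-< : ∀ {b} → X b ≡ true → A b ≡ true → a ≢ b → card X₁ < card X
  X₁-< {b} Xb Ab a≢b = card-< (λ v → X₁⊆X) b Xb
    (trans (cong₂ (λ p q → X b ∧ (not p ∨ q)) Ab (⁅⁆-≢ a≢b)) (Bool.∧-zeroʳ (X b)))

-- The theorem of Lovász, Thomassen, Wu and Zhang, in which the orientation
-- of all edges at the vertex z is prescribed.  X is the set of vertices.
module PartialOrientation {n : ℕ} (z : Fin n) where

  -- Instances with prescribed edges at z

  data Valid (X : Subset (Fin n)) : Link (Fin n) → Set where
    free : ∀ {u v} → X u ≡ true → X v ≡ true → z ≢ u → z ≢ v → u ≢ v → Valid X (free u v)
    away : ∀ {v} → X v ≡ true → Valid X (fixed z v)
    to   : ∀ {v} → X v ≡ true → Valid X (fixed v z)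

  valid-sym : ∀ {u v} → Valid X (free u v) → Valid X (free v u)
  valid-sym (free Xu Xv zu zv u≢v) = free Xv Xu zv zu (≢-sym u≢v)

  -- The set of all vertices other than z has the cut of z, which is bounded from above; a lower
  -- bound is asked only of sets that leave out some further vertex.
  Misses : Subset (Fin n) → Subset (Fin n) → Set
  Misses X A = ∃ λ v → X v ≡ true × z ≢ v × A v ≡ false

  -- The value prescribed at A is `net H A`, and it vanishes on X as a whole because every arc of
  -- `H` lies in X. At z nothing is left to orient, so there the prescribed edges must already meet
  -- the demand.
  record Hyp (X : Subset (Fin n)) (L : List (Link (Fin n))) (H : List (Arc (Fin n))) : Set where
    field
      z∈X     : X z ≡ true
      well-formed : All (Valid X) L
      demand  : All (ArcIn X) H
      balance : fixedNet L ⁅ z ⁆ ⊕ net H ⁅ z ⁆ ≡ 0F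
      z-small : small (cut L ⁅ z ⁆) (net H ⁅ z ⁆) ≡ true
      sets    : ∀ A → A z ≡ false → Meets X A → Misses X A → good (cut L A) (net H A) ≡ true

  Slack Tight : Subset (Fin n) → List (Link (Fin n)) → List (Arc (Fin n)) → Set
  Slack X L H = ∀ A → A z ≡ false → Twice X A → Misses X A → small (cut L A) (net H A) ≡ false
  Tight X L H = ∀ v → X v ≡ true → z ≢ v → small (cut L ⁅ v ⁆) (net H ⁅ v ⁆) ≡ true

  -- At least two vertices besides z, stated so that for each v both `⁅ v ⁆` and `rest v` fall under
  -- the hypothesis on sets.
  Others : Subset (Fin n) → Set
  Others X = ∀ v → ∃ λ w → X w ≡ true × z ≢ w × v ≢ w

  Simple : List (Link (Fin n)) → Set
  Simple L = ∀ {v w M} → L ⟶ free v w ∷ free v w ∷ M → ⊥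

  cut-agree : ∀ {S T L} → X z ≡ true → All (Valid X) L → (∀ v → X v ≡ true → S v ≡ T v) → cut L S ≡ cut L T
  cut-agree {S = S} {T} Xz ok p = total-cong (All.map eq ok)
    where
    eq : ∀ {e} → Valid _ e → crossing S e ≡ crossing T e
    eq (free Xu Xv _ _ _) = cong₂ cross (p _ Xu) (p _ Xv)
    eq (away Xv)          = cong₂ cross (p _ Xz) (p _ Xv)
    eq (to Xv)            = cong₂ cross (p _ Xv) (p _ Xz)

  rest : Fin n → Subset (Fin n)
  rest v w = not (⁅ z ⁆ w ∨ ⁅ v ⁆ w)

  -- The fixed edges at v are those between z and v. They count at z and at v but do not leave the
  -- set of remaining vertices; every other edge counts equally often on both sides.
  cut-rest : ∀ {L v} → All (Valid X) L → z ≢ v →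
    cut L (rest v) + total (λ e → fixedCrossing ⁅ v ⁆ e + fixedCrossing ⁅ v ⁆ e) L ≡ cut L ⁅ z ⁆ + cut L ⁅ v ⁆
  cut-rest {v = v} ok z≢v = total-sum (All.map eq ok)
    where
    bits : ∀ p q → p ∧ q ≡ false → cross false (not (p ∨ q)) + (cross false q + cross false q) ≡ cross true p + cross false q
    bits true  false _ = refl
    bits false true  _ = refl
    bits false false _ = refl
    eq : ∀ {e} → Valid _ e → crossing (rest v) e + (fixedCrossing ⁅ v ⁆ e + fixedCrossing ⁅ v ⁆ e)
      ≡ crossing ⁅ z ⁆ e + crossing ⁅ v ⁆ e
    eq {free a b} (free _ _ z≢a z≢b _) rewrite ⁅⁆-≢ z≢a | ⁅⁆-≢ z≢b =
      trans (ℕ.+-identityʳ _) (cross-not (⁅ v ⁆ a) (⁅ v ⁆ b))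
    eq {fixed _ b} (away _) rewrite ⁅⁆-refl z | ⁅⁆-≢ (≢-sym z≢v) = bits (⁅ z ⁆ b) (⁅ v ⁆ b) (∨-∧-distinct z≢v b)
    eq {fixed b _} (to _) rewrite ⁅⁆-refl z | ⁅⁆-≢ (≢-sym z≢v)
      | cross-sym (not (⁅ z ⁆ b ∨ ⁅ v ⁆ b)) false | cross-sym (⁅ v ⁆ b) false | cross-sym (⁅ z ⁆ b) true =
      bits (⁅ z ⁆ b) (⁅ v ⁆ b) (∨-∧-distinct z≢v b)

  net-rest : ∀ H {v} → z ≢ v → net H (rest v) ≡ -₃ (net H ⁅ z ⁆ ⊕ net H ⁅ v ⁆)
  net-rest H {v} z≢v = trans (net-not H (⁅ z ⁆ ∪ ⁅ v ⁆)) (cong -₃_ (net-∪ H ⁅ z ⁆ ⁅ v ⁆ (∨-∧-distinct z≢v)))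

  rest-z : ∀ v → rest v z ≡ false
  rest-z v rewrite ⁅⁆-refl z = refl

  rest-v : ∀ v → rest v v ≡ false
  rest-v v rewrite ⁅⁆-refl v | Bool.∨-zeroʳ (⁅ z ⁆ v) = refl

  rest-true : ∀ {v w} → z ≢ w → v ≢ w → rest v w ≡ true
  rest-true z≢w v≢w rewrite ⁅⁆-≢ z≢w | ⁅⁆-≢ v≢w = refl

  arcs-valid : ∀ {L O} → X z ≡ true → All (Valid X) L → Oriented L O → All (ArcIn X) O
  arcs-valid Xz []                     []           = []
  arcs-valid Xz (free Xu Xv _ _ _ ∷ p) (forth ∷ os) = (Xu , Xv) ∷ arcs-valid Xz p os
  arcs-valid Xz (free Xu Xv _ _ _ ∷ p) (back ∷ os)  = (Xv , Xu) ∷ arcs-valid Xz p os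
  arcs-valid Xz (away Xv ∷ p)          (given ∷ os) = (Xz , Xv) ∷ arcs-valid Xz p os
  arcs-valid Xz (to Xv ∷ p)            (given ∷ os) = (Xv , Xz) ∷ arcs-valid Xz p os

  -- No free edge has room, and with at most one vertex besides z, balance at z forces balance
  -- there.
  small-case : ∀ {L H} → Hyp X L H → (∀ a b → X a ≡ true → X b ≡ true → z ≢ a → z ≢ b → a ≡ b) → Solvable L H
  small-case {X} {L} {H} hyp single = solved O os meets
    where
    open Hyp hyp
    allFixed : ∀ {L} → All (Valid X) L → ∃ λ O → Oriented L O × (∀ S → net O S ≡ fixedNet L S)
    allFixed [] = [] , [] , λ S → refl
    allFixed (free Xu Xv z≢u z≢v u≢v ∷ p) = contradiction (single _ _ Xu Xv z≢u z≢v) u≢v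
    allFixed (away _ ∷ p) = let O , os , eq = allFixed p in _ , given ∷ os , λ S → cong (_ ⊕_) (eq S)
    allFixed (to _ ∷ p) = let O , os , eq = allFixed p in _ , given ∷ os , λ S → cong (_ ⊕_) (eq S)
    O = proj₁ (allFixed well-formed)
    os = proj₁ (proj₂ (allFixed well-formed))
    K = O ++ H
    K-valid : All (ArcIn X) K
    K-valid = All.++⁺ (arcs-valid z∈X well-formed os) demand
    at-z : net K ⁅ z ⁆ ≡ 0F
    at-z = trans (net-++ O H ⁅ z ⁆) (trans (cong (_⊕ net H ⁅ z ⁆) (proj₂ (proj₂ (allFixed well-formed)) ⁅ z ⁆)) balance)
    everywhere : ∀ v → net K ⁅ v ⁆ ≡ 0F
    everywhere v with z Fin.≟ v | X v in Xv
    ... | yes refl | _     = at-z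
    ... | no z≢v   | false = net-const false K-valid (λ w Xw → ⁅⁆-≢ (≢-sym (≢-by X Xw Xv)))
    ... | no z≢v   | true  = begin
      net K ⁅ v ⁆                  ≡⟨ ⊕-identityˡ _ ⟨
      0F ⊕ net K ⁅ v ⁆             ≡⟨ cong (_⊕ net K ⁅ v ⁆) at-z ⟨
      net K ⁅ z ⁆ ⊕ net K ⁅ v ⁆    ≡⟨ net-∪ K ⁅ z ⁆ ⁅ v ⁆ (∨-∧-distinct z≢v) ⟨
      net K (⁅ z ⁆ ∪ ⁅ v ⁆)        ≡⟨ net-const true K-valid all ⟩
      0F                           ∎
      where
      open ≡-Reasoning
      all : ∀ w → X w ≡ true → (⁅ z ⁆ ∪ ⁅ v ⁆) w ≡ true
      all w Xw with z Fin.≟ w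
      ... | yes _  = refl
      ... | no z≢w rewrite single v w Xv Xw z≢v z≢w = ⁅⁆-refl w
    meets : ∀ v → net O ⁅ v ⁆ ⊕ net H ⁅ v ⁆ ≡ 0F
    meets v = trans (sym (net-++ O H ⁅ v ⁆)) (everywhere v)

  -- Contracting a set that attains the bound

  Smaller Lighter : Subset (Fin n) → List (Link (Fin n)) → Set
  Smaller X L = ∀ {X′ L′ H′} → Hyp X′ L′ H′ → card X′ < card X → Solvable L′ H′
  Lighter X L = ∀ {L′ H′} → Hyp X L′ H′ → weight L′ < weight L → Solvable L′ H′

  module Contract {X : Subset (Fin n)} {L : List (Link (Fin n))} {H : List (Arc (Fin n))} (hyp : Hyp X L H) {A : Subset (Fin n)} (Az : A z ≡ false)
    {a : Fin n} (Xa : X a ≡ true) (Aa : A a ≡ true) where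
    open Hyp hyp

    open Within {X = X} {A} Xa Aa public

    X₁-z : X₁ z ≡ true
    X₁-z = ∧-intro z∈X (cong (λ b → not b ∨ ⁅ a ⁆ z) Az)

    πz : π z ≡ z
    πz = collapse-out A a Az

    z≢π : ∀ {v} → z ≢ v → z ≢ π v
    z≢π {v} z≢v with A v
    ... | true  = ≢-sym (≢-by A Aa Az)
    ... | false = z≢v

    valid₁ : ∀ {e} → Valid X e → inside A e ≡ false → Valid X₁ (mapEdge π e)
    valid₁ (free Xu Xv z≢u z≢v u≢v) p = free (X₁-π Xu) (X₁-π Xv) (z≢π z≢u) (z≢π z≢v) (π≢π u≢v p)
    valid₁ (away Xv) p = subst (λ t → Valid X₁ (fixed t (π _))) (sym πz) (away (X₁-π Xv))
    valid₁ (to Xv) p = subst (λ t → Valid X₁ (fixed (π _) t)) (sym πz) (to (X₁-π Xv))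

    contracted : ∀ {I R} → L ⟶ I ++ R → All (λ e → inside A e ≡ true) I → All (λ e → inside A e ≡ false) R →
      Hyp X₁ (map (mapEdge π) R) (map (mapArc π) H)
    contracted {I} {R} r ins outs = record
      { z∈X     = X₁-z
      ; well-formed = All.map⁺ (All.zipWith (λ (p , q) → valid₁ p q) (All.++⁻ʳ I (All-⟶ valid-sym r well-formed) , outs))
      ; demand  = All.map⁺ (All.map (λ (p , q) → X₁-π p , X₁-π q) demand)
      ; balance = trans (cong₂ _⊕_ fixed-z (netH z-π)) balance
      ; z-small = trans (cong₂ small (cutR z-π) (netH z-π)) z-small
      ; sets    = λ S Sz (u , X₁u , Su) (w , X₁w , z≢w , Sw) →
          trans (cong₂ good (cutR (λ _ → refl)) (netH (λ _ → refl)))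
            (sets (S ∘ π) (trans (cong S πz) Sz)
              (u , X₁⊆X X₁u , trans (cong S (X₁-fixed X₁u)) Su)
              (w , X₁⊆X X₁w , z≢w , trans (cong S (X₁-fixed X₁w)) Sw))
      }
      where
      z-π : ∀ w → ⁅ z ⁆ (π w) ≡ ⁅ z ⁆ w
      z-π = ⁅⁆-collapse-out A Aa Az
      netH : ∀ {S T} → (∀ w → S (π w) ≡ T w) → net (map (mapArc π) H) S ≡ net H T
      netH p = trans (net-map π H _) (net-ext H p)
      cutR : ∀ {S T} → (∀ w → S (π w) ≡ T w) → cut (map (mapEdge π) R) S ≡ cut L T
      cutR {S} {T} p = begin
        cut (map (mapEdge π) R) S ≡⟨ cut-map π R S ⟩
        cut R (S ∘ π)             ≡⟨ cong (_+ cut R (S ∘ π)) (cut-inside (S a) ins (λ v → const-on-A S)) ⟨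
        cut I (S ∘ π) + cut R (S ∘ π) ≡⟨ total-++ _ I R ⟨
        cut (I ++ R) (S ∘ π)      ≡⟨ cut-⟶ (S ∘ π) r ⟨
        cut L (S ∘ π)             ≡⟨ cut-ext L p ⟩
        cut L T                   ∎
        where open ≡-Reasoning
      fixed-inside : ∀ e → inside A e ≡ true → fixedOut ⁅ z ⁆ e ≡ 0F
      fixed-inside (free u v) p = refl
      fixed-z : fixedNet (map (mapEdge π) R) ⁅ z ⁆ ≡ fixedNet L ⁅ z ⁆
      fixed-z = begin
        fixedNet (map (mapEdge π) R) ⁅ z ⁆ ≡⟨ fixedNet-map π R ⁅ z ⁆ ⟩
        fixedNet R (⁅ z ⁆ ∘ π)             ≡⟨ total₃-cong (All.universal ext R) ⟩
        fixedNet R ⁅ z ⁆                   ≡⟨ ⊕-identityˡ _ ⟨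
        0F ⊕ fixedNet R ⁅ z ⁆              ≡⟨ cong (_⊕ fixedNet R ⁅ z ⁆) (total₃-0 (fixedOut ⁅ z ⁆) (All.map (λ {e} → fixed-inside e) ins)) ⟨
        fixedNet I ⁅ z ⁆ ⊕ fixedNet R ⁅ z ⁆ ≡⟨ total₃-++ _ I R ⟨
        fixedNet (I ++ R) ⁅ z ⁆            ≡⟨ fixedNet-⟶ ⁅ z ⁆ r ⟨
        fixedNet L ⁅ z ⁆                   ∎
        where
        open ≡-Reasoning
        ext : ∀ e → fixedOut (⁅ z ⁆ ∘ π) e ≡ fixedOut ⁅ z ⁆ e
        ext (free u v)  = refl
        ext (fixed u v) = cong₂ flow (⁅⁆-collapse-out A Aa Az u) (⁅⁆-collapse-out A Aa Az v)

  -- Once the edges not inside A are oriented, the complement of A is contracted to z. The arcs that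
  -- cross A become prescribed edges at z, and `tight` becomes the upper bound at z, up to a change
  -- of sign.
  module Complement {X : Subset (Fin n)} {L : List (Link (Fin n))} {H : List (Arc (Fin n))} (hyp : Hyp X L H)
    {A : Subset (Fin n)} (Az : A z ≡ false)
    (tight : small (cut L A) (net H A) ≡ true) {I R : List (Link (Fin n))} (r : L ⟶ I ++ R)
    (ins : All (λ e → inside A e ≡ true) I) (outs : All (λ e → inside A e ≡ false) R) (outer : Outer A R H) where
    open Hyp hyp
    open Outer outer

    A′ : Subset (Fin n)
    A′ v = not (A v)

    σ : Fin n → Fin n
    σ = collapse A′ z

    A′z : A′ z ≡ true
    A′z = cong not Az

    X₂ : Subset (Fin n)
    X₂ w = X w ∧ (A w ∨ ⁅ z ⁆ w)

    L₂ = I ++ map toFixed (map (mapArc σ) arcs)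
    H₂ = map (mapArc σ) H

    X₂-z : X₂ z ≡ true
    X₂-z = ∧-intro z∈X (trans (cong (A z ∨_) (⁅⁆-refl z)) (Bool.∨-zeroʳ _))

    X₂-in : ∀ {v} → X v ≡ true → A v ≡ true → X₂ v ≡ true
    X₂-in {v} Xv Av = ∧-intro Xv (cong (_∨ ⁅ z ⁆ v) Av)

    σ-in : ∀ {v} → A v ≡ true → σ v ≡ v
    σ-in Av = collapse-out A′ z (cong not Av)

    σ-out : ∀ {v} → A v ≡ false → σ v ≡ z
    σ-out Av = collapse-in A′ z (cong not Av)

    X₂-σ : ∀ {v} → X v ≡ true → X₂ (σ v) ≡ true
    X₂-σ {v} Xv with A v in Av
    ... | true  = X₂-in Xv Av
    ... | false = X₂-z

    valid-arc : ∀ {u v} → X u ≡ true → X v ≡ true → A u ∧ A v ≡ false → Valid X₂ (fixed (σ u) (σ v))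
    valid-arc {u} {v} Xu Xv p with A u in Au
    -- If v is outside A as well, this is a loop at z, which crosses no cut.
    ... | false = away (X₂-σ Xv)
    ... | true rewrite p = to (X₂-in Xu Au)

    valid₂ : ∀ {R O} → All (Valid X) R → All (λ e → inside A e ≡ false) R → Oriented R O →
      All (Valid X₂) (map toFixed (map (mapArc σ) O))
    valid₂ []                      []       []           = []
    valid₂ (free Xu Xv _ _ _ ∷ ps) (q ∷ qs) (forth ∷ os) = valid-arc Xu Xv q ∷ valid₂ ps qs os
    valid₂ (free {u} {v} Xu Xv _ _ _ ∷ ps) (q ∷ qs) (back ∷ os) =
      valid-arc Xv Xu (trans (Bool.∧-comm (A v) (A u)) q) ∷ valid₂ ps qs os
    valid₂ (away {v} Xv ∷ ps) (q ∷ qs) (given ∷ os) = valid-arc z∈X Xv (cong (_∧ A v) Az) ∷ valid₂ ps qs os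
    valid₂ (to {v} Xv ∷ ps) (q ∷ qs) (given ∷ os) =
      valid-arc Xv z∈X (trans (cong (A v ∧_) Az) (Bool.∧-zeroʳ _)) ∷ valid₂ ps qs os

    valid-in : ∀ {e} → Valid X e → inside A e ≡ true → Valid X₂ e
    valid-in (free {u} {v} Xu Xv z≢u z≢v u≢v) p =
      let Au , Av = ∧-true {A u} p in free (X₂-in Xu Au) (X₂-in Xv Av) z≢u z≢v u≢v

    X₂-A : ∀ {v} → X₂ v ≡ true → z ≢ v → A v ≡ true
    X₂-A {v} p z≢v with A v
    ... | true  = refl
    ... | false = contradiction (⁅⁆-true (proj₂ (∧-true p))) z≢v

    pull : ∀ K {S T : Subset (Fin n)} → (∀ w → S (σ w) ≡ T w) → net (map (mapArc σ) K) S ≡ net K T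
    pull K p = trans (net-map σ K _) (net-ext K p)

    cut-A : cut L A ≡ cut R A
    cut-A = trans (cut-⟶ A r) (trans (total-++ _ I R) (cong (_+ cut R A) (cut-inside true ins (λ v p → p))))

    cut₂ : ∀ S → cut L₂ S ≡ cut I S + cut R (S ∘ σ)
    cut₂ S = trans (total-++ _ I _) (cong (cut I S +_) (cut-oriented σ S orients))

    hyp₂ : Hyp X₂ L₂ H₂
    hyp₂ = record
      { z∈X     = X₂-z
      ; well-formed = All.++⁺ (All.zipWith (λ (p , q) → valid-in p q) (All.++⁻ˡ I valid , ins))
                    (valid₂ (All.++⁻ʳ I valid) outs orients)
      ; demand  = All.map⁺ (All.map (λ (p , q) → X₂-σ p , X₂-σ q) demand)
      ; balance = begin
          fixedNet L₂ ⁅ z ⁆ ⊕ net H₂ ⁅ z ⁆           ≡⟨ cong₂ _⊕_ net-z (pull H (⁅⁆-collapse-in A′ A′z)) ⟩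
          net arcs A′ ⊕ net H A′                     ≡⟨ cong₂ _⊕_ (net-not arcs A) (net-not H A) ⟩
          -₃ net arcs A ⊕ -₃ net H A                 ≡⟨ -₃-⊕ (net arcs A) (net H A) ⟨
          -₃ (net arcs A ⊕ net H A)                  ≡⟨ cong -₃_ across ⟩
          0F                                         ∎
      ; z-small = begin
          small (cut L₂ ⁅ z ⁆) (net H₂ ⁅ z ⁆)        ≡⟨ cong₂ small cut-z (trans (pull H (⁅⁆-collapse-in A′ A′z)) (net-not H A)) ⟩
          small (cut L A) (-₃ net H A)               ≡⟨ small-neg (cut L A) (net H A) ⟨
          small (cut L A) (net H A)                  ≡⟨ tight ⟩
          true                                       ∎
      ; sets    = λ S Sz (u , X₂u , Su) (w , X₂w , z≢w , Sw) →
          let Au = X₂-A X₂u (≢-sym (≢-by S Su Sz))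
              Aw = X₂-A X₂w z≢w in
          trans (cong₂ good (cut-S S) (pull H (λ _ → refl)))
            (sets (S ∘ σ) (trans (cong S (σ-out Az)) Sz)
              (u , proj₁ (∧-true X₂u) , trans (cong S (σ-in Au)) Su)
              (w , proj₁ (∧-true X₂w) , z≢w , trans (cong S (σ-in Aw)) Sw))
      }
      where
      open ≡-Reasoning
      valid = All-⟶ valid-sym r well-formed
      net-z : fixedNet L₂ ⁅ z ⁆ ≡ net arcs A′
      net-z = trans (total₃-++ (fixedOut ⁅ z ⁆) I _) (trans (cong₂ _⊕_ (fixedNet-inside ⁅ z ⁆ ins)
        (trans (fixedNet-toFixed (map (mapArc σ) arcs) ⁅ z ⁆) (pull arcs (⁅⁆-collapse-in A′ A′z)))) (⊕-identityˡ _))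
      cut-z : cut L₂ ⁅ z ⁆ ≡ cut L A
      cut-z = begin
        cut L₂ ⁅ z ⁆                        ≡⟨ cut₂ ⁅ z ⁆ ⟩
        cut I ⁅ z ⁆ + cut R (⁅ z ⁆ ∘ σ)     ≡⟨ cong₂ _+_ (cut-inside false ins (λ v Av → ⁅⁆-≢ (≢-sym (≢-by A Av Az))))
                                                  (cut-ext R (⁅⁆-collapse-in A′ A′z)) ⟩
        cut R A′                            ≡⟨ cut-not R A ⟩
        cut R A                             ≡⟨ cut-A ⟨
        cut L A                             ∎
      cut-S : ∀ S → cut L₂ S ≡ cut L (S ∘ σ)
      cut-S S = begin
        cut L₂ S                            ≡⟨ cut₂ S ⟩
        cut I S + cut R (S ∘ σ)             ≡⟨ cong (_+ cut R (S ∘ σ)) (inside-agree ins (λ v Av → cong S (sym (σ-in Av)))) ⟩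
        cut I (S ∘ σ) + cut R (S ∘ σ)       ≡⟨ total-++ _ I R ⟨
        cut (I ++ R) (S ∘ σ)                ≡⟨ cut-⟶ (S ∘ σ) r ⟨
        cut L (S ∘ σ)                       ∎

    X₂-< : ∀ {b} → X b ≡ true → z ≢ b → A b ≡ false → card X₂ < card X
    X₂-< {b} Xb z≢b Ab = card-< (λ v p → proj₁ (∧-true p)) b Xb
      (trans (cong₂ (λ p q → X b ∧ (p ∨ q)) Ab (⁅⁆-≢ z≢b)) (Bool.∧-zeroʳ (X b)))

    finish : Solvable L₂ H₂ → Solvable L H
    finish (solved O os eq) with orientation-++⁻ I os
    ... | P , ps , refl = solvable-split A r ins outer ps λ v Av →
      let σ-v = ⁅⁆-collapse-out A′ A′z (cong not Av) in begin
      net P ⁅ v ⁆ ⊕ (net arcs ⁅ v ⁆ ⊕ net H ⁅ v ⁆)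
        ≡⟨ cong (net P ⁅ v ⁆ ⊕_) (cong₂ _⊕_ (pull arcs σ-v) (pull H σ-v)) ⟨
      net P ⁅ v ⁆ ⊕ (net (map (mapArc σ) arcs) ⁅ v ⁆ ⊕ net H₂ ⁅ v ⁆)
        ≡⟨ ⊕-assoc (net P ⁅ v ⁆) _ _ ⟨
      net P ⁅ v ⁆ ⊕ net (map (mapArc σ) arcs) ⁅ v ⁆ ⊕ net H₂ ⁅ v ⁆
        ≡⟨ cong (_⊕ net H₂ ⁅ v ⁆) (net-++ P (map (mapArc σ) arcs) ⁅ v ⁆) ⟨
      net (P ++ map (mapArc σ) arcs) ⁅ v ⁆ ⊕ net H₂ ⁅ v ⁆
        ≡⟨ eq v ⟩
      0F ∎
      where open ≡-Reasoning

  -- The instance with A contracted is smaller because A has two vertices; the instance with the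
  -- complement contracted to z is smaller because A misses a vertex other than z.
  contract-small : ∀ {X L H} → Hyp X L H → Smaller X L → ∀ A → A z ≡ false →
    small (cut L A) (net H A) ≡ true → Twice X A → Misses X A → Solvable L H
  contract-small {L = L} hyp smaller A Az tight (a , b , Xa , Xb , Aa , Ab , a≢b) (w , Xw , z≢w , Aw)
    with splitInside A L
  ... | I , R , r , ins , outs = finish (smaller hyp₂ (X₂-< Xw z≢w Aw))
    where
    open Contract hyp Az Xa Aa
    open Complement hyp Az tight r ins outs (expand A Aa (smaller (contracted r ins outs) (X₁-< Xb Ab a≢b)))

  contract-parallel : ∀ {X L H} → Hyp X L H → Smaller X L → ∀ {u w M} → L ⟶ free u w ∷ free u w ∷ M → Solvable L H
  contract-parallel {X} {L} {H} hyp smaller {u} {w} {M} r with All-⟶ valid-sym r (Hyp.well-formed hyp)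
  ... | free Xu Xw z≢u z≢w u≢w ∷ _ with splitInside (⁅ u ⁆ ∪ ⁅ w ⁆) M
  ... | I , R , s , ins , outs = solvable-parallel u≢w r s ins
    (smaller (contracted (r ⟫ keep _ (keep _ s)) (uw ∷ uw ∷ ins) outs) (X₁-< Xw Aw u≢w))
    where
    A = ⁅ u ⁆ ∪ ⁅ w ⁆
    Au : A u ≡ true
    Au = cong (_∨ ⁅ w ⁆ u) (⁅⁆-refl u)
    Aw : A w ≡ true
    Aw = trans (cong (⁅ u ⁆ w ∨_) (⁅⁆-refl w)) (Bool.∨-zeroʳ _)
    uw : inside A (free u w) ≡ true
    uw = ∧-intro Au Aw
    Az : A z ≡ false
    Az = cong₂ _∨_ (⁅⁆-≢ (≢-sym z≢u)) (⁅⁆-≢ (≢-sym z≢w))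
    open Contract hyp Az Xu Au

  -- Lifting, orienting and reversing edges

  valid-lifted : ∀ {v w k u} → Valid X (free v w) → Valid X (spoke v k u) → w ≢ u → Valid X (lifted k w u)
  valid-lifted {k = free} (free Xv Xw z≢v z≢w _) (free _ Xu _ z≢u _) w≢u = free Xw Xu z≢w z≢u w≢u
  valid-lifted {k = outward} (free Xv Xw z≢v z≢w _) (away _) w≢u = contradiction refl z≢v
  valid-lifted {k = outward} (free Xv Xw z≢v z≢w _) (to _)   w≢u = to Xw
  valid-lifted {k = inward}  (free Xv Xw z≢v z≢w _) (away _) w≢u = away Xw
  valid-lifted {k = inward}  (free Xv Xw z≢v z≢w _) (to _)   w≢u = contradiction refl z≢v

  valid-end : ∀ {v k u} → X z ≡ true → Valid X (spoke v k u) → X u ≡ true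
  valid-end {k = free}    Xz (free _ Xu _ _ _) = Xu
  valid-end {k = outward} Xz (away Xu)         = Xu
  valid-end {k = outward} Xz (to _)            = Xz
  valid-end {k = inward}  Xz (away _)          = Xz
  valid-end {k = inward}  Xz (to Xu)           = Xu

  -- A prescribed spoke at v ends in z, where no free edge ends; two free edges to the same vertex
  -- would be parallel.
  distinct-ends : ∀ {L v w k u M} → All (Valid X) L → Simple L →
    L ⟶ free v w ∷ spoke v k u ∷ M → w ≢ u
  distinct-ends {k = free} ok np r refl = np r
  distinct-ends {k = outward} ok np r with All-⟶ valid-sym r ok
  ... | free _ _ z≢v z≢w _ ∷ away _ ∷ _ = contradiction refl z≢v
  ... | free _ _ z≢v z≢w _ ∷ to _ ∷ _   = ≢-sym z≢w
  distinct-ends {k = inward} ok np r with All-⟶ valid-sym r ok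
  ... | free _ _ z≢v z≢w _ ∷ away _ ∷ _ = ≢-sym z≢w
  ... | free _ _ z≢v z≢w _ ∷ to _ ∷ _   = contradiction refl z≢v

  module _ {X : Subset (Fin n)} {L : List (Link (Fin n))} {H : List (Arc (Fin n))} (hyp : Hyp X L H)
    (slack : Slack X L H) where
    open Hyp hyp

    degree : Fin n → ℕ
    degree v = cut L ⁅ v ⁆

    value : Fin n → ℤ₃
    value v = net H ⁅ v ⁆

    goodL : ∀ A → A z ≡ false → Meets X A → Misses X A → ∀ {d h} → cut L A ≡ d → net H A ≡ h → good d h ≡ true
    goodL A Az m o refl refl = sets A Az m o

    slackL : ∀ A → A z ≡ false → Twice X A → Misses X A → ∀ {d} → cut L A ≡ d → small d (net H A) ≡ false
    slackL A Az t o refl = slack A Az t o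

    agree₂ : ∀ {A B} (f : ℕ → ℤ₃ → Bool) → (∀ v → X v ≡ true → A v ≡ B v) →
      f (cut L A) (net H A) ≡ f (cut L B) (net H B)
    agree₂ f p = cong₂ f (cut-agree z∈X well-formed p) (net-agree demand p)

    -- A set that contains just one end loses an edge. If it has several vertices, `slack` pays for
    -- the loss; otherwise it amounts to that end, and `up` or `dn` applies. One end may be z, which
    -- no set in question contains.
    orient-sets : ∀ {e M x y} → L ⟶ e ∷ M → (∀ S → crossing S e ≡ cross (S x) (S y)) →
      X x ≡ true → X y ≡ true → (z ≢ x → up (degree x) (value x) ≡ true) → (z ≢ y → dn (degree y) (value y) ≡ true) →
      ∀ A → A z ≡ false → Meets X A → Misses X A → good (cut M A) (net ((x , y) ∷ H) A) ≡ true
    orient-sets {e} {M} {x} {y} r c Xx Xy up-x dn-y A Az m o =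
      by-cases (A x) (A y) refl refl (trans (cut-⟶ A r) (cong (_+ cut M A) (c A)))
      where
      by-cases : ∀ a b → A x ≡ a → A y ≡ b → cut L A ≡ cross (A x) (A y) + cut M A →
        good (cut M A) (flow (A x) (A y) ⊕ net H A) ≡ true
      by-cases true true p q eq rewrite p | q = goodL A Az m o eq (sym (⊕-identityˡ _))
      by-cases false false p q eq rewrite p | q = goodL A Az m o eq (sym (⊕-identityˡ _))
      by-cases true false p q eq rewrite p | q with one-or-twice x Xx p
      ... | inj₁ t = slack⇒good⁻¹₁ (cut M A) (net H A) (slackL A Az t o eq)
      ... | inj₂ s = trans (cong (λ d → good d (1F ⊕ net H A)) (sym (cong pred eq)))
        (trans (agree₂ up s) (up-x (≢-sym (≢-by A p Az))))
      by-cases false true p q eq rewrite p | q with one-or-twice y Xy q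
      ... | inj₁ t = slack⇒good⁻¹₂ (cut M A) (net H A) (slackL A Az t o eq)
      ... | inj₂ s = trans (cong (λ d → good d (2F ⊕ net H A)) (sym (cong pred eq)))
        (trans (agree₂ dn s) (dn-y (≢-sym (≢-by A q Az))))

    orient-edge : Lighter X L → ∀ {x y M} → L ⟶ free x y ∷ M →
      up (degree x) (value x) ≡ true → dn (degree y) (value y) ≡ true → Solvable L H
    orient-edge lighter {x} {y} {M} r up-x dn-y with All-⟶ valid-sym r well-formed
    ... | free Xx Xy z≢x z≢y x≢y ∷ valid = solvable-⟶ r (solvable-orient forth (lighter record
      { z∈X     = z∈X
      ; well-formed = valid
      ; demand  = (Xx , Xy) ∷ demand
      ; balance = trans (cong₂ _⊕_ (trans (sym (⊕-identityˡ _)) (sym (fixedNet-⟶ ⁅ z ⁆ r))) net-z) balance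
      ; z-small = trans (cong₂ small (sym cut-z) net-z) z-small
      ; sets    = orient-sets r (λ S → refl) Xx Xy (λ _ → up-x) (λ _ → dn-y)
      } (subst (weight M <_) (sym (weight-⟶ r)) (ℕ.m<n+m (weight M) {2} (s≤s z≤n)))))
      where
      net-z : net ((x , y) ∷ H) ⁅ z ⁆ ≡ net H ⁅ z ⁆
      net-z = trans (cong₂ (λ a b → flow a b ⊕ net H ⁅ z ⁆) (⁅⁆-≢ z≢x) (⁅⁆-≢ z≢y)) (⊕-identityˡ _)
      cut-z : cut L ⁅ z ⁆ ≡ cut M ⁅ z ⁆
      cut-z = trans (cut-⟶ ⁅ z ⁆ r) (cong₂ (λ a b → cross a b + cut M ⁅ z ⁆) (⁅⁆-≢ z≢x) (⁅⁆-≢ z≢y))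

    -- The arc moves into the demand: z loses one edge while its value drops by 1, which keeps z
    -- `small`, and x changes as `up` permits.
    drop-arc : Lighter X L → ∀ {x M} → L ⟶ fixed x z ∷ M → z ≢ x → X x ≡ true →
      up (degree x) (value x) ≡ true → Solvable L H
    drop-arc lighter {x} {M} r z≢x Xx up-x = solvable-⟶ r (solvable-orient given (lighter record
      { z∈X     = z∈X
      ; well-formed = All.tail (All-⟶ valid-sym r well-formed)
      ; demand  = (Xx , z∈X) ∷ demand
      ; balance = begin
          fixedNet M ⁅ z ⁆ ⊕ (out ⁅ z ⁆ (x , z) ⊕ net H ⁅ z ⁆) ≡⟨ ⊕-swap (fixedNet M ⁅ z ⁆) _ _ ⟩
          out ⁅ z ⁆ (x , z) ⊕ (fixedNet M ⁅ z ⁆ ⊕ net H ⁅ z ⁆) ≡⟨ ⊕-assoc (out ⁅ z ⁆ (x , z)) _ _ ⟨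
          fixedNet (fixed x z ∷ M) ⁅ z ⁆ ⊕ net H ⁅ z ⁆         ≡⟨ cong (_⊕ net H ⁅ z ⁆) (fixedNet-⟶ ⁅ z ⁆ r) ⟨
          fixedNet L ⁅ z ⁆ ⊕ net H ⁅ z ⁆                       ≡⟨ balance ⟩
          0F                                                   ∎
      ; z-small = trans (cong (λ h → small (cut M ⁅ z ⁆) (h ⊕ net H ⁅ z ⁆)) flow-z)
          (small⁻¹₂ (cut M ⁅ z ⁆) (net H ⁅ z ⁆) (subst (λ d → small d (net H ⁅ z ⁆) ≡ true) cut-z z-small))
      ; sets    = orient-sets r (λ S → refl) Xx z∈X (λ _ → up-x) (λ z≢z → contradiction refl z≢z)
      } (subst (weight M <_) (sym (weight-⟶ r)) (ℕ.n<1+n (weight M)))))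
      where
      open ≡-Reasoning
      flow-z : out ⁅ z ⁆ (x , z) ≡ 2F
      flow-z = cong₂ flow (⁅⁆-≢ z≢x) (⁅⁆-refl z)
      cut-z : cut L ⁅ z ⁆ ≡ suc (cut M ⁅ z ⁆)
      cut-z = trans (cut-⟶ ⁅ z ⁆ r) (cong₂ (λ a b → cross a b + cut M ⁅ z ⁆) (⁅⁆-≢ z≢x) (⁅⁆-refl z))

    cut-z-lift : ∀ {v w k u M} → z ≢ v → z ≢ w →
      cut (free v w ∷ spoke v k u ∷ M) ⁅ z ⁆ ≡ cut (lifted k w u ∷ M) ⁅ z ⁆
    cut-z-lift {v} {w} {k} {u} {M} z≢v z≢w
      rewrite crossing-spoke ⁅ z ⁆ v k u | crossing-lifted ⁅ z ⁆ k w u | ⁅⁆-≢ z≢v | ⁅⁆-≢ z≢w = refl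

    fixedNet-z-lift : ∀ {v w k u M} → z ≢ v → z ≢ w →
      fixedNet (free v w ∷ spoke v k u ∷ M) ⁅ z ⁆ ≡ fixedNet (lifted k w u ∷ M) ⁅ z ⁆
    fixedNet-z-lift {v} {w} {k} {u} {M} z≢v z≢w = trans (⊕-identityˡ _)
      (cong (_⊕ fixedNet M ⁅ z ⁆) (fixedOut-lifted ⁅ z ⁆ k u (trans (⁅⁆-≢ z≢v) (sym (⁅⁆-≢ z≢w)))))

    -- A set whose cut drops by two either contains w and u, which are distinct, or contains v. In
    -- the first case, and for larger sets in the second, `slack` pays; for v alone the slack at v
    -- does.
    lift-edges : Lighter X L → ∀ {v w k u M} → small (degree v) (value v) ≡ false → w ≢ u →
      L ⟶ free v w ∷ spoke v k u ∷ M → Solvable L H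
    lift-edges lighter {v} {w} {k} {u} {M} v-slack w≢u r with All-⟶ valid-sym r well-formed
    ... | vw@(free Xv Xw z≢v z≢w v≢w) ∷ vu ∷ valid = solvable-⟶ r (solvable-lift k (lighter record
      { z∈X     = z∈X
      ; well-formed = valid-lifted vw vu w≢u ∷ valid
      ; demand  = demand
      ; balance = trans (cong (_⊕ net H ⁅ z ⁆)
          (trans (sym (fixedNet-z-lift {v} {w} {k} {u} {M} z≢v z≢w)) (sym (fixedNet-⟶ ⁅ z ⁆ r)))) balance
      ; z-small = trans (cong (λ d → small d (net H ⁅ z ⁆))
          (trans (sym (cut-z-lift {v} {w} {k} {u} {M} z≢v z≢w)) (sym (cut-⟶ ⁅ z ⁆ r)))) z-small
      ; sets    = sets′
      } (subst (weight (lifted k w u ∷ M) <_) (sym (weight-⟶ r)) lighter′)))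
      where
      lighter′ : weight (lifted k w u ∷ M) < weight (free v w ∷ spoke v k u ∷ M)
      lighter′ rewrite weigh-lifted k v w u = ℕ.m<n+m _ {2} (s≤s z≤n)
      sets′ : ∀ A → A z ≡ false → Meets X A → Misses X A → good (cut (lifted k w u ∷ M) A) (net H A) ≡ true
      sets′ A Az m o with cut-lift A {v} {w} k {u} {M}
      ... | inj₁ eq = goodL A Az m o (trans (cut-⟶ A r) eq) refl
      ... | inj₂ (inj₁ (_ , Aw , Au) , eq) = slack⇒good⁻² _ (net H A)
        (slackL A Az (w , u , Xw , valid-end z∈X vu , Aw , Au , w≢u) o (trans (cut-⟶ A r) eq))
      ... | inj₂ (inj₂ (Av , _ , _) , eq) with one-or-twice v Xv Av
      ... | inj₁ t = slack⇒good⁻² _ (net H A) (slackL A Az t o (trans (cut-⟶ A r) eq))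
      ... | inj₂ s = slack⇒good⁻² _ (net H A) (trans (cong (λ d → small d (net H A)) (trans (sym eq) (sym (cut-⟶ A r))))
        (trans (agree₂ small s) v-slack))

    -- An arc from z to x has the same effect modulo 3 as two arcs from x to z.
    reverse-arc : Lighter X L → ∀ {x y M} → L ⟶ fixed z x ∷ free x y ∷ M →
      up (degree x) (value x) ≡ true → up (degree y) (value y) ≡ true →
      fixedNet L ⁅ z ⁆ ≡ ones (cut L ⁅ z ⁆) → Solvable L H
    reverse-arc lighter {x} {y} {M} r up-x up-y all-out with All-⟶ valid-sym r well-formed
    ... | _ ∷ free Xx Xy z≢x z≢y x≢y ∷ valid = solvable-⟶ r (transfer (lighter record
      { z∈X     = z∈X
      ; well-formed = to Xx ∷ to Xx ∷ valid
      ; demand  = (Xy , Xx) ∷ demand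
      ; balance = trans (cong₂ _⊕_ fixed-z net-z) balance
      -- The degree of z grows by one, which is affordable because all its edges leave it.
      ; z-small = trans (cong₂ small cut-z net-z) (small⁺¹ (cut L ⁅ z ⁆) (net H ⁅ z ⁆)
          (trans (cong (_⊕ net H ⁅ z ⁆) (sym all-out)) balance) z-small)
      ; sets    = λ A Az m o → sets′ A Az m o (A x) (A y) refl refl
          (trans (cut-⟶ A r) (cong (λ a → cross a (A x) + (cross (A x) (A y) + cut M A)) Az))
      } (subst (weight L′ <_) (sym (weight-⟶ r)) (ℕ.n<1+n (weight L′)))))
      where
      L′ = fixed x z ∷ fixed x z ∷ M
      H′ = (y , x) ∷ H
      net-z : net H′ ⁅ z ⁆ ≡ net H ⁅ z ⁆
      net-z = trans (cong₂ (λ a b → flow a b ⊕ net H ⁅ z ⁆) (⁅⁆-≢ z≢y) (⁅⁆-≢ z≢x)) (⊕-identityˡ _)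
      fixed-z : fixedNet L′ ⁅ z ⁆ ≡ fixedNet L ⁅ z ⁆
      fixed-z = trans before (trans (sym after) (sym (fixedNet-⟶ ⁅ z ⁆ r)))
        where
        before : fixedNet L′ ⁅ z ⁆ ≡ 1F ⊕ fixedNet M ⁅ z ⁆
        before rewrite ⁅⁆-≢ z≢x | ⁅⁆-refl z = 2+2≡1 _
        after : fixedNet (fixed z x ∷ free x y ∷ M) ⁅ z ⁆ ≡ 1F ⊕ fixedNet M ⁅ z ⁆
        after rewrite ⁅⁆-≢ z≢x | ⁅⁆-refl z = cong (1F ⊕_) (⊕-identityˡ _)
      cut-z : cut L′ ⁅ z ⁆ ≡ suc (cut L ⁅ z ⁆)
      cut-z = trans before (cong suc (trans (sym after) (sym (cut-⟶ ⁅ z ⁆ r))))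
        where
        before : cut L′ ⁅ z ⁆ ≡ 2 + cut M ⁅ z ⁆
        before rewrite ⁅⁆-≢ z≢x | ⁅⁆-refl z = refl
        after : cut (fixed z x ∷ free x y ∷ M) ⁅ z ⁆ ≡ 1 + cut M ⁅ z ⁆
        after rewrite ⁅⁆-≢ z≢x | ⁅⁆-≢ z≢y | ⁅⁆-refl z = refl
      transfer : Solvable L′ H′ → Solvable (fixed z x ∷ free x y ∷ M) H
      transfer (solved (_ ∷ _ ∷ O) (given ∷ given ∷ os) eq) = solved _ (given ∷ back ∷ os) λ v → trans (sym (same v)) (eq v)
        where
        same : ∀ v → net ((x , z) ∷ (x , z) ∷ O) ⁅ v ⁆ ⊕ net H′ ⁅ v ⁆ ≡ net ((z , x) ∷ (y , x) ∷ O) ⁅ v ⁆ ⊕ net H ⁅ v ⁆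
        same v = begin
          (a ⊕ (a ⊕ o)) ⊕ (b ⊕ h)   ≡⟨ cong (_⊕ (b ⊕ h)) (twice (⁅ v ⁆ x) (⁅ v ⁆ z) o) ⟩
          (c ⊕ o) ⊕ (b ⊕ h)         ≡⟨ ⊕-assoc (c ⊕ o) b h ⟨
          ((c ⊕ o) ⊕ b) ⊕ h         ≡⟨ cong (_⊕ h) (trans (⊕-assoc c o b) (cong (c ⊕_) (⊕-comm o b))) ⟩
          (c ⊕ (b ⊕ o)) ⊕ h         ∎
          where
          open ≡-Reasoning
          a = out ⁅ v ⁆ (x , z)
          b = out ⁅ v ⁆ (y , x)
          c = out ⁅ v ⁆ (z , x)
          o = net O ⁅ v ⁆
          h = net H ⁅ v ⁆
          twice : ∀ p q o → flow p q ⊕ (flow p q ⊕ o) ≡ flow q p ⊕ o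
          twice true  true  o = ⊕-identityˡ _
          twice true  false o = trans (sym (⊕-assoc 1F 1F o)) (cong (_⊕ o) 1+1≡2)
          twice false true  o = 2+2≡1 o
          twice false false o = ⊕-identityˡ _
      sets′ : ∀ A → A z ≡ false → Meets X A → Misses X A → ∀ a b → A x ≡ a → A y ≡ b →
        cut L A ≡ cross false (A x) + (cross (A x) (A y) + cut M A) → good (cut L′ A) (net H′ A) ≡ true
      sets′ A Az m o false false p q eq rewrite Az | p | q = goodL A Az m o eq (sym (⊕-identityˡ _))
      sets′ A Az m o true true p q eq rewrite Az | p | q =
        6≤⇒good (2 + cut M A) _ (ℕ.m≤n⇒m≤1+n (subst (6 ≤_) eq
          (slack⇒6≤ (cut L A) (net H A) (slack A Az (x , y , Xx , Xy , p , q , x≢y) o))))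
      sets′ A Az m o true false p q eq rewrite Az | p | q with one-or-twice x Xx p
      ... | inj₁ t = 6≤⇒good (2 + cut M A) _ (subst (6 ≤_) eq (slack⇒6≤ (cut L A) (net H A) (slack A Az t o)))
      -- At x two edges replace two, so the degree stays while the arc from y lowers the value by 1.
      ... | inj₂ s = up⇒good (2 + cut M A) (net H A) (goodL A Az m o eq refl)
        (subst (λ d → up d (net H A) ≡ true) eq (trans (agree₂ up s) up-x))
      sets′ A Az m o false true p q eq rewrite Az | p | q with one-or-twice y Xy q
      ... | inj₁ t = slack⇒good⁻¹₁ (cut M A) (net H A) (slackL A Az t o eq)
      ... | inj₂ s = subst (λ d → up d (net H A) ≡ true) eq (trans (agree₂ up s) up-y)

  -- A vertex v of degree 4 and value 0 disappears when its four edges are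
  -- lifted in pairs.
  module Removal {X : Subset (Fin n)} {L : List (Link (Fin n))} {H : List (Arc (Fin n))} (hyp : Hyp X L H)
    (slack : Slack X L H)
    {v : Fin n} (z≢v : z ≢ v) (Xv : X v ≡ true) (value-v : net H ⁅ v ⁆ ≡ 0F)
    {w₁ w₂ : Fin n} {k₁ k₂ : Kind} {u₁ u₂ : Fin n} {M : List (Link (Fin n))}
    (r : L ⟶ free v w₁ ∷ spoke v k₁ u₁ ∷ free v w₂ ∷ spoke v k₂ u₂ ∷ M)
    (w₁≢u₁ : w₁ ≢ u₁) (w₂≢u₂ : w₂ ≢ u₂) (v≢u₁ : v ≢ u₁) (v≢u₂ : v ≢ u₂) (untouched : cut M ⁅ v ⁆ ≡ 0) where
    open Hyp hyp

    X′ : Subset (Fin n)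
    X′ = X ∖ v

    L′ : List (Link (Fin n))
    L′ = lifted k₁ w₁ u₁ ∷ lifted k₂ w₂ u₂ ∷ M
    -- Demand arcs at v are handed to z; as v has value 0, no value changes.
    π = collapse ⁅ v ⁆ z
    H′ = map (mapArc π) H

    X′-intro : ∀ {w} → X w ≡ true → v ≢ w → X′ w ≡ true
    X′-intro = ∖-intro X

    X′-≢ : ∀ {w} → X′ w ≡ true → v ≢ w
    X′-≢ p = proj₂ (∖-true X p)

    valid-M : All (Valid X′) M
    valid-M = All.zipWith (λ (p , q) → valid′ p q)
      (All.tail (All.tail (All.tail (All.tail (All-⟶ valid-sym r well-formed)))) , total≡0⇒All (crossing ⁅ v ⁆) untouched)
      where
      valid′ : ∀ {e} → Valid X e → crossing ⁅ v ⁆ e ≡ 0 → Valid X′ e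
      valid′ {free a b} (free Xa Xb z≢a z≢b a≢b) p = free (X′-intro Xa v≢a) (X′-intro Xb v≢b) z≢a z≢b a≢b
        where
        v≢a : v ≢ a
        v≢a refl = a≢b (⁅⁆-true (trans (sym (cross-0 _ _ p)) (⁅⁆-refl v)))
        v≢b : v ≢ b
        v≢b refl = ≢-sym a≢b (⁅⁆-true (trans (cross-0 _ _ p) (⁅⁆-refl v)))
      valid′ (away Xb) p = away (X′-intro Xb λ { refl →
        true≢false (⁅⁆-refl v) (trans (sym (cross-0 _ _ p)) (⁅⁆-≢ (≢-sym z≢v))) })
      valid′ (to Xb) p = to (X′-intro Xb λ { refl →
        true≢false (⁅⁆-refl v) (trans (cross-0 _ _ p) (⁅⁆-≢ (≢-sym z≢v))) })

    valid-pair : ∀ {w k u} → Valid X (free v w) → Valid X (spoke v k u) → w ≢ u → v ≢ u → Valid X′ (lifted k w u)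
    valid-pair {w} {k} {u} vw@(free _ _ _ _ v≢w) vu w≢u v≢u = restrict k (valid-lifted vw vu w≢u)
      where
      restrict : ∀ k → Valid X (lifted k w u) → Valid X′ (lifted k w u)
      restrict free    (free Xw Xu z≢w z≢u w≢u) = free (X′-intro Xw v≢w) (X′-intro Xu v≢u) z≢w z≢u w≢u
      restrict outward (away Xu) = away (X′-intro Xu v≢u)
      restrict outward (to Xw)   = to (X′-intro Xw v≢w)
      restrict inward  (away Xw) = away (X′-intro Xw v≢w)
      restrict inward  (to Xu)   = to (X′-intro Xu v≢u)

    lifts : All (Valid X) (free v w₁ ∷ spoke v k₁ u₁ ∷ free v w₂ ∷ spoke v k₂ u₂ ∷ M)
    lifts = All-⟶ valid-sym r well-formed

    vw₁ = All.head lifts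
    vu₁ = All.head (All.tail lifts)
    vw₂ = All.head (All.tail (All.tail lifts))
    vu₂ = All.head (All.tail (All.tail (All.tail lifts)))

    free-end : ∀ {w} → Valid X (free v w) → X w ≡ true × z ≢ w × v ≢ w
    free-end (free _ Xw _ z≢w v≢w) = Xw , z≢w , v≢w

    valid-L′ : All (Valid X′) L′
    valid-L′ = valid-pair {k = k₁} vw₁ vu₁ w₁≢u₁ v≢u₁ ∷ valid-pair {k = k₂} vw₂ vu₂ w₂≢u₂ v≢u₂ ∷ valid-M

    X′-z : X′ z ≡ true
    X′-z = X′-intro z∈X (≢-sym z≢v)

    net-on : ∀ A → net H (A ∖ v ∪ ⁅ v ⁆) ≡ net H (A ∖ v)
    net-on A = trans (net-∪ H (A ∖ v) ⁅ v ⁆ disjoint) (trans (cong (net H (A ∖ v) ⊕_) value-v) (⊕-identityʳ _))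
      where
      disjoint : ∀ w → (A ∖ v) w ∧ ⁅ v ⁆ w ≡ false
      disjoint w with v Fin.≟ w
      ... | yes refl = cong (_∧ true) (Bool.∧-zeroʳ (A v))
      ... | no _     = Bool.∧-zeroʳ _

    pair : ∀ S {w k u N} → S v ≡ false → cut (free v w ∷ spoke v k u ∷ N) S ≡ cut (lifted k w u ∷ N) S
      ⊎ (S w ≡ true × S u ≡ true) × cut (free v w ∷ spoke v k u ∷ N) S ≡ 2 + cut (lifted k w u ∷ N) S
    pair S {w} {k} {u} {N} Sv with cut-lift S {v} {w} k {u} {N}
    ... | inj₁ eq                          = inj₁ eq
    ... | inj₂ (inj₁ (_ , Sw , Su) , eq)   = inj₂ ((Sw , Su) , eq)
    ... | inj₂ (inj₂ (Sv′ , _ , _) , eq)   = ⊥-elim (true≢false Sv′ Sv)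

    N : List (Link (Fin n))
    N = free v w₂ ∷ spoke v k₂ u₂ ∷ M

    sets′ : ∀ A → A z ≡ false → Meets X′ A → Misses X′ A → good (cut L′ A) (net H′ A) ≡ true
    sets′ A Az (a , X′a , Aa) (b , X′b , z≢b , Ab) =
      trans (cong₂ good (cut-agree {S = A} {A ∖ v} {L′} X′-z valid-L′ (λ w X′w → sym (∖-≢ A (X′-≢ X′w)))) (net-collapse-out H A v Az))
        (main (pair S {w₁} {k₁} {u₁} {N} (∖-self A v)) (pair S {w₂} {k₂} {u₂} {M} (∖-self A v)))
      where
      S = A ∖ v
      Sz : S z ≡ false
      Sz = cong (_∧ not (⁅ v ⁆ z)) Az
      m : Meets X S
      m = a , proj₁ (∧-true X′a) , trans (∖-≢ A (X′-≢ X′a)) Aa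
      o : Misses X S
      o = b , proj₁ (∧-true X′b) , z≢b , trans (∖-≢ A (X′-≢ X′b)) Ab
      twice : ∀ {w k u} → Valid X (free v w) → Valid X (spoke v k u) → w ≢ u → S w ≡ true → S u ≡ true → Twice X S
      twice {w} {k} {u} vw vu w≢u Sw Su = w , u , proj₁ (free-end vw) , valid-end {k = k} z∈X vu , Sw , Su , w≢u
      c₁ = crossing S (lifted k₁ w₁ u₁)
      loses-two : Twice X S → cut L S ≡ 2 + cut L′ S → good (cut L′ S) (net H S) ≡ true
      loses-two t eq = slack⇒good⁻² (cut L′ S) (net H S) (subst (λ d → small d (net H S) ≡ false) eq (slack S Sz t o))
      main : cut (free v w₁ ∷ spoke v k₁ u₁ ∷ N) S ≡ cut (lifted k₁ w₁ u₁ ∷ N) S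
        ⊎ (S w₁ ≡ true × S u₁ ≡ true) × cut (free v w₁ ∷ spoke v k₁ u₁ ∷ N) S ≡ 2 + cut (lifted k₁ w₁ u₁ ∷ N) S →
        cut N S ≡ cut (lifted k₂ w₂ u₂ ∷ M) S
        ⊎ (S w₂ ≡ true × S u₂ ≡ true) × cut N S ≡ 2 + cut (lifted k₂ w₂ u₂ ∷ M) S →
        good (cut L′ S) (net H S) ≡ true
      main (inj₁ p) (inj₁ q) = trans (cong (λ d → good d (net H S))
        (sym (trans (cut-⟶ S r) (trans p (cong (c₁ +_) q))))) (sets S Sz m o)
      main (inj₂ ((Sw , Su) , p)) (inj₁ q) = loses-two (twice {k = k₁} vw₁ vu₁ w₁≢u₁ Sw Su)
        (trans (cut-⟶ S r) (trans p (cong (λ d → 2 + (c₁ + d)) q)))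
      main (inj₁ p) (inj₂ ((Sw , Su) , q)) = loses-two (twice {k = k₂} vw₂ vu₂ w₂≢u₂ Sw Su)
        (trans (cut-⟶ S r) (trans p (trans (cong (c₁ +_) q) (+-swap c₁ 2 _))))
      -- S loses four edges, more than `slack` pays for. But then all four edges at v lead into S,
      -- and S with v added has in `L` the cut that S has in `L′`, and the same value.
      main (inj₂ ((Sw₁ , Su₁) , p)) (inj₂ ((Sw₂ , Su₂) , q)) =
        trans (cong₂ good (trans (cut-lifted-in S k₁ k₂ {M = M} Sw₁ Su₁ Sw₂ Su₂) (sym cut-S⁺)) (sym (net-on A)))
          (sets S⁺ (trans (cong (_∨ ⁅ v ⁆ z) Sz) (⁅⁆-≢ (≢-sym z≢v))) (a , proj₁ (∧-true X′a) , cong (_∨ ⁅ v ⁆ a) (proj₂ (proj₂ m)))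
            (b , proj₁ (∧-true X′b) , z≢b , trans (cong (_∨ ⁅ v ⁆ b) (proj₂ (proj₂ (proj₂ o)))) (⁅⁆-≢ (X′-≢ X′b))))
        where
        S⁺ = S ∪ ⁅ v ⁆
        into : ∀ {w} → S w ≡ true → S⁺ w ≡ true
        into {w} = cong (_∨ ⁅ v ⁆ w)
        cut-S⁺ : cut L S⁺ ≡ cut M S
        cut-S⁺ = trans (cut-⟶ S⁺ r) (trans
          (cut-spokes-in S⁺ k₁ k₂ {M = M} (trans (cong (S v ∨_) (⁅⁆-refl v)) (Bool.∨-zeroʳ _)) (into Sw₁) (into Su₁) (into Sw₂) (into Su₂))
          (cut-agree X′-z valid-M λ w X′w → trans (cong (S w ∨_) (⁅⁆-≢ (X′-≢ X′w))) (Bool.∨-identityʳ _)))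

    net-z : net H′ ⁅ z ⁆ ≡ net H ⁅ z ⁆
    net-z = net-collapse H z≢v value-v z

    cut-z : cut L ⁅ z ⁆ ≡ cut L′ ⁅ z ⁆
    cut-z = trans (cut-⟶ ⁅ z ⁆ r) (trans (cut-z-lift hyp slack {k = k₁} {u₁} {N} z≢v (proj₁ (proj₂ (free-end vw₁))))
      (cong (crossing ⁅ z ⁆ (lifted k₁ w₁ u₁) +_) (cut-z-lift hyp slack {k = k₂} {u₂} {M} z≢v (proj₁ (proj₂ (free-end vw₂))))))

    fixed-z : fixedNet L ⁅ z ⁆ ≡ fixedNet L′ ⁅ z ⁆
    fixed-z = trans (fixedNet-⟶ ⁅ z ⁆ r) (trans (fixedNet-z-lift hyp slack {k = k₁} {u₁} {N} z≢v (proj₁ (proj₂ (free-end vw₁))))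
      (cong (fixedOut ⁅ z ⁆ (lifted k₁ w₁ u₁) ⊕_) (fixedNet-z-lift hyp slack {k = k₂} {u₂} {M} z≢v (proj₁ (proj₂ (free-end vw₂))))))

    remove : Smaller X L → Solvable L H
    remove smaller = solvable-⟶ r (solvable-lift k₁ (solvable-⟶ reorder (solvable-lift k₂ (solvable-⟶ (swap _ _)
      (solvable-demand (net-collapse H z≢v value-v) (smaller record
        { z∈X     = X′-z
        ; well-formed = valid-L′
        ; demand  = All.map⁺ (All.map (λ (p , q) → X′-π p , X′-π q) demand)
        ; balance = trans (cong₂ _⊕_ (sym fixed-z) net-z) balance
        ; z-small = trans (cong₂ small (sym cut-z) net-z) z-small
        ; sets    = sets′
        } (∖-card X Xv)))))))
      where
      X′-π : ∀ {w} → X w ≡ true → X′ (π w) ≡ true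
      X′-π {w} Xw with v Fin.≟ w
      ... | yes _  = X′-z
      ... | no v≢w = X′-intro Xw v≢w
      reorder : ∀ {a b c M} → a ∷ b ∷ c ∷ M ⟶ b ∷ c ∷ a ∷ M
      reorder {a} {b} {c} = swap a b ⟫ keep b (swap a c)

  -- Counting edges at a vertex

  module _ {X : Subset (Fin n)} {L : List (Link (Fin n))} {H : List (Arc (Fin n))} (hyp : Hyp X L H) (others : Others X) where
    open Hyp hyp

    vertex-good : ∀ {v} → X v ≡ true → z ≢ v → good (cut L ⁅ v ⁆) (net H ⁅ v ⁆) ≡ true
    vertex-good {v} Xv z≢v = let w , Xw , z≢w , v≢w = others v in
      sets ⁅ v ⁆ (⁅⁆-≢ (≢-sym z≢v)) (v , Xv , ⁅⁆-refl v) (w , Xw , z≢w , ⁅⁆-≢ v≢w)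

    rest-misses : ∀ {v} → X v ≡ true → z ≢ v → Misses X (rest v)
    rest-misses {v} Xv z≢v = v , Xv , z≢v , rest-v v

    rest-good : ∀ {v} → X v ≡ true → z ≢ v → good (cut L (rest v)) (net H (rest v)) ≡ true
    rest-good {v} Xv z≢v = let w , Xw , z≢w , v≢w = others v in
      sets (rest v) (rest-z v) (w , Xw , rest-true z≢w v≢w) (rest-misses Xv z≢v)

    rest-count : ∀ {v} → z ≢ v →
      cut L (rest v) + (fixedCut L ⁅ v ⁆ + fixedCut L ⁅ v ⁆) ≡ cut L ⁅ z ⁆ + cut L ⁅ v ⁆
    rest-count {v} z≢v = trans (cong (cut L (rest v) +_) (sym (total-+ (fixedCrossing ⁅ v ⁆) (fixedCrossing ⁅ v ⁆) L)))
      (cut-rest well-formed z≢v)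

    cut-z≤7 : cut L ⁅ z ⁆ ≤ 7
    cut-z≤7 = small⇒≤7 _ _ z-small

    -- If all edges at v went to z, then v and the remaining vertices would together send at least 4
    -- + 4 edges to z, which has degree at most 7.
    has-free : ∀ {v} → X v ≡ true → z ≢ v → 0 < freeCut L ⁅ v ⁆
    has-free {v} Xv z≢v = ℕ.n≢0⇒n>0 λ p → ℕ.<⇒≱ (s≤s cut-z≤7) (subst (8 ≤_) (sum p)
      (ℕ.+-mono-≤ (good⇒4≤ _ _ (rest-good Xv z≢v)) (good⇒4≤ _ _ (vertex-good Xv z≢v))))
      where
      all-fixed : freeCut L ⁅ v ⁆ ≡ 0 → fixedCut L ⁅ v ⁆ ≡ cut L ⁅ v ⁆
      all-fixed p = sym (trans (cut≡free+fixed L ⁅ v ⁆) (cong (_+ fixedCut L ⁅ v ⁆) p))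
      sum : freeCut L ⁅ v ⁆ ≡ 0 → cut L (rest v) + cut L ⁅ v ⁆ ≡ cut L ⁅ z ⁆
      sum p = ℕ.+-cancelʳ-≡ (cut L ⁅ v ⁆) _ _ (trans (ℕ.+-assoc (cut L (rest v)) _ _)
        (subst (λ f → cut L (rest v) + (f + f) ≡ cut L ⁅ z ⁆ + cut L ⁅ v ⁆) (all-fixed p) (rest-count z≢v)))

    -- With three of its four edges going to z, v would leave the remaining vertices with two edges
    -- fewer than z and the opposite value. Their lower bound would then push z above its upper
    -- bound.
    two-free : ∀ {v} → X v ≡ true → z ≢ v → cut L ⁅ v ⁆ ≡ 4 → net H ⁅ v ⁆ ≡ 0F → 2 ≤ freeCut L ⁅ v ⁆
    two-free {v} Xv z≢v d h = ℕ.≤∧≢⇒< (has-free Xv z≢v) λ one → true≢false z-small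
      (trans (small-neg _ _) (subst₂ (λ d h → small d h ≡ false) (count (sym one)) net-eq (good⇒slack⁺² _ _ (rest-good Xv z≢v))))
      where
      net-eq : net H (rest v) ≡ -₃ net H ⁅ z ⁆
      net-eq = trans (net-rest H z≢v) (cong -₃_ (trans (cong (net H ⁅ z ⁆ ⊕_) h) (⊕-identityʳ _)))
      count : freeCut L ⁅ v ⁆ ≡ 1 → 2 + cut L (rest v) ≡ cut L ⁅ z ⁆
      count one = ℕ.+-cancelʳ-≡ 4 _ _ (begin
        2 + cut L (rest v) + 4     ≡⟨ ℕ.+-comm (2 + cut L (rest v)) 4 ⟩
        6 + cut L (rest v)         ≡⟨ ℕ.+-comm 6 _ ⟩
        cut L (rest v) + (3 + 3)   ≡⟨ cong (λ f → cut L (rest v) + (f + f)) three ⟨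
        cut L (rest v) + (fixedCut L ⁅ v ⁆ + fixedCut L ⁅ v ⁆) ≡⟨ rest-count z≢v ⟩
        cut L ⁅ z ⁆ + cut L ⁅ v ⁆  ≡⟨ cong (cut L ⁅ z ⁆ +_) d ⟩
        cut L ⁅ z ⁆ + 4            ∎)
        where
        open ≡-Reasoning
        three : fixedCut L ⁅ v ⁆ ≡ 3
        three = ℕ.suc-injective (trans (cong (_+ fixedCut L ⁅ v ⁆) (sym one)) (trans (sym (cut≡free+fixed L ⁅ v ⁆)) d))

    module _ (slack : Slack X L H) where

      -- Each lifted pair needs a free edge that can continue the other edge of the pair; `two-free`
      -- supplies one for each.
      remove-degree-4 : Smaller X L → Simple L →
        ∀ {v} → X v ≡ true → z ≢ v → cut L ⁅ v ⁆ ≡ 4 → Solvable L H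
      remove-degree-4 smaller simple {v} Xv z≢v d = go
        where
        value-0 : net H ⁅ v ⁆ ≡ 0F
        value-0 = good-4 _ (subst (λ d → good d (net H ⁅ v ⁆) ≡ true) d (vertex-good Xv z≢v))
          where
          good-4 : ∀ h → good 4 h ≡ true → h ≡ 0F
          good-4 0F _ = refl
        across : ∀ {w} → v ≢ w → cross (⁅ v ⁆ v) (⁅ v ⁆ w) ≡ 1
        across v≢w = cong₂ cross (⁅⁆-refl v) (⁅⁆-≢ v≢w)
        first : ∃ λ w → ∃ λ M → L ⟶ free v w ∷ M × v ≢ w
        first = extractFree v L (has-free Xv z≢v)
        go : Solvable L H
        go with first
        ... | w₁ , M₁ , r₁ , v≢w₁ with extractFree v M₁ (s≤s⁻¹ (subst (2 ≤_)
                (trans (freeCut-⟶ ⁅ v ⁆ r₁) (cong (_+ freeCut M₁ ⁅ v ⁆) (across v≢w₁))) (two-free Xv z≢v d value-0)))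
        ... | w₂ , M₂ , r₂ , v≢w₂ = pairs (ℕ.suc-injective (ℕ.suc-injective (trans (sym (begin
            cut L ⁅ v ⁆            ≡⟨ cut-⟶ ⁅ v ⁆ (r₁ ⟫ keep _ r₂) ⟩
            _                      ≡⟨ cong₂ (λ a b → a + (b + cut M₂ ⁅ v ⁆)) (across v≢w₁) (across v≢w₂) ⟩
            2 + cut M₂ ⁅ v ⁆       ∎)) d)))
          where
          open ≡-Reasoning
          pairs : cut M₂ ⁅ v ⁆ ≡ 2 → Solvable L H
          pairs d₂ with extractSpoke v M₂ (subst (0 <_) (sym d₂) (s≤s z≤n))
          ... | k₁ , u₁ , M₃ , r₃ , v≢u₁ with ℕ.suc-injective (trans (sym (trans (cut-⟶ ⁅ v ⁆ r₃)
                  (cong (_+ cut M₃ ⁅ v ⁆) (trans (crossing-spoke ⁅ v ⁆ v k₁ u₁) (across v≢u₁))))) d₂)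
          ... | d₃ with extractSpoke v M₃ (subst (0 <_) (sym d₃) (s≤s z≤n))
          ... | k₂ , u₂ , M₄ , r₄ , v≢u₂ = Removal.remove hyp slack z≢v Xv value-0 {k₁ = k₁} {k₂ = k₂} r
                  (distinct-ends {k = k₁} well-formed simple (r ⟫ done))
                  (distinct-ends {k = k₂} well-formed simple (r ⟫ exchange)) v≢u₁ v≢u₂
                  (ℕ.suc-injective (trans (sym (trans (cut-⟶ ⁅ v ⁆ r₄)
                    (cong (_+ cut M₄ ⁅ v ⁆) (trans (crossing-spoke ⁅ v ⁆ v k₂ u₂) (across v≢u₂))))) d₃)) smaller
            where
            r : L ⟶ free v w₁ ∷ spoke v k₁ u₁ ∷ free v w₂ ∷ spoke v k₂ u₂ ∷ M₄
            r = r₁ ⟫ keep _ (r₂ ⟫ keep _ (r₃ ⟫ keep _ r₄) ⟫ swap _ _)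
            exchange : ∀ {a b c d : Link (Fin n)} {M} → a ∷ b ∷ c ∷ d ∷ M ⟶ c ∷ d ∷ a ∷ b ∷ M
            exchange = keep _ (swap _ _) ⟫ swap _ _ ⟫ keep _ (keep _ (swap _ _) ⟫ swap _ _)

      -- If z is isolated, the remaining vertices have the degree of v and the opposite value, so
      -- they too attain the bound. By `slack` they cannot be several, yet v has at least four
      -- edges, all free and no two parallel.
      z-not-isolated : Simple L →
        Tight X L H → cut L ⁅ z ⁆ ≢ 0
      z-not-isolated simple tight cut-z≡0 = go (others z)
        where
        uncrossed : All (λ e → crossing ⁅ z ⁆ e ≡ 0) L
        uncrossed = total≡0⇒All (crossing ⁅ z ⁆) cut-z≡0
        value-z : net H ⁅ z ⁆ ≡ 0F
        value-z = trans (sym (⊕-identityˡ _)) (trans (cong (_⊕ net H ⁅ z ⁆) (sym no-flow)) balance)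
          where
          none : ∀ e → crossing ⁅ z ⁆ e ≡ 0 → fixedOut ⁅ z ⁆ e ≡ 0F
          none (free a b)  p = refl
          none (fixed a b) p = trans (cong (flow (⁅ z ⁆ a)) (sym (cross-0 _ _ p))) (flow-refl _)
          no-flow : fixedNet L ⁅ z ⁆ ≡ 0F
          no-flow = total₃-0 (fixedOut ⁅ z ⁆) (All.map (λ {e} → none e) uncrossed)
        go : (∃ λ v → X v ≡ true × z ≢ v × z ≢ v) → ⊥
        go (v , Xv , z≢v , _) = two-ends (extractFree v L (has-free Xv z≢v))
          where
          no-fixed : ∀ {e} → Valid X e → crossing ⁅ z ⁆ e ≡ 0 → fixedCrossing ⁅ v ⁆ e ≡ 0
          no-fixed (free _ _ _ _ _) p = refl
          no-fixed {fixed _ b} (away _) p rewrite ⁅⁆-refl z with z Fin.≟ b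
          ... | yes refl = cong₂ cross (⁅⁆-≢ (≢-sym z≢v)) (⁅⁆-≢ (≢-sym z≢v))
          no-fixed {fixed b _} (to _) p rewrite ⁅⁆-refl z with z Fin.≟ b
          ... | yes refl = cong₂ cross (⁅⁆-≢ (≢-sym z≢v)) (⁅⁆-≢ (≢-sym z≢v))
          fixed-0 : fixedCut L ⁅ v ⁆ ≡ 0
          fixed-0 = total-0 (fixedCrossing ⁅ v ⁆) (All.zipWith (λ (p , q) → no-fixed p q) (well-formed , uncrossed))
          all-free : cut L ⁅ v ⁆ ≡ freeCut L ⁅ v ⁆
          all-free = trans (cut≡free+fixed L ⁅ v ⁆) (trans (cong (freeCut L ⁅ v ⁆ +_) fixed-0) (ℕ.+-identityʳ _))
          cut-rest-v : cut L (rest v) ≡ cut L ⁅ v ⁆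
          cut-rest-v = trans (sym (ℕ.+-identityʳ _)) (trans
            (subst (λ f → cut L (rest v) + (f + f) ≡ cut L ⁅ z ⁆ + cut L ⁅ v ⁆) fixed-0 (rest-count z≢v))
            (cong (_+ cut L ⁅ v ⁆) cut-z≡0))
          net-rest-v : net H (rest v) ≡ -₃ net H ⁅ v ⁆
          net-rest-v = trans (net-rest H z≢v) (cong -₃_ (trans (cong (_⊕ net H ⁅ v ⁆) value-z) (⊕-identityˡ _)))
          two-ends : (∃ λ w → ∃ λ M → L ⟶ free v w ∷ M × v ≢ w) → ⊥
          two-ends (w₁ , M₁ , r₁ , v≢w₁) = second (extractFree v M₁
            (ℕ.≤-trans (s≤s z≤n) (s≤s⁻¹ (subst (4 ≤_) count (good⇒4≤ _ _ (vertex-good Xv z≢v))))))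
            where
            count : cut L ⁅ v ⁆ ≡ suc (freeCut M₁ ⁅ v ⁆)
            count = trans all-free (trans (freeCut-⟶ ⁅ v ⁆ r₁)
              (cong (_+ freeCut M₁ ⁅ v ⁆) (cong₂ cross (⁅⁆-refl v) (⁅⁆-≢ v≢w₁))))
            second : (∃ λ w → ∃ λ M → M₁ ⟶ free v w ∷ M × v ≢ w) → ⊥
            second (w₂ , M₂ , r₂ , v≢w₂) = apart (All-⟶ valid-sym (r₁ ⟫ keep _ r₂) well-formed)
              where
              apart : All (Valid X) (free v w₁ ∷ free v w₂ ∷ M₂) → ⊥
              apart (free _ Xw₁ _ z≢w₁ _ ∷ free _ Xw₂ _ z≢w₂ _ ∷ _) = true≢false (tight v Xv z≢v)
                (trans (small-neg _ _) (trans (sym (cong₂ small cut-rest-v net-rest-v)) (slack (rest v) (rest-z v)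
                  (w₁ , w₂ , Xw₁ , Xw₂ , rest-true z≢w₁ v≢w₁ , rest-true z≢w₂ v≢w₂ ,
                    λ { refl → simple (r₁ ⟫ keep _ r₂) }) (rest-misses Xv z≢v))))

      all-up : Lighter X L → cut L ⁅ z ⁆ ≢ 0 →
        (∀ v → X v ≡ true → z ≢ v → up (cut L ⁅ v ⁆) (net H ⁅ v ⁆) ≡ true) → Solvable L H
      all-up lighter isolated up-all = go (findEdge incoming? L)
        where
        Incoming : Link (Fin n) → Set
        Incoming e = ∃ λ x → e ≡ fixed x z × z ≢ x
        incoming? : ∀ e → Dec (Incoming e)
        incoming? (free a b) = no λ ()
        incoming? (fixed a b) with b Fin.≟ z | z Fin.≟ a
        ... | yes refl | no z≢a = yes (a , refl , z≢a)
        ... | no b≢z   | _      = no λ { (x , refl , _) → b≢z refl }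
        ... | yes refl | yes p  = no λ { (x , refl , q) → q p }
        outgoing : ∀ {L} → All (Valid X) L → All (¬_ ∘ Incoming) L → fixedNet L ⁅ z ⁆ ≡ ones (cut L ⁅ z ⁆)
        outgoing [] [] = sym ones-zero
        outgoing {free a b ∷ L} (free _ _ z≢a z≢b _ ∷ ps) (_ ∷ qs) rewrite ⁅⁆-≢ z≢a | ⁅⁆-≢ z≢b =
          trans (⊕-identityˡ _) (outgoing ps qs)
        outgoing {fixed _ b ∷ L} (away _ ∷ ps) (_ ∷ qs) rewrite ⁅⁆-refl z with z Fin.≟ b
        ... | yes _ = trans (⊕-identityˡ _) (outgoing ps qs)
        ... | no _  = trans (cong (1F ⊕_) (outgoing ps qs)) (sym (ones-suc _))
        outgoing {fixed b _ ∷ L} (to _ ∷ ps) (q ∷ qs) rewrite ⁅⁆-refl z with z Fin.≟ b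
        ... | yes _  = trans (⊕-identityˡ _) (outgoing ps qs)
        ... | no z≢b = contradiction (b , refl , z≢b) q
        go : (∃ λ e → ∃ λ M → L ⟶ e ∷ M × Incoming e) ⊎ All (¬_ ∘ Incoming) L → Solvable L H
        go (inj₁ (_ , M , r , x , refl , z≢x)) = drop-arc hyp slack lighter r z≢x Xx (up-all x Xx z≢x)
          where
          end : Valid X (fixed x z) → X x ≡ true
          end (away _) = z∈X
          end (to Xx)  = Xx
          Xx = end (All.head (All-⟶ valid-sym r well-formed))
        go (inj₂ none) = turn (extractSpoke z L (ℕ.n≢0⇒n>0 isolated))
          where
          turn : (∃ λ k → ∃ λ w → ∃ λ M → L ⟶ spoke z k w ∷ M × z ≢ w) → Solvable L H
          turn (free , w , M , r , _) with All-⟶ valid-sym r well-formed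
          ... | free _ _ z≢z _ _ ∷ _ = contradiction refl z≢z
          turn (inward , w , M , r , z≢w) = contradiction (w , refl , z≢w)
            (All.head (All-⟶ (λ { _ (_ , () , _) }) r none))
          turn (outward , x , M , r , z≢x) = beyond (extractFree x M (subst (0 <_) (freeCut-⟶ ⁅ x ⁆ r) (has-free Xx z≢x)))
            where
            end : Valid X (fixed z x) → X x ≡ true
            end (away Xx) = Xx
            end (to _)    = z∈X
            Xx = end (All.head (All-⟶ valid-sym r well-formed))
            beyond : (∃ λ y → ∃ λ M′ → M ⟶ free x y ∷ M′ × x ≢ y) → Solvable L H
            beyond (y , M′ , r′ , _) with All-⟶ valid-sym (r ⟫ keep _ r′) well-formed
            ... | _ ∷ free _ Xy _ z≢y _ ∷ _ = reverse-arc hyp slack lighter (r ⟫ keep _ r′)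
              (up-all x Xx z≢x) (up-all y Xy z≢y) (outgoing well-formed none)

    -- With no free edge between the two classes, all edges leaving either class go to z: at least 4
    -- + 4 against degree at most 7.
    not-mixed : ∀ {P : Subset (Fin n)} → All (Uniform P) L →
      ∀ {p q} → X p ≡ true → z ≢ p → P p ≡ true → X q ≡ true → z ≢ q → P q ≡ false → ⊥
    not-mixed {P} same {p} {q} Xp z≢p Pp Xq z≢q Pq = ℕ.<⇒≱ (s≤s cut-z≤7) (subst (8 ≤_) sum (ℕ.+-mono-≤
      (good⇒4≤ _ _ (sets A (A-z P) (p , Xp , A-in P z≢p Pp) (q , Xq , z≢q , A-out P Pq)))
      (good⇒4≤ _ _ (sets B (A-z (not ∘ P)) (q , Xq , A-in (not ∘ P) z≢q (cong not Pq)) (p , Xp , z≢p , A-out (not ∘ P) (cong not Pp))))))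
      where
      side : Subset (Fin n) → Subset (Fin n)
      side P v = not (⁅ z ⁆ v) ∧ P v
      A = side P
      B = side (not ∘ P)
      A-z : ∀ P → side P z ≡ false
      A-z P = cong (λ b → not b ∧ P z) (⁅⁆-refl z)
      A-in : ∀ P {v} → z ≢ v → P v ≡ true → side P v ≡ true
      A-in P z≢v Pv = ∧-intro (cong not (⁅⁆-≢ z≢v)) Pv
      A-out : ∀ P {v} → P v ≡ false → side P v ≡ false
      A-out P {v} Pv = trans (cong (not (⁅ z ⁆ v) ∧_) Pv) (Bool.∧-zeroʳ _)
      bits : ∀ a b → cross false (not a ∧ b) + cross false (not a ∧ not b) ≡ cross true a + 0
      bits true  b     = refl
      bits false true  = refl
      bits false false = refl
      eq : ∀ {e} → Valid X e → Uniform P e →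
        crossing A e + crossing B e ≡ crossing ⁅ z ⁆ e + 0
      eq {free x y} (free _ _ z≢x z≢y _) s rewrite ⁅⁆-≢ z≢x | ⁅⁆-≢ z≢y | s with P y
      ... | true  = refl
      ... | false = refl
      eq {fixed _ y} (away _) _ rewrite ⁅⁆-refl z = bits (⁅ z ⁆ y) (P y)
      eq {fixed y _} (to _) _ rewrite ⁅⁆-refl z | cross-sym (side P y) false
        | cross-sym (side (not ∘ P) y) false | cross-sym (⁅ z ⁆ y) true = bits (⁅ z ⁆ y) (P y)
      sum : cut L A + cut L B ≡ cut L ⁅ z ⁆
      sum = trans (total-sum (All.zipWith (λ (p , q) → eq p q) (well-formed , same)))
        (trans (cong (cut L ⁅ z ⁆ +_) (total-0 (λ _ → 0) (All.universal (λ _ → refl) L))) (ℕ.+-identityʳ _))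

  -- The induction step with prescribed edges

  mirrored : ∀ {X L H} → Hyp X L H → Hyp X (map mirror L) (map flipArc H)
  mirrored {X} {L} {H} hyp = record
    { z∈X     = z∈X
    ; well-formed = All.map⁺ (All.map valid-mirror well-formed)
    ; demand  = All.map⁺ (All.map (λ (p , q) → q , p) demand)
    ; balance = trans (cong₂ _⊕_ (fixedNet-mirror L ⁅ z ⁆) (net-flip H ⁅ z ⁆))
        (trans (sym (-₃-⊕ (fixedNet L ⁅ z ⁆) _)) (cong -₃_ balance))
    ; z-small = trans (cong₂ small (cut-mirror L ⁅ z ⁆) (net-flip H ⁅ z ⁆)) (trans (sym (small-neg _ _)) z-small)
    ; sets    = λ A Az m o → trans (cong₂ good (cut-mirror L A) (net-flip H A)) (trans (sym (good-neg _ _)) (sets A Az m o))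
    }
    where
    open Hyp hyp
    valid-mirror : ∀ {e} → Valid X e → Valid X (mirror e)
    valid-mirror (free Xu Xv z≢u z≢v u≢v) = free Xu Xv z≢u z≢v u≢v
    valid-mirror (away Xv) = to Xv
    valid-mirror (to Xv)   = away Xv

  misses? : ∀ X A → Dec (Misses X A)
  misses? X A = any? λ v → (X v Bool.≟ true) ×-dec ¬? (z Fin.≟ v) ×-dec (A v Bool.≟ false)

  step : ∀ {X L H} → Hyp X L H → Smaller X L → Lighter X L → Solvable L H
  step {X} {L} {H} hyp smaller lighter = by-vertices (any? λ a → any? λ b →
    (X a Bool.≟ true) ×-dec (X b Bool.≟ true) ×-dec ¬? (z Fin.≟ a) ×-dec ¬? (z Fin.≟ b) ×-dec ¬? (a Fin.≟ b))
    where
    open Hyp hyp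
    module _ (others : Others X)
      (slack : Slack X L H)
      (simple : Simple L)
      (tight : Tight X L H)
      (no-4 : ∀ v → X v ≡ true → z ≢ v → cut L ⁅ v ⁆ ≢ 4) where

      UP DN : Fin n → Bool
      UP v = up (cut L ⁅ v ⁆) (net H ⁅ v ⁆)
      DN v = dn (cut L ⁅ v ⁆) (net H ⁅ v ⁆)

      isolated : cut L ⁅ z ⁆ ≢ 0
      isolated = z-not-isolated hyp others slack simple tight

      up-or-dn : ∀ v → X v ≡ true → z ≢ v → UP v ∨ DN v ≡ true
      up-or-dn v Xv z≢v = tight⇒up∨dn _ _ (vertex-good hyp others Xv z≢v) (tight v Xv z≢v) (no-4 v Xv z≢v)

      not-up : ∀ v → X v ≡ true → z ≢ v → UP v ≡ false → DN v ≡ true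
      not-up v Xv z≢v p with up-or-dn v Xv z≢v
      ... | q rewrite p = q

      Directed : Link (Fin n) → Set
      Directed (free x y)  = (UP x ≡ true × DN y ≡ true) ⊎ (UP y ≡ true × DN x ≡ true)
      Directed (fixed x y) = ⊥

      directed? : ∀ e → Dec (Directed e)
      directed? (free x y) = ((UP x Bool.≟ true) ×-dec (DN y Bool.≟ true)) ⊎-dec ((UP y Bool.≟ true) ×-dec (DN x Bool.≟ true))
      directed? (fixed x y) = no λ ()

      -- A vertex that is not `UP` is `DN`, so an edge from an `UP` vertex to it could be oriented
      -- and deleted.
      uniform : ∀ {e} → Valid X e → ¬ Directed e → Uniform UP e
      uniform {free x y} (free Xx Xy z≢x z≢y _) ¬d with UP x in ux | UP y in uy
      ... | true  | true  = refl
      ... | false | false = refl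
      ... | true  | false = contradiction (inj₁ (refl , not-up y Xy z≢y uy)) ¬d
      ... | false | true  = contradiction (inj₂ (refl , not-up x Xx z≢x ux)) ¬d
      uniform {fixed x y} _ _ = tt

      orientations : Dec (∃ λ p → X p ≡ true × z ≢ p × UP p ≡ true) → Dec (∃ λ q → X q ≡ true × z ≢ q × UP q ≡ false) →
        All (¬_ ∘ Directed) L → Solvable L H
      orientations (yes (p , Xp , z≢p , up-p)) (yes (q , Xq , z≢q , up-q)) none =
        ⊥-elim (not-mixed hyp others (All.zipWith (λ (p , q) → uniform p q) (well-formed , none)) Xp z≢p up-p Xq z≢q up-q)
      orientations _ (no all) none = all-up hyp others slack lighter isolated λ v Xv z≢v →
        Bool.¬-not λ p → all (v , Xv , z≢v , p)
      -- Now every vertex is `DN`, and reversing all directions makes every vertex `UP`.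
      orientations (no none-up) _ none = solvable-mirror (all-up (mirrored hyp) others
        (λ A Az t o → trans (cong₂ small (cut-mirror L A) (net-flip H A)) (trans (sym (small-neg _ _)) (slack A Az t o)))
        (λ hyp′ l → lighter hyp′ (subst (_ <_) (weight-mirror L) l))
        (λ p → isolated (trans (sym (cut-mirror L ⁅ z ⁆)) p))
        λ v Xv z≢v → trans (cong₂ up (cut-mirror L ⁅ v ⁆) (net-flip H ⁅ v ⁆)) (trans (up-neg (cut L ⁅ v ⁆) (net H ⁅ v ⁆))
          (not-up v Xv z≢v (Bool.¬-not λ p → none-up (v , Xv , z≢v , p)))))

      directed : (∃ λ e → ∃ λ M → L ⟶ e ∷ M × Directed e) ⊎ All (¬_ ∘ Directed) L → Solvable L H
      directed (inj₁ (free x y , M , r , inj₁ (ux , dy))) = orient-edge hyp slack lighter r ux dy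
      directed (inj₁ (free x y , M , r , inj₂ (uy , dx))) = orient-edge hyp slack lighter (r ⟫ flip x y) uy dx
      directed (inj₂ none) = orientations
        (any? λ p → (X p Bool.≟ true) ×-dec ¬? (z Fin.≟ p) ×-dec (UP p Bool.≟ true))
        (any? λ q → (X q Bool.≟ true) ×-dec ¬? (z Fin.≟ q) ×-dec (UP q Bool.≟ false)) none

    module _ (others : Others X)
      (slack : Slack X L H)
      (simple : Simple L) where

      degree-4 : Tight X L H →
        Dec (∃ λ v → X v ≡ true × z ≢ v × cut L ⁅ v ⁆ ≡ 4) → Solvable L H
      degree-4 tight (yes (v , Xv , z≢v , d)) = remove-degree-4 hyp others slack smaller simple Xv z≢v d
      degree-4 tight (no none) = directed others slack simple tight no-4 (findEdge (directed? others slack simple tight no-4) L)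
        where
        no-4 : ∀ v → X v ≡ true → z ≢ v → cut L ⁅ v ⁆ ≢ 4
        no-4 v Xv z≢v d = none (v , Xv , z≢v , d)

      slack-vertex : Dec (∃ λ v → X v ≡ true × z ≢ v × small (cut L ⁅ v ⁆) (net H ⁅ v ⁆) ≡ false) → Solvable L H
      slack-vertex (no none) = degree-4 (λ v Xv z≢v → Bool.¬-not λ p → none (v , Xv , z≢v , p))
        (any? λ v → (X v Bool.≟ true) ×-dec ¬? (z Fin.≟ v) ×-dec (cut L ⁅ v ⁆ ℕ.≟ 4))
      slack-vertex (yes (v , Xv , z≢v , s)) with extractFree v L (has-free hyp others Xv z≢v)
      ... | w , M , r , v≢w with extractSpoke v M (ℕ.≤-trans (s≤s z≤n) (s≤s⁻¹ (subst (6 ≤_)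
              (trans (cut-⟶ ⁅ v ⁆ r) (cong (_+ cut M ⁅ v ⁆) (cong₂ cross (⁅⁆-refl v) (⁅⁆-≢ v≢w)))) (slack⇒6≤ _ _ s))))
      ... | k , u , M′ , r′ , v≢u = lift-edges hyp slack lighter {k = k} s
              (distinct-ends {k = k} well-formed simple (r ⟫ keep _ r′)) (r ⟫ keep _ r′)

    parallel : Others X →
      Slack X L H →
      Dec (∃ λ v → ∃ λ w → 1 < multiplicity L v w) → Solvable L H
    parallel others slack (yes (v , w , p)) with extractJoining v w L (ℕ.<⇒≤ p)
    ... | M , r with extractJoining v w M (s≤s⁻¹ (subst (1 <_)
                       (trans (multiplicity-⟶ v w r) (cong (_+ multiplicity M v w) (joining-refl v w))) p))
    ... | M′ , r′ = contract-parallel hyp smaller (r ⟫ keep _ r′)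
    parallel others slack (no none) = slack-vertex others slack
      (λ {v} {w} {M} r → none (v , w , subst (1 <_) (sym (trans (multiplicity-⟶ v w r)
        (cong₂ (λ a b → a + (b + multiplicity M v w)) (joining-refl v w) (joining-refl v w)))) (s≤s (s≤s z≤n))))
      (any? λ v → (X v Bool.≟ true) ×-dec ¬? (z Fin.≟ v) ×-dec (small (cut L ⁅ v ⁆) (net H ⁅ v ⁆) Bool.≟ false))

    Small : Subset (Fin n) → Set
    Small A = A z ≡ false × Twice X A × Misses X A × small (cut L A) (net H A) ≡ true

    small-resp : ∀ {S T} → (∀ v → S v ≡ T v) → Small S → Small T
    small-resp p (Sz , (a , b , Xa , Xb , Sa , Sb , a≢b) , (w , Xw , z≢w , Sw) , s) =
      trans (sym (p z)) Sz , (a , b , Xa , Xb , trans (sym (p a)) Sa , trans (sym (p b)) Sb , a≢b) ,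
      (w , Xw , z≢w , trans (sym (p w)) Sw) , trans (sym (cong₂ small (cut-ext L p) (net-ext H p))) s

    contractions : Others X → Dec (∃ Small) → Solvable L H
    contractions others (yes (A , Az , t , o , s)) = contract-small hyp smaller A Az s t o
    contractions others (no none) = parallel others
      (λ A Az t o → Bool.¬-not λ s → none (A , Az , t , o , s))
      (any? λ v → any? λ w → 1 <? multiplicity L v w)

    by-vertices : Dec (∃ λ a → ∃ λ b → X a ≡ true × X b ≡ true × z ≢ a × z ≢ b × a ≢ b) → Solvable L H
    by-vertices (no none) = small-case hyp λ a b Xa Xb z≢a z≢b → decidable-stable (a Fin.≟ b)
      λ a≢b → none (a , b , Xa , Xb , z≢a , z≢b , a≢b)
    by-vertices (yes (a , b , Xa , Xb , z≢a , z≢b , a≢b)) = contractions others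
      (findSubset small-resp λ A → (A z Bool.≟ false) ×-dec twice? X A ×-dec misses? X A ×-dec (small (cut L A) (net H A) Bool.≟ true))
      where
      others : Others X
      others v with v Fin.≟ a
      ... | yes refl = b , Xb , z≢b , a≢b
      ... | no v≢a   = a , Xa , z≢a , v≢a

  solve : ∀ k w {X L H} → Hyp X L H → card X < k → weight L < w → Solvable L H
  solve (suc k) (suc w) hyp p q = step hyp
    -- The induction is lexicographic: with fewer vertices, any weight is allowed.
    (λ {_} {L′} hyp′ r → solve k (suc (weight L′)) hyp′ (ℕ.<-≤-trans r (s≤s⁻¹ p)) (ℕ.n<1+n _))
    (λ hyp′ r → solve (suc k) w hyp′ p (ℕ.<-≤-trans r (s≤s⁻¹ q)))

  extend : ∀ {X L H} → Hyp X L H → Solvable L H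
  extend hyp = solve _ _ hyp (ℕ.n<1+n _) (ℕ.n<1+n _)

-- Truth tables and concatenated edge lists

∀ᵇ : (Bool → Bool) → Bool
∀ᵇ f = f true ∧ f false

-- Iterated, this proves an identity in several Boolean variables by evaluating its truth table.
∀ᵇ-sound : ∀ f → ∀ᵇ f ≡ true → ∀ b → f b ≡ true
∀ᵇ-sound f p true  = proj₁ (∧-true p)
∀ᵇ-sound f p false = proj₂ (∧-true {f true} p)

≡ᵇ-sound : ∀ {m k} → (m ≡ᵇ k) ≡ true → m ≡ k
≡ᵇ-sound {m} {k} p = ℕ.≡ᵇ⇒≡ m k (subst T (sym p) tt)

⟶-++ʳ : ∀ {L M : List (Link V)} N → L ⟶ M → L ++ N ⟶ M ++ N
⟶-++ʳ N done       = done
⟶-++ʳ N (keep e r) = keep e (⟶-++ʳ N r)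
⟶-++ʳ N (swap e f) = swap e f
⟶-++ʳ N (flip u v) = flip u v
⟶-++ʳ N (r ⟫ s)    = ⟶-++ʳ N r ⟫ ⟶-++ʳ N s

⟶-++ˡ : ∀ (N : List (Link V)) {L M} → L ⟶ M → N ++ L ⟶ N ++ M
⟶-++ˡ []      r = r
⟶-++ˡ (e ∷ N) r = keep e (⟶-++ˡ N r)

⟶-++-comm : ∀ (L M : List (Link V)) → L ++ M ⟶ M ++ L
⟶-++-comm []      M = subst (M ⟶_) (sym (++-identityʳ M)) done
⟶-++-comm (e ∷ L) M = keep e (⟶-++-comm L M) ⟫ ⟶-shift M e

⟶-++-swap : ∀ (L M N : List (Link V)) → L ++ (M ++ N) ⟶ M ++ (L ++ N)
⟶-++-swap L M N = subst₂ _⟶_ (++-assoc L M N) (++-assoc M L N) (⟶-++ʳ N (⟶-++-comm L M))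

-- Spanning subgraphs and small cuts

data Plain (X : Subset (Fin n)) : Link (Fin n) → Set where
  plain : ∀ {u v} → X u ≡ true → X v ≡ true → u ≢ v → Plain X (free u v)

plain-sym : ∀ {u v} → Plain X (free u v) → Plain X (free v u)
plain-sym (plain Xu Xv u≢v) = plain Xv Xu (≢-sym u≢v)

-- Connectedness in terms of cuts, a form that passes directly to contractions and liftings.
Spans : Subset (Fin n) → List (Link (Fin n)) → Set
Spans X T = ∀ A → Meets X A → Meets X (not ∘ A) → 1 ≤ cut T A

record Spanning (X : Subset (Fin n)) (T : List (Link (Fin n))) : Set where
  constructor spanning
  field
    well-formed : All (Plain X) T
    spans : Spans X T

open Spanning

plain-agree : ∀ {S T : Subset (Fin n)} {L} → All (Plain X) L → (∀ v → X v ≡ true → S v ≡ T v) → cut L S ≡ cut L T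
plain-agree {S = S} {T} ok p = total-cong (All.map eq ok)
  where
  eq : ∀ {e} → Plain _ e → crossing S e ≡ crossing T e
  eq (plain Xu Xv _) = cong₂ cross (p _ Xu) (p _ Xv)

innerCrossing : Subset V → Subset V → Link V → ℕ
innerCrossing A S e = if inside A e then crossing S e else 0

innerCut : Subset V → List (Link V) → Subset V → ℕ
innerCut A T S = total (innerCrossing A S) T

-- The edges of T with both ends in A connect the vertices of X in A.
Inner : Subset (Fin n) → Subset (Fin n) → List (Link (Fin n)) → Set
Inner X A T = ∀ S → Meets X (λ v → A v ∧ S v) → Meets X (λ v → A v ∧ not (S v)) → 1 ≤ innerCut A T S

meets? : ∀ (X A : Subset (Fin n)) → Dec (Meets X A)
meets? X A = any? λ v → (X v Bool.≟ true) ×-dec (A v Bool.≟ true)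

meets-resp : ∀ {A B : Subset (Fin n)} → (∀ v → A v ≡ B v) → Meets X A → Meets X B
meets-resp p (v , Xv , Av) = v , Xv , trans (sym (p v)) Av

Split : Subset (Fin n) → Subset (Fin n) → List (Link (Fin n)) → Subset (Fin n) → Set
Split X A T S = Meets X (λ v → A v ∧ S v) × Meets X (λ v → A v ∧ not (S v)) × innerCut A T S ≡ 0

inner? : ∀ X A (T : List (Link (Fin n))) → ∃ (Split X A T) ⊎ Inner X A T
inner? X A T with findSubset split-resp (λ S → meets? X (λ v → A v ∧ S v) ×-dec meets? X (λ v → A v ∧ not (S v))
  ×-dec (innerCut A T S ℕ.≟ 0))
  where
  split-resp : ∀ {S S′} → (∀ v → S v ≡ S′ v) → Split X A T S → Split X A T S′
  split-resp p (m , m′ , c) = meets-resp (λ v → cong (A v ∧_) (p v)) m , meets-resp (λ v → cong (λ b → A v ∧ not b) (p v)) m′ ,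
    trans (sym (total-cong (All.universal eq T))) c
    where
    eq : ∀ e → innerCrossing A _ e ≡ innerCrossing A _ e
    eq (free u v)  = cong (λ c → if A u ∧ A v then c else 0) (cong₂ cross (p u) (p v))
    eq (fixed u v) = refl
... | yes found = inj₁ found
... | no none   = inj₂ λ S m m′ → ℕ.n≢0⇒n>0 λ c → none (S , m , m′ , c)

module _ {X : Subset (Fin n)} {T : List (Link (Fin n))} (T-spanning : Spanning X T) where

  private
    only-plain : ∀ {f g : Link (Fin n) → ℕ} → (∀ u v → f (free u v) ≡ g (free u v)) → total f T ≡ total g T
    only-plain {f} {g} p = total-cong (All.map eq (well-formed T-spanning))
      where
      eq : ∀ {e} → Plain X e → f e ≡ g e
      eq {free u v} _ = p u v

  -- An edge between the two halves of A counts at both of them, and an edge that leaves A counts at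
  -- one.
  split-halves : ∀ A S → cut T (λ v → A v ∧ S v) + cut T (λ v → A v ∧ not (S v)) ≡ cut T A + (innerCut A T S + innerCut A T S)
  split-halves A S = trans (sym (total-+ (crossing (λ v → A v ∧ S v)) (crossing (λ v → A v ∧ not (S v))) T))
    (trans (only-plain (λ u v → bits (A u) (A v) (S u) (S v)))
      (trans (total-+ (crossing A) (λ e → innerCrossing A S e + innerCrossing A S e) T)
        (cong (cut T A +_) (total-+ (innerCrossing A S) (innerCrossing A S) T))))
    where
    f : Bool → Bool → Bool → Bool → Bool
    f a b s t = (cross (a ∧ s) (b ∧ t) + cross (a ∧ not s) (b ∧ not t)) ≡ᵇ
      (cross a b + ((if a ∧ b then cross s t else 0) + (if a ∧ b then cross s t else 0)))
    bits : ∀ a b s t → cross (a ∧ s) (b ∧ t) + cross (a ∧ not s) (b ∧ not t) ≡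
      cross a b + ((if a ∧ b then cross s t else 0) + (if a ∧ b then cross s t else 0))
    bits a b s t = ≡ᵇ-sound (∀ᵇ-sound (f a b s) (∀ᵇ-sound (λ s → ∀ᵇ (f a b s)) (∀ᵇ-sound (λ b → ∀ᵇ λ s → ∀ᵇ (f a b s))
      (∀ᵇ-sound (λ a → ∀ᵇ λ b → ∀ᵇ λ s → ∀ᵇ (f a b s)) refl a) b) s) t)

  half-meets : ∀ (A S : Subset (Fin n)) → Meets X (λ v → A v ∧ S v) → Meets X (λ v → A v ∧ not (S v)) →
    1 ≤ cut T (λ v → A v ∧ S v) × 1 ≤ cut T (λ v → A v ∧ not (S v))
  half-meets A S (v , Xv , p) (w , Xw , q) =
    spans T-spanning (λ v → A v ∧ S v) (v , Xv , p) (w , Xw , other (A w) (S w) q) ,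
    spans T-spanning (λ v → A v ∧ not (S v)) (w , Xw , q) (v , Xv , other′ (A v) (S v) p)
    where
    other : ∀ a s → a ∧ not s ≡ true → not (a ∧ s) ≡ true
    other true false _ = refl
    other′ : ∀ a s → a ∧ s ≡ true → not (a ∧ not s) ≡ true
    other′ true true _ = refl

  -- Each half needs an edge that leaves it, and without edges between the halves these are distinct
  -- edges of the cut of A.
  split-cut : ∀ {A S : Subset (Fin n)} → Split X A T S → 2 ≤ cut T A
  split-cut {A} {S} (m , m′ , c) = let p , q = half-meets A S m m′ in
    subst (2 ≤_) (trans (split-halves A S) (trans (cong (λ d → cut T A + (d + d)) c) (ℕ.+-identityʳ _))) (ℕ.+-mono-≤ p q)

  cut-1⇒inner : ∀ A → cut T A ≡ 1 → Inner X A T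
  cut-1⇒inner A d with inner? X A T
  ... | inj₁ (S , split) = contradiction (subst (2 ≤_) d (split-cut split)) λ { (s≤s ()) }
  ... | inj₂ inner       = inner

  -- If both sides of a 2-cut fell apart, the four pieces would be joined by
  -- only two edges.
  cut-2⇒inner : ∀ A → cut T A ≡ 2 → Inner X A T ⊎ Inner X (not ∘ A) T
  cut-2⇒inner A d with inner? X A T | inner? X (not ∘ A) T
  ... | inj₂ inner | _          = inj₁ inner
  ... | inj₁ _     | inj₂ inner = inj₂ inner
  ... | inj₁ (S , m₁ , m₂ , c) | inj₁ (S′ , m₃ , m₄ , c′) = contradiction parity (odd innerPairs)
    where
    B : Subset (Fin n)
    B v = not (A v)
    -- `C` unites `A₁` with one half of `B`, and `C′` unites it with the other. Each of the two
    -- edges of the cut of `A` crosses exactly one of `C` and `C′`, and no other edge does, so `C`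
    -- has cut 1. But `A₁` and `B₁` have cut 1 each, and 1 + 1 = 1 + 2k is impossible for the number
    -- k of edges between them.
    A₁ B₁ C C′ : Subset (Fin n)
    A₁ v = A v ∧ S v
    B₁ v = B v ∧ S′ v
    C  v = if A v then S v else S′ v
    C′ v = if A v then S v else not (S′ v)
    pairCrossing : Link (Fin n) → ℕ
    pairCrossing (free u v)  = if (A₁ u ∧ B₁ v) ∨ (B₁ u ∧ A₁ v) then 1 else 0
    pairCrossing (fixed u v) = 0
    innerPairs = total pairCrossing T
    odd : ∀ k → 2 ≢ 1 + (k + k)
    odd (suc k) p = contradiction (trans (ℕ.suc-injective (ℕ.suc-injective p)) (ℕ.+-suc k k)) λ ()
    one : ∀ {a b} → 1 ≤ a → 1 ≤ b → a + b ≡ 2 → a ≡ 1 × b ≡ 1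
    one {suc zero} {suc zero} _ _ _ = refl , refl
    one {suc (suc a)} {suc b} _ _ p = contradiction (ℕ.suc-injective (ℕ.suc-injective (trans (cong (λ x → 2 + x) (sym (ℕ.+-suc a b))) p))) λ ()
    halves : ∀ A S → Meets X (λ v → A v ∧ S v) → Meets X (λ v → A v ∧ not (S v)) → innerCut A T S ≡ 0 → cut T A ≡ 2 →
      cut T (λ v → A v ∧ S v) ≡ 1
    halves A S m m′ c d = let p , q = half-meets A S m m′ in
      proj₁ (one p q (trans (split-halves A S) (trans (cong (λ d → cut T A + (d + d)) c) (trans (ℕ.+-identityʳ _) d))))
    A₁-1 : cut T A₁ ≡ 1
    A₁-1 = halves A S m₁ m₂ c d
    B₁-1 : cut T B₁ ≡ 1
    B₁-1 = halves B S′ m₃ m₄ c′ (trans (cut-not T A) d)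
    joined : cut T A₁ + cut T B₁ ≡ cut T C + (innerPairs + innerPairs)
    joined = trans (sym (total-+ (crossing A₁) (crossing B₁) T))
      (trans (only-plain (λ u v → bits (A u) (A v) (S u) (S v) (S′ u) (S′ v)))
      (trans (total-+ (crossing C) (λ e → pairCrossing e + pairCrossing e) T) (cong (cut T C +_) (total-+ pairCrossing pairCrossing T))))
      where
      pairs : Bool → Bool → Bool → Bool → Bool → Bool → ℕ
      pairs a b s t s′ t′ = if ((a ∧ s) ∧ (not b ∧ t′)) ∨ ((not a ∧ s′) ∧ (b ∧ t)) then 1 else 0
      f : Bool → Bool → Bool → Bool → Bool → Bool → Bool
      f a b s t s′ t′ = (cross (a ∧ s) (b ∧ t) + cross (not a ∧ s′) (not b ∧ t′)) ≡ᵇ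
        (cross (if a then s else s′) (if b then t else t′) + (pairs a b s t s′ t′ + pairs a b s t s′ t′))
      bits : ∀ a b s t s′ t′ → cross (a ∧ s) (b ∧ t) + cross (not a ∧ s′) (not b ∧ t′) ≡
        cross (if a then s else s′) (if b then t else t′) + (pairs a b s t s′ t′ + pairs a b s t s′ t′)
      bits a b s t s′ t′ = ≡ᵇ-sound (∀ᵇ-sound (f a b s t s′) (∀ᵇ-sound (λ s′ → ∀ᵇ (f a b s t s′))
        (∀ᵇ-sound (λ t → ∀ᵇ λ s′ → ∀ᵇ (f a b s t s′)) (∀ᵇ-sound (λ s → ∀ᵇ λ t → ∀ᵇ λ s′ → ∀ᵇ (f a b s t s′))
        (∀ᵇ-sound (λ b → ∀ᵇ λ s → ∀ᵇ λ t → ∀ᵇ λ s′ → ∀ᵇ (f a b s t s′))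
        (∀ᵇ-sound (λ a → ∀ᵇ λ b → ∀ᵇ λ s → ∀ᵇ λ t → ∀ᵇ λ s′ → ∀ᵇ (f a b s t s′)) refl a) b) s) t) s′) t′)
    crossed : cut T C + cut T C′ ≡ 2
    crossed = trans (sym (total-+ (crossing C) (crossing C′) T))
      (trans (only-plain (λ u v → bits (A u) (A v) (S u) (S v) (S′ u) (S′ v)))
      (trans (total-+ (crossing A) (λ e → twiceInner e) T)
      (trans (cong (cut T A +_) (trans (total-+ (λ e → innerCrossing A S e + innerCrossing A S e) (λ e → innerCrossing B S′ e + innerCrossing B S′ e) T)
        (cong₂ _+_ (trans (total-+ (innerCrossing A S) (innerCrossing A S) T) (cong₂ _+_ c c))
          (trans (total-+ (innerCrossing B S′) (innerCrossing B S′) T) (cong₂ _+_ c′ c′)))))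
        (trans (ℕ.+-identityʳ _) d))))
      where
      twiceInner : Link (Fin n) → ℕ
      twiceInner e = (innerCrossing A S e + innerCrossing A S e) + (innerCrossing B S′ e + innerCrossing B S′ e)
      inn : Bool → Bool → Bool → Bool → ℕ
      inn a b s t = if a ∧ b then cross s t else 0
      rhs : Bool → Bool → Bool → Bool → Bool → Bool → ℕ
      rhs a b s t s′ t′ = cross a b + ((inn a b s t + inn a b s t) + (inn (not a) (not b) s′ t′ + inn (not a) (not b) s′ t′))
      f : Bool → Bool → Bool → Bool → Bool → Bool → Bool
      f a b s t s′ t′ = (cross (if a then s else s′) (if b then t else t′) + cross (if a then s else not s′) (if b then t else not t′))
        ≡ᵇ rhs a b s t s′ t′
      bits : ∀ a b s t s′ t′ → cross (if a then s else s′) (if b then t else t′) + cross (if a then s else not s′) (if b then t else not t′)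
        ≡ rhs a b s t s′ t′
      bits a b s t s′ t′ = ≡ᵇ-sound (∀ᵇ-sound (f a b s t s′) (∀ᵇ-sound (λ s′ → ∀ᵇ (f a b s t s′))
        (∀ᵇ-sound (λ t → ∀ᵇ λ s′ → ∀ᵇ (f a b s t s′)) (∀ᵇ-sound (λ s → ∀ᵇ λ t → ∀ᵇ λ s′ → ∀ᵇ (f a b s t s′))
        (∀ᵇ-sound (λ b → ∀ᵇ λ s → ∀ᵇ λ t → ∀ᵇ λ s′ → ∀ᵇ (f a b s t s′))
        (∀ᵇ-sound (λ a → ∀ᵇ λ b → ∀ᵇ λ s → ∀ᵇ λ t → ∀ᵇ λ s′ → ∀ᵇ (f a b s t s′)) refl a) b) s) t) s′) t′)
    in-A : ∀ {v} → A v ∧ S v ≡ true → C v ≡ true × C′ v ≡ true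
    in-A {v} p with A v | S v
    ... | true | true = refl , refl
    in-A₂ : ∀ {v} → A v ∧ not (S v) ≡ true → not (C v) ≡ true × not (C′ v) ≡ true
    in-A₂ {v} p with A v | S v
    ... | true | false = refl , refl
    C-1 : cut T C ≡ 1
    C-1 = let v , Xv , p = m₁ ; w , Xw , q = m₂ in
      proj₁ (one (spans T-spanning C (v , Xv , proj₁ (in-A p)) (w , Xw , proj₁ (in-A₂ q)))
                 (spans T-spanning C′ (v , Xv , proj₂ (in-A p)) (w , Xw , proj₂ (in-A₂ q))) crossed)
    parity : 2 ≡ 1 + (innerPairs + innerPairs)
    parity = trans (sym (cong₂ _+_ A₁-1 B₁-1)) (trans joined (cong (_+ (innerPairs + innerPairs)) C-1))

length≤cut : ∀ {Ts} → All (Spanning X) Ts → ∀ {A : Subset (Fin n)} → Meets X A → Meets X (not ∘ A) →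
  length Ts ≤ cut (concat Ts) A
length≤cut [] m m′ = z≤n
length≤cut {Ts = T ∷ Ts} (s ∷ ss) {A} m m′ = subst (suc (length Ts) ≤_) (sym (total-++ (crossing A) T (concat Ts)))
  (ℕ.+-mono-≤ (spans s A m m′) (length≤cut ss m m′))

inner-both : ∀ {T} → Spanning X T → ∀ (A : Subset (Fin n)) → cut T A ≡ 1 → Inner X A T × Inner X (not ∘ A) T
inner-both {T = T} s A d = cut-1⇒inner s A d , cut-1⇒inner s (not ∘ A) (trans (cut-not T A) d)

inner-all : ∀ {Ts} → All (Spanning X) Ts → ∀ {A : Subset (Fin n)} → Meets X A → Meets X (not ∘ A) →
  cut (concat Ts) A ≤ length Ts → All (λ T → Inner X A T × Inner X (not ∘ A) T) Ts
inner-all [] m m′ p = []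
inner-all {X = X} {Ts = T ∷ Ts} (s ∷ ss) {A} m m′ p = by-cut (cut T A) refl
  (subst (_≤ suc (length Ts)) (total-++ (crossing A) T (concat Ts)) p)
  where
  by-cut : ∀ d → cut T A ≡ d → cut T A + cut (concat Ts) A ≤ suc (length Ts) →
    All (λ T → Inner X A T × Inner X (not ∘ A) T) (T ∷ Ts)
  by-cut zero d q = contradiction (subst (1 ≤_) d (spans s A m m′)) λ ()
  by-cut (suc zero) d q rewrite d = inner-both s A d ∷ inner-all ss m m′ (s≤s⁻¹ q)
  by-cut (suc (suc k)) d q rewrite d = contradiction (ℕ.≤-trans (s≤s (length≤cut ss m m′))
    (ℕ.≤-trans (s≤s (ℕ.m≤n+m _ k)) (s≤s⁻¹ q))) (ℕ.n≮n _)

-- A subgraph that crosses once is connected on both sides and leaves the choice open. The one that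
-- crosses twice uses up the surplus and picks the side for all.
inner-side : ∀ {Ts} → All (Spanning X) Ts → ∀ {A : Subset (Fin n)} → Meets X A → Meets X (not ∘ A) →
  cut (concat Ts) A ≤ suc (length Ts) → All (Inner X A) Ts ⊎ All (Inner X (not ∘ A)) Ts
inner-side [] m m′ p = inj₁ []
inner-side {X = X} {Ts = T ∷ Ts} (s ∷ ss) {A} m m′ p = by-cut (cut T A) refl
  (subst (_≤ suc (suc (length Ts))) (total-++ (crossing A) T (concat Ts)) p)
  where
  by-cut : ∀ d → cut T A ≡ d → cut T A + cut (concat Ts) A ≤ suc (suc (length Ts)) →
    All (Inner X A) (T ∷ Ts) ⊎ All (Inner X (not ∘ A)) (T ∷ Ts)
  by-cut zero d q = contradiction (subst (1 ≤_) d (spans s A m m′)) λ ()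
  by-cut (suc zero) d q rewrite d with inner-both s A d | inner-side ss m m′ (s≤s⁻¹ q)
  ... | i , i′ | inj₁ is = inj₁ (i ∷ is)
  ... | i , i′ | inj₂ is = inj₂ (i′ ∷ is)
  by-cut (suc (suc zero)) d q rewrite d with cut-2⇒inner s A d | inner-all ss m m′ (s≤s⁻¹ (s≤s⁻¹ q))
  ... | inj₁ i | is = inj₁ (i ∷ All.map proj₁ is)
  ... | inj₂ i | is = inj₂ (i ∷ All.map proj₂ is)
  by-cut (suc (suc (suc k))) d q rewrite d = contradiction (ℕ.≤-trans (s≤s (length≤cut ss m m′))
    (ℕ.≤-trans (s≤s (ℕ.m≤n+m _ k)) (s≤s⁻¹ (s≤s⁻¹ q)))) (ℕ.n≮n _)

-- Removing a vertex from the spanning subgraphs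

plain-free : ∀ {L} → All (Plain X) L → ∀ (S : Subset (Fin n)) → cut L S ≡ freeCut L S
plain-free ok S = total-cong (All.map eq ok)
  where
  eq : ∀ {e} → Plain _ e → crossing S e ≡ freeCrossing S e
  eq (plain _ _ _) = refl

module _ {X : Subset (Fin n)} {v : Fin n} (Xv : X v ≡ true) where

  plain-∖ : ∀ {L} → All (Plain X) L → cut L ⁅ v ⁆ ≡ 0 → All (Plain (X ∖ v)) L
  plain-∖ ok p = All.zipWith (λ (q , r) → restrict q r) (ok , total≡0⇒All (crossing ⁅ v ⁆) p)
    where
    restrict : ∀ {e} → Plain X e → crossing ⁅ v ⁆ e ≡ 0 → Plain (X ∖ v) e
    restrict {free a b} (plain Xa Xb a≢b) p = plain (∖-intro X Xa v≢a) (∖-intro X Xb v≢b) a≢b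
      where
      v≢a : v ≢ a
      v≢a refl = a≢b (⁅⁆-true (trans (sym (cross-0 _ _ p)) (⁅⁆-refl v)))
      v≢b : v ≢ b
      v≢b refl = ≢-sym a≢b (⁅⁆-true (trans (cross-0 _ _ p) (⁅⁆-refl v)))

  spans-extended : ∀ {T} → Spans X T → ∀ {A} → Meets (X ∖ v) A → Meets (X ∖ v) (not ∘ A) → ∀ b →
    ∃ λ S → S v ≡ b × (∀ {w} → v ≢ w → S w ≡ A w) × 1 ≤ cut T S
  spans-extended {T} sp {A} (p , Xp , Ap) (q , Xq , Aq) b = S , on , off , sp S
    (p , proj₁ (∖-true X {v} Xp) , trans (off (proj₂ (∖-true X {v} Xp))) Ap)
    (q , proj₁ (∖-true X {v} Xq) , trans (cong not (off (proj₂ (∖-true X {v} Xq)))) Aq)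
    where
    S : Subset (Fin n)
    S w = if ⁅ v ⁆ w then b else A w
    on : S v ≡ b
    on rewrite ⁅⁆-refl v = refl
    off : ∀ {w} → v ≢ w → S w ≡ A w
    off v≢w rewrite ⁅⁆-≢ v≢w = refl

  first-edge : ∀ {T d} → All (Plain X) T → cut T ⁅ v ⁆ ≡ suc d →
    ∃ λ w → ∃ λ T′ → T ⟶ free v w ∷ T′ × v ≢ w × X w ≡ true × All (Plain X) T′ × cut T′ ⁅ v ⁆ ≡ d
  first-edge {T} ok p with extractFree v T (subst (0 <_) (trans (sym p) (plain-free ok ⁅ v ⁆)) (s≤s z≤n))
  ... | w , T′ , r , v≢w with All-⟶ plain-sym r ok
  ... | plain _ Xw _ ∷ ok′ = w , T′ , r , v≢w , Xw , ok′ , ℕ.suc-injective (trans (sym (trans (cut-⟶ ⁅ v ⁆ r)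
    (cong (_+ cut T′ ⁅ v ⁆) (cong₂ cross (⁅⁆-refl v) (⁅⁆-≢ v≢w))))) p)

  peel₁ : ∀ {T} → Spanning X T → cut T ⁅ v ⁆ ≡ 1 →
    ∃ λ w → ∃ λ T′ → T ⟶ free v w ∷ T′ × v ≢ w × X w ≡ true × Spanning (X ∖ v) T′
  peel₁ {T} s d with first-edge (well-formed s) d
  ... | w , T′ , r , v≢w , Xw , ok , d′ = w , T′ , r , v≢w , Xw , spanning ok′ spans′
    where
    ok′ = plain-∖ ok d′
    spans′ : Spans (X ∖ v) T′
    -- With v on the side of its only neighbour w, the edge `v w` is not cut.
    spans′ A m m′ with spans-extended {T} (spans s) m m′ (A w)
    ... | S , Sv , off , q = subst (1 ≤_) (trans (cut-⟶ S r) (trans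
      (cong₂ (λ a b → cross a b + cut T′ S) Sv (off v≢w)) (trans (cong (_+ cut T′ S) (cross-refl (A w)))
      (plain-agree ok′ (λ u Xu → off (proj₂ (∖-true X Xu))))))) q

  solvable-loop : ∀ {a : Fin n} {L H} → Solvable L H → Solvable (free a a ∷ L) H
  solvable-loop {a} {L} {H} (solved O os eq) = solved _ (forth ∷ os) λ i →
    trans (cong (_⊕ net H ⁅ i ⁆) (trans (cong (_⊕ net O ⁅ i ⁆) (flow-refl (⁅ i ⁆ a))) (⊕-identityˡ _))) (eq i)

  peel₂ : ∀ {T} → Spanning X T → cut T ⁅ v ⁆ ≡ 2 →
    ∃ λ T′ → Spanning (X ∖ v) T′ × (∀ K {H} → Solvable (T′ ++ K) H → Solvable (T ++ K) H)
  peel₂ {T} s d with first-edge (well-formed s) d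
  ... | a , T₁ , r₁ , v≢a , Xa , ok₁ , d₁ with first-edge ok₁ d₁
  ... | b , T₂ , r₂ , v≢b , Xb , ok₂ , d₂ = go (a Fin.≟ b)
    where
    r : T ⟶ free v a ∷ free v b ∷ T₂
    r = r₁ ⟫ keep _ r₂
    ok′ = plain-∖ ok₂ d₂
    spans-with : Spans (X ∖ v) (free a b ∷ T₂)
    -- With v on the side of a, the edges at v contribute to the cut exactly what the lifted edge
    -- contributes.
    spans-with A m m′ with spans-extended {T} (spans s) m m′ (A a)
    ... | S , Sv , off , q = subst (1 ≤_) (trans (cut-⟶ S r) (trans
      (cong₂ _+_ (cong₂ cross Sv (off v≢a)) (cong₂ _+_ (cong₂ cross Sv (off v≢b)) (plain-agree ok′ (λ u Xu → off (proj₂ (∖-true X Xu))))))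
      (cong (_+ (cross (A a) (A b) + cut T₂ A)) (cross-refl (A a))))) q
    lift : ∀ K {H} → Solvable (free a b ∷ T₂ ++ K) H → Solvable (T ++ K) H
    lift K sol = solvable-⟶ (⟶-++ʳ K r) (solvable-lift free sol)
    go : Dec (a ≡ b) → ∃ λ T′ → Spanning (X ∖ v) T′ × (∀ K {H} → Solvable (T′ ++ K) H → Solvable (T ++ K) H)
    go (no a≢b) = free a b ∷ T₂ , spanning (plain (∖-intro X Xa v≢a) (∖-intro X Xb v≢b) a≢b ∷ ok′) spans-with , lift
    -- Two edges to the same neighbour lift to a loop, which crosses no cut and may be oriented at
    -- will.
    go (yes refl) = T₂ , spanning ok′ (λ A m m′ → subst (1 ≤_) (cong (_+ cut T₂ A) (cross-refl (A a))) (spans-with A m m′)) ,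
      λ K sol → lift K (solvable-loop sol)

  End : Fin n → Set
  End w = v ≢ w × X w ≡ true

  -- Here e is the surplus: up to e members of `Ts` have two edges at v, which are lifted. Each of
  -- the others has a single edge at v, whose far end is kept in `ends`. The list `K` in `lifting`
  -- is a context, through which the recursion carries the edges already treated.
  record Peeled (e : ℕ) (Ts : List (List (Link (Fin n)))) : Set where
    field
      ends    : List (Fin n)
      trees   : List (List (Link (Fin n)))
      enough  : length Ts ≤ e + length ends
      length≡ : length trees ≡ length Ts
      distinct : All End ends
      spanned : All (Spanning (X ∖ v)) trees
      lifting : ∀ K {H} → Solvable (map (free v) ends ++ (concat trees ++ K)) H → Solvable (concat Ts ++ K) H

  peel : ∀ {p} → X p ≡ true → v ≢ p → ∀ {Ts} → All (Spanning X) Ts → ∀ e → e ≤ 1 →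
    cut (concat Ts) ⁅ v ⁆ ≤ e + length Ts → Peeled e Ts
  peel Xp v≢p [] e e≤1 c = record
    { ends = [] ; trees = [] ; enough = z≤n ; length≡ = refl ; distinct = [] ; spanned = [] ; lifting = λ K sol → sol }
  peel {p} Xp v≢p {T ∷ Ts} (s ∷ ss) e e≤1 c = by-cut (cut T ⁅ v ⁆) refl
    (subst (_≤ e + suc (length Ts)) (total-++ (crossing ⁅ v ⁆) T (concat Ts)) c)
    where
    m : Meets X ⁅ v ⁆
    m = v , Xv , ⁅⁆-refl v
    m′ : Meets X (not ∘ ⁅ v ⁆)
    m′ = p , Xp , cong not (⁅⁆-≢ v≢p)
    by-cut : ∀ d → cut T ⁅ v ⁆ ≡ d → cut T ⁅ v ⁆ + cut (concat Ts) ⁅ v ⁆ ≤ e + suc (length Ts) → Peeled e (T ∷ Ts)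
    by-cut zero d q = contradiction (subst (1 ≤_) d (spans s ⁅ v ⁆ m m′)) λ ()
    by-cut (suc zero) d q with peel₁ s d | peel Xp v≢p ss e e≤1 (s≤s⁻¹ (subst₂ _≤_ (cong (_+ cut (concat Ts) ⁅ v ⁆) d) (ℕ.+-suc e (length Ts)) q))
    ... | w , T′ , r , v≢w , Xw , s′ | rest = record
      { ends    = w ∷ ends
      ; trees   = T′ ∷ trees
      ; enough  = subst (suc (length Ts) ≤_) (sym (ℕ.+-suc e (length ends))) (s≤s enough)
      ; length≡ = cong suc length≡
      ; distinct = (v≢w , Xw) ∷ distinct
      ; spanned = s′ ∷ spanned
      ; lifting = λ K sol →
          solvable-⟶ (subst (_⟶ concat Ts ++ (T ++ K)) (sym (++-assoc T (concat Ts) K)) (⟶-++-swap T (concat Ts) K) ⟫ ⟶-++ˡ (concat Ts) (⟶-++ʳ K r))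
            (lifting (free v w ∷ T′ ++ K) (solvable-⟶ (reorder K) sol))
      }
      where
      open Peeled rest
      reorder : ∀ K → map (free v) ends ++ (concat trees ++ (free v w ∷ T′ ++ K)) ⟶
        free v w ∷ map (free v) ends ++ ((T′ ++ concat trees) ++ K)
      reorder K = subst (λ M → map (free v) ends ++ (concat trees ++ (free v w ∷ T′ ++ K)) ⟶ free v w ∷ map (free v) ends ++ M) (sym (++-assoc T′ (concat trees) K))
        (⟶-++ˡ (map (free v) ends) (⟶-++-swap (concat trees) (free v w ∷ []) (T′ ++ K)) ⟫
          ⟶-++-swap (map (free v) ends) (free v w ∷ []) (concat trees ++ (T′ ++ K)) ⟫
          keep _ (⟶-++ˡ (map (free v) ends) (⟶-++-swap (concat trees) T′ K)))
    by-cut (suc (suc zero)) d q = two e e≤1 (subst (_≤ e + suc (length Ts)) (cong (_+ cut (concat Ts) ⁅ v ⁆) d) q)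
      where
      two : ∀ e → e ≤ 1 → 2 + cut (concat Ts) ⁅ v ⁆ ≤ e + suc (length Ts) → Peeled e (T ∷ Ts)
      two zero e≤1 q = contradiction (ℕ.≤-trans (s≤s (length≤cut ss m m′)) (s≤s⁻¹ q)) (ℕ.n≮n _)
      two (suc zero) e≤1 q with peel₂ s d | peel Xp v≢p ss 0 z≤n (s≤s⁻¹ (s≤s⁻¹ q))
      ... | T′ , s′ , up-lift | rest = record
        { ends    = ends
        ; trees   = T′ ∷ trees
        ; enough  = s≤s enough
        ; length≡ = cong suc length≡
        ; distinct = distinct
        ; spanned = s′ ∷ spanned
        ; lifting = λ K sol → subst (λ M → Solvable M _) (sym (++-assoc T (concat Ts) K))
            (up-lift (concat Ts ++ K) (solvable-⟶ (⟶-++-swap T′ (concat Ts) K)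
              (lifting (T′ ++ K) (solvable-⟶ (reorder K) sol))))
        }
        where
        open Peeled rest
        reorder : ∀ K → map (free v) ends ++ (concat trees ++ (T′ ++ K)) ⟶ map (free v) ends ++ ((T′ ++ concat trees) ++ K)
        reorder K = subst (λ M → map (free v) ends ++ (concat trees ++ (T′ ++ K)) ⟶ map (free v) ends ++ M) (sym (++-assoc T′ (concat trees) K))
          (⟶-++ˡ (map (free v) ends) (⟶-++-swap (concat trees) T′ K))
      two (suc (suc e)) (s≤s ()) q
    by-cut (suc (suc (suc k))) d q = contradiction
      (ℕ.≤-trans (s≤s (s≤s (s≤s (ℕ.≤-trans (length≤cut ss m m′) (ℕ.m≤n+m _ k)))))
        (ℕ.≤-trans (subst (_≤ e + suc (length Ts)) (cong (_+ cut (concat Ts) ⁅ v ⁆) d) q) (ℕ.+-monoˡ-≤ (suc (length Ts)) e≤1)))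
      (ℕ.n≮n _)

solvable-prefix : ∀ {M P L} {H : List (Arc (Fin n))} → Oriented M P → Solvable L (P ++ H) → Solvable (M ++ L) H
solvable-prefix {P = P} {H = H} ps (solved O os eq) = solved (P ++ O) (orientation-++ ps os) λ v → begin
  net (P ++ O) ⁅ v ⁆ ⊕ net H ⁅ v ⁆               ≡⟨ cong (_⊕ net H ⁅ v ⁆) (trans (net-++ P O ⁅ v ⁆) (⊕-comm (net P ⁅ v ⁆) _)) ⟩
  (net O ⁅ v ⁆ ⊕ net P ⁅ v ⁆) ⊕ net H ⁅ v ⁆      ≡⟨ ⊕-assoc (net O ⁅ v ⁆) _ _ ⟩
  net O ⁅ v ⁆ ⊕ (net P ⁅ v ⁆ ⊕ net H ⁅ v ⁆)      ≡⟨ cong (net O ⁅ v ⁆ ⊕_) (net-++ P H ⁅ v ⁆) ⟨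
  net O ⁅ v ⁆ ⊕ net (P ++ H) ⁅ v ⁆               ≡⟨ eq v ⟩
  0F                                             ∎
  where open ≡-Reasoning

-- Splitting the spanning subgraphs along a vertex set

innerPart outerPart : Subset (Fin n) → List (Link (Fin n)) → List (Link (Fin n))
innerPart B T = proj₁ (splitInside B T)
outerPart B T = proj₁ (proj₂ (splitInside B T))

part-⟶ : ∀ (B : Subset (Fin n)) T → T ⟶ innerPart B T ++ outerPart B T
part-⟶ B T = proj₁ (proj₂ (proj₂ (splitInside B T)))

innerPart-inside : ∀ (B : Subset (Fin n)) T → All (λ e → inside B e ≡ true) (innerPart B T)
innerPart-inside B T = proj₁ (proj₂ (proj₂ (proj₂ (splitInside B T))))

outerPart-outside : ∀ (B : Subset (Fin n)) T → All (λ e → inside B e ≡ false) (outerPart B T)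
outerPart-outside B T = proj₂ (proj₂ (proj₂ (proj₂ (splitInside B T))))

parts-⟶ : ∀ (B : Subset (Fin n)) Ts → concat Ts ⟶ concat (map (innerPart B) Ts) ++ concat (map (outerPart B) Ts)
parts-⟶ B [] = done
parts-⟶ B (T ∷ Ts) = ⟶-++ʳ (concat Ts) (part-⟶ B T) ⟫ ⟶-++ˡ (innerPart B T ++ outerPart B T) (parts-⟶ B Ts) ⟫
  subst₂ _⟶_ (sym (++-assoc (innerPart B T) (outerPart B T) (Is ++ Rs))) (sym (++-assoc (innerPart B T) Is (outerPart B T ++ Rs)))
    (⟶-++ˡ (innerPart B T) (⟶-++-swap (outerPart B T) Is Rs))
  where
  Is = concat (map (innerPart B) Ts)
  Rs = concat (map (outerPart B) Ts)

inner-spanning : ∀ {T} (B : Subset (Fin n)) → Spanning X T → Inner X B T → Spanning (λ v → X v ∧ B v) (innerPart B T)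
inner-spanning {n} {X} {T} B s inner = spanning
  (All.zipWith (λ (p , q) → restrict p q) (All.++⁻ˡ I (All-⟶ plain-sym (part-⟶ B T) (well-formed s)) , innerPart-inside B T))
  λ A (v , p , Av) (w , q , Aw) → subst (1 ≤_) (counts A) (inner A
    (v , proj₁ (∧-true p) , ∧-intro (proj₂ (∧-true {X v} p)) Av)
    (w , proj₁ (∧-true q) , ∧-intro (proj₂ (∧-true {X w} q)) Aw))
  where
  I = innerPart B T
  R = outerPart B T
  restrict : ∀ {e} → Plain X e → inside B e ≡ true → Plain (λ v → X v ∧ B v) e
  restrict (plain {u} Xu Xv u≢v) p = plain (∧-intro Xu (proj₁ (∧-true p))) (∧-intro Xv (proj₂ (∧-true {B u} p))) u≢v
  counts : ∀ A → innerCut B T A ≡ cut I A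
  counts A = begin
    innerCut B T A                            ≡⟨ total-⟶ symmetric (part-⟶ B T) ⟩
    innerCut B (I ++ R) A                     ≡⟨ total-++ (innerCrossing B A) I R ⟩
    innerCut B I A + innerCut B R A           ≡⟨ cong₂ _+_ (total-cong (All.map (λ {e} → cong (if_then crossing A e else 0)) (innerPart-inside B T)))
                                                   (total-0 (innerCrossing B A) (All.map (λ {e} → cong (if_then crossing A e else 0)) (outerPart-outside B T))) ⟩
    cut I A + 0                               ≡⟨ ℕ.+-identityʳ _ ⟩
    cut I A                                   ∎
    where
    open ≡-Reasoning
    symmetric : ∀ u v → innerCrossing B A (free u v) ≡ innerCrossing B A (free v u)
    symmetric u v = cong₂ (if_then_else 0) (Bool.∧-comm (B u) (B v)) (cross-sym (A u) (A v))

module _ {X B : Subset (Fin n)} {b : Fin n} (Xb : X b ≡ true) (Bb : B b ≡ true) where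
  open Within {X = X} {B} Xb Bb

  -- A cut of the contraction pulls back to a cut of T that does not separate B, so the edges inside
  -- B contribute nothing.
  outer-spanning : ∀ {T} → Spanning X T → Spanning X₁ (map (mapEdge π) (outerPart B T))
  outer-spanning {T} s = spanning
    (All.map⁺ (All.zipWith (λ (p , q) → contract p q) (All.++⁻ʳ I (All-⟶ plain-sym (part-⟶ B T) (well-formed s)) , outerPart-outside B T)))
    λ A (v , p , Av) (w , q , Aw) → subst (1 ≤_) (counts A) (spans s (A ∘ π)
      (v , X₁⊆X p , trans (cong A (X₁-fixed p)) Av)
      (w , X₁⊆X q , trans (cong (not ∘ A) (X₁-fixed q)) Aw))
    where
    I = innerPart B T
    R = outerPart B T
    contract : ∀ {e} → Plain X e → inside B e ≡ false → Plain X₁ (mapEdge π e)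
    contract (plain Xu Xv u≢v) p = plain (X₁-π Xu) (X₁-π Xv) (π≢π u≢v p)
    counts : ∀ A → cut T (A ∘ π) ≡ cut (map (mapEdge π) R) A
    counts A = begin
      cut T (A ∘ π)                 ≡⟨ cut-⟶ (A ∘ π) (part-⟶ B T) ⟩
      cut (I ++ R) (A ∘ π)          ≡⟨ total-++ (crossing (A ∘ π)) I R ⟩
      cut I (A ∘ π) + cut R (A ∘ π) ≡⟨ cong (_+ cut R (A ∘ π)) (cut-inside (A b) (innerPart-inside B T) (λ v → const-on-A A)) ⟩
      cut R (A ∘ π)                 ≡⟨ cut-map π R A ⟨
      cut (map (mapEdge π) R) A     ∎
      where open ≡-Reasoning

-- Induction on packings of four spanning subgraphs

module TreePacking {n : ℕ} (z : Fin n) where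

  -- z stays outside X throughout, in reserve as the isolated vertex of the highly connected case.
  Packing : Subset (Fin n) → List (List (Link (Fin n))) → List (Arc (Fin n)) → Set
  Packing X Ts H = X z ≡ false × length Ts ≡ 4 × All (Spanning X) Ts × All (ArcIn X) H

  Fewer : Subset (Fin n) → Set
  Fewer X = ∀ {X′ Ts H} → Packing X′ Ts H → card X′ < card X → Solvable (concat Ts) H

  contract : ∀ {X Ts H} → Packing X Ts H → Fewer X → ∀ B → Twice X B → Meets X (not ∘ B) → All (Inner X B) Ts →
    Solvable (concat Ts) H
  contract {X} {Ts} {H} (Xz , four , trees , demand) fewer B (b , c , Xb , Xc , Bb , Bc , b≢c) (w , Xw , Bw) inners =
    finish (expand B Bb (subst (λ M → Solvable M (map (mapArc π) H)) (sym (concat-map′ Ts))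
      (fewer (X₁-z , trans (length-map _ Ts) four , All.map⁺ (All.map (outer-spanning Xb Bb) trees) ,
        All.map⁺ (All.map (λ (p , q) → X₁-π p , X₁-π q) demand)) (X₁-< Xc Bc b≢c))))
    where
    open Within {X = X} {B} Xb Bb
    concat-map′ : ∀ Ts → map (mapEdge π) (concat (map (outerPart B) Ts)) ≡ concat (map (λ T → map (mapEdge π) (outerPart B T)) Ts)
    concat-map′ [] = refl
    concat-map′ (T ∷ Ts) = trans (map-++ (mapEdge π) (outerPart B T) _) (cong (map (mapEdge π) (outerPart B T) ++_) (concat-map′ Ts))
    X₁-z : X₁ z ≡ false
    X₁-z = cong (_∧ (not (B z) ∨ ⁅ b ⁆ z)) Xz
    X₂ : Subset (Fin n)
    X₂ v = X v ∧ B v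
    B′ : Subset (Fin n)
    B′ v = not (B v)
    σ : Fin n → Fin n
    σ = collapse B′ b
    X₂-σ : ∀ {v} → X v ≡ true → X₂ (σ v) ≡ true
    X₂-σ {v} Xv with B v in Bv
    ... | true  = ∧-intro Xv Bv
    ... | false = ∧-intro Xb Bb
    X₂-< : card X₂ < card X
    X₂-< = card-< (λ v p → proj₁ (∧-true p)) w Xw (trans (cong (X w ∧_) (trans (sym (Bool.not-involutive (B w))) (cong not Bw))) (Bool.∧-zeroʳ _))
    arc-in : ∀ {R O} → All (Plain X) R → Oriented R O → All (ArcIn X) O
    arc-in [] [] = []
    arc-in (plain Xu Xv _ ∷ ps) (forth ∷ os) = (Xu , Xv) ∷ arc-in ps os
    arc-in (plain Xu Xv _ ∷ ps) (back ∷ os)  = (Xv , Xu) ∷ arc-in ps os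
    all-plain : All (Plain X) (concat (map (innerPart B) Ts) ++ concat (map (outerPart B) Ts))
    all-plain = All-⟶ plain-sym (parts-⟶ B Ts) (All.concat⁺ (All.map well-formed trees))
    finish : Outer B (concat (map (outerPart B) Ts)) H → Solvable (concat Ts) H
    finish outer = join (fewer (cong (_∧ B z) Xz , trans (length-map (innerPart B) Ts) four ,
        All.map⁺ (All.zipWith (λ (s , i) → inner-spanning B s i) (trees , inners)) ,
        All.map⁺ (All.map (λ (p , q) → X₂-σ p , X₂-σ q) (All.++⁺ (arc-in (All.++⁻ʳ (concat (map (innerPart B) Ts)) all-plain) orients) demand))) X₂-<)
      where
      open Outer outer
      K = arcs ++ H
      net-B : net K B ≡ 0F
      net-B = trans (net-++ arcs H B) across
      -- The complement of B is collapsed onto b. Its net outflow is zero, as that of B is, so even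
      -- the value at b stays the same.
      net-σ : ∀ v → B v ≡ true → net (map (mapArc σ) K) ⁅ v ⁆ ≡ net K ⁅ v ⁆
      net-σ v Bv with v Fin.≟ b
      ... | yes refl = trans (net-map σ K ⁅ v ⁆) (trans (net-ext K eq) (trans (net-∪ K ⁅ v ⁆ B′ disjoint)
          (trans (cong (net K ⁅ v ⁆ ⊕_) (trans (net-not K B) (cong -₃_ net-B))) (⊕-identityʳ _))))
        where
        eq : ∀ w → ⁅ v ⁆ (σ w) ≡ (⁅ v ⁆ ∪ B′) w
        eq w with B w
        ... | true  = sym (Bool.∨-identityʳ _)
        ... | false = trans (⁅⁆-refl v) (sym (Bool.∨-zeroʳ _))
        disjoint : ∀ w → ⁅ v ⁆ w ∧ B′ w ≡ false
        disjoint w with v Fin.≟ w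
        ... | yes refl = cong not Bv
        ... | no _     = refl
      ... | no v≢b = trans (net-map σ K ⁅ v ⁆) (net-ext K eq)
        where
        eq : ∀ w → ⁅ v ⁆ (σ w) ≡ ⁅ v ⁆ w
        eq w with B w in Bw
        ... | true  = refl
        ... | false = trans (⁅⁆-≢ v≢b) (sym (⁅⁆-≢ (≢-by B Bv Bw)))
      insides : ∀ Ts → All (λ e → inside B e ≡ true) (concat (map (innerPart B) Ts))
      insides Ts = All.concat⁺ (All.map⁺ (All.universal (innerPart-inside B) Ts))
      join : Solvable (concat (map (innerPart B) Ts)) (map (mapArc σ) K) → Solvable (concat Ts) H
      join (solved O os eq) = solvable-split B (parts-⟶ B Ts) (insides Ts) outer os λ v Bv →
        trans (cong (net O ⁅ v ⁆ ⊕_) (trans (sym (net-++ arcs H ⁅ v ⁆)) (sym (net-σ v Bv)))) (eq v)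

  detach : ∀ {X Ts H} → Packing X Ts H → Fewer X → ∀ {v p} → X v ≡ true → X p ≡ true → v ≢ p →
    cut (concat Ts) ⁅ v ⁆ ≤ suc (length Ts) → Solvable (concat Ts) H
  detach {X} {Ts} {H} (Xz , four , trees , demand) fewer {v} {p} Xv Xp v≢p few =
    subst (λ M → Solvable M H) (++-identityʳ (concat Ts)) (Peeled.lifting peeled []
      (subst (λ M → Solvable (map (free v) ends ++ M) H) (sym (++-identityʳ _)) (orient-ends ends three distinct)))
    where
    peeled : Peeled Xv 1 Ts
    peeled = peel Xv Xp v≢p trees 1 (s≤s z≤n) few
    open Peeled peeled renaming (trees to trees′)
    three : 3 ≤ length ends
    three = s≤s⁻¹ (subst (_≤ suc (length ends)) four enough)
    ends-in : ∀ {ws} → All (End Xv) ws → All (λ e → inside X e ≡ true) (map (free v) ws)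
    ends-in es = All.map⁺ (All.map (λ (_ , Xw) → ∧-intro Xv Xw) es)
    -- Once v is balanced, its arcs can be handed to any other vertex p without changing a value.
    with-demand : ∀ {P} → All (ArcIn X) P → net P ⁅ v ⁆ ⊕ net H ⁅ v ⁆ ≡ 0F → Solvable (concat trees′) (P ++ H)
    with-demand {P} P-in met = solvable-demand (net-collapse (P ++ H) (≢-sym v≢p) (trans (net-++ P H ⁅ v ⁆) met))
      (fewer (cong (_∧ not (⁅ v ⁆ z)) Xz , trans length≡ four , spanned ,
        All.map⁺ (All.map (λ (q , r) → moved q , moved r) (All.++⁺ P-in demand))) (∖-card X Xv))
      where
      moved : ∀ {u} → X u ≡ true → (X ∖ v) (collapse ⁅ v ⁆ p u) ≡ true
      moved {u} Xu with v Fin.≟ u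
      ... | yes _  = ∖-intro X Xp v≢p
      ... | no v≢u = ∖-intro X Xu v≢u
    -- Three edges at v take every value modulo 3.
    orient-ends : ∀ ws → 3 ≤ length ws → All (End Xv) ws → Solvable (map (free v) ws ++ concat trees′) H
    orient-ends (a ∷ []) (s≤s ()) es
    orient-ends (a ∷ b ∷ []) (s≤s (s≤s ())) es
    orient-ends (a ∷ b ∷ c ∷ ws) _ es@((v≢a , _) ∷ (v≢b , _) ∷ (v≢c , _) ∷ _) with anyOrientation (map (free v) ws)
    ... | O , os with fix₃ v a b c (net O ⁅ v ⁆ ⊕ net H ⁅ v ⁆)
    ... | x , y , w , ox , oy , ow , fix = solvable-prefix oriented (with-demand (orientation-inside oriented (ends-in es))
      (trans (shift (out ⁅ v ⁆ x) (out ⁅ v ⁆ y) (out ⁅ v ⁆ w) (net O ⁅ v ⁆) (net H ⁅ v ⁆))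
        (fix ⁅ v ⁆ (⁅⁆-refl v) (⁅⁆-≢ v≢a) (⁅⁆-≢ v≢b) (⁅⁆-≢ v≢c))))
      where
      oriented : Oriented (map (free v) (a ∷ b ∷ c ∷ ws)) (x ∷ y ∷ w ∷ O)
      oriented = ox ∷ oy ∷ ow ∷ os
      shift : ∀ i j k o h → (i ⊕ (j ⊕ (k ⊕ o))) ⊕ h ≡ i ⊕ (j ⊕ (k ⊕ (o ⊕ h)))
      shift i j k o h = trans (⊕-assoc i _ h) (cong (i ⊕_) (trans (⊕-assoc j _ h) (cong (j ⊕_) (⊕-assoc k o h))))

  highly-connected : ∀ {X Ts H} → Packing X Ts H →
    (∀ A → Meets X A → Meets X (not ∘ A) → 6 ≤ cut (concat Ts) A) → Solvable (concat Ts) H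
  highly-connected {X} {Ts} {H} (Xz , four , trees , demand) connected = PartialOrientation.extend z {X⁺} record
    { z∈X     = trans (cong (X z ∨_) (⁅⁆-refl z)) (Bool.∨-zeroʳ _)
    ; well-formed = All.map valid all-plain
    ; demand  = All.map (λ (p , q) → into p , into q) demand
    ; balance = trans (cong₂ _⊕_ (total₃-0 (fixedOut ⁅ z ⁆) (All.map no-fixed all-plain)) net-z) (⊕-identityˡ _)
    -- Degree 0 is `small` for every value.
    ; z-small = cong (λ d → small d (net H ⁅ z ⁆)) (total-0 (crossing ⁅ z ⁆) (All.map uncrossed all-plain))
    ; sets    = λ A Az (u , X⁺u , Au) (w , X⁺w , z≢w , Aw) → 6≤⇒good _ _ (connected A
        (u , from X⁺u (≢-sym (≢-by A Au Az)) , Au) (w , from X⁺w z≢w , cong not Aw))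
    }
    where
    open PartialOrientation z using (Valid; free)
    X⁺ : Subset (Fin n)
    X⁺ = X ∪ ⁅ z ⁆
    into : ∀ {v} → X v ≡ true → X⁺ v ≡ true
    into {v} Xv = cong (_∨ ⁅ z ⁆ v) Xv
    from : ∀ {v} → X⁺ v ≡ true → z ≢ v → X v ≡ true
    from {v} p z≢v = trans (sym (Bool.∨-identityʳ _)) (trans (cong (X v ∨_) (sym (⁅⁆-≢ z≢v))) p)
    z≢ : ∀ {v} → X v ≡ true → z ≢ v
    z≢ Xv = ≢-sym (≢-by X Xv Xz)
    all-plain : All (Plain X) (concat Ts)
    all-plain = All.concat⁺ (All.map well-formed trees)
    valid : ∀ {e} → Plain X e → Valid X⁺ e
    valid (plain Xu Xv u≢v) = free (into Xu) (into Xv) (z≢ Xu) (z≢ Xv) u≢v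
    no-fixed : ∀ {e} → Plain X e → fixedOut ⁅ z ⁆ e ≡ 0F
    no-fixed (plain _ _ _) = refl
    uncrossed : ∀ {e} → Plain X e → crossing ⁅ z ⁆ e ≡ 0
    uncrossed (plain Xu Xv _) = cong₂ cross (⁅⁆-≢ (z≢ Xu)) (⁅⁆-≢ (z≢ Xv))
    net-z : net H ⁅ z ⁆ ≡ 0F
    net-z = net-const false demand (λ v Xv → ⁅⁆-≢ (z≢ Xv))

  one-vertex : ∀ {X Ts H} → Packing X Ts H → (∀ a b → X a ≡ true → X b ≡ true → a ≡ b) → Solvable (concat Ts) H
  one-vertex {X} {Ts} {H} (Xz , four , trees , demand) single = empty (All.concat⁺ (All.map well-formed trees))
    where
    net-0 : ∀ v → net H ⁅ v ⁆ ≡ 0F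
    net-0 v with X v in Xv
    ... | false = net-const false demand (λ w Xw → ⁅⁆-≢ (≢-sym (≢-by X Xw Xv)))
    ... | true  = net-const true demand (λ w Xw → subst (λ u → ⁅ v ⁆ u ≡ true) (single v w Xv Xw) (⁅⁆-refl v))
    empty : ∀ {L} → All (Plain X) L → Solvable L H
    empty [] = solved [] [] λ v → trans (⊕-identityˡ _) (net-0 v)
    empty (plain Xu Xv u≢v ∷ _) = contradiction (single _ _ Xu Xv) u≢v

  Sparse : Subset (Fin n) → List (List (Link (Fin n))) → Subset (Fin n) → Set
  Sparse X Ts A = Meets X A × Meets X (not ∘ A) × cut (concat Ts) A ≤ 5

  shrink : ∀ {X Ts H} → Packing X Ts H → Fewer X → ∀ {B} → Meets X B → Meets X (not ∘ B) → cut (concat Ts) B ≤ 5 →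
    All (Inner X B) Ts → Solvable (concat Ts) H
  shrink {X} {Ts} packing@(Xz , four , trees , demand) fewer {B} (v , Xv , Bv) m@(p , Xp , Bp) few inners with one-or-twice {X = X} {B} v Xv Bv
  ... | inj₁ t = contract packing fewer B t m inners
  ... | inj₂ s = detach packing fewer Xv Xp (≢-by B Bv (trans (sym (Bool.not-involutive _)) (cong not Bp)))
    (subst₂ _≤_ (plain-agree (All.concat⁺ (All.map well-formed trees)) s) (cong suc (sym four)) few)

  step : ∀ {X Ts H} → Packing X Ts H → Fewer X → Solvable (concat Ts) H
  step {X} {Ts} {H} packing@(Xz , four , trees , demand) fewer = by-size
    (any? λ a → any? λ b → (X a Bool.≟ true) ×-dec (X b Bool.≟ true) ×-dec ¬? (a Fin.≟ b))
    where
    sparse-resp : ∀ {S T} → (∀ v → S v ≡ T v) → Sparse X Ts S → Sparse X Ts T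
    sparse-resp p (m , m′ , c) = meets-resp p m , meets-resp (λ v → cong not (p v)) m′ , subst (_≤ 5) (cut-ext (concat Ts) p) c
    by-cuts : Dec (∃ (Sparse X Ts)) → Solvable (concat Ts) H
    by-cuts (no none) = highly-connected packing λ A m m′ → ℕ.≰⇒> λ c → none (A , m , m′ , c)
    by-cuts (yes (A , m , m′ , c)) with inner-side trees m m′ (subst (λ l → cut (concat Ts) A ≤ suc l) (sym four) c)
    ... | inj₁ inners = shrink packing fewer m m′ c inners
    ... | inj₂ inners = shrink packing fewer m′ (meets-resp (λ v → sym (Bool.not-involutive (A v))) m)
      (subst (_≤ 5) (sym (cut-not (concat Ts) A)) c) inners
    by-size : Dec (∃ λ a → ∃ λ b → X a ≡ true × X b ≡ true × a ≢ b) → Solvable (concat Ts) H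
    by-size (no none) = one-vertex packing λ a b Xa Xb → decidable-stable (a Fin.≟ b) λ a≢b → none (a , b , Xa , Xb , a≢b)
    by-size (yes _) = by-cuts (findSubset sparse-resp λ A → meets? X A ×-dec meets? X (not ∘ A) ×-dec (cut (concat Ts) A ℕ.≤? 5))

  solve : ∀ k {X Ts H} → Packing X Ts H → card X < k → Solvable (concat Ts) H
  solve (suc k) packing p = step packing λ packing′ q → solve k packing′ (ℕ.<-≤-trans q (s≤s⁻¹ p))

-- Residues of degree differences

ones-periodic : ∀ m → ones (3 + m) ≡ ones m
ones-periodic m = trans (ones-suc (2 + m)) (trans (cong (1F ⊕_) (trans (ones-suc (1 + m)) (cong (1F ⊕_) (ones-suc m)))) (thrice (ones m)))
  where
  thrice : ∀ a → 1F ⊕ (1F ⊕ (1F ⊕ a)) ≡ a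
  thrice a = trans (sym (⊕-assoc 1F 1F _)) (trans (cong (_⊕ (1F ⊕ a)) 1+1≡2)
    (trans (sym (⊕-assoc 2F 1F a)) (trans (cong (_⊕ a) (⊕-inverseˡ 1F)) (⊕-identityˡ a))))

residue-pos : ∀ m → residue (ℤ.+ m) ≡ ones m
residue-pos 0 = sym ones-zero
residue-pos 1 = sym (trans (ones-suc 0) (trans (cong (1F ⊕_) ones-zero) (⊕-identityʳ 1F)))
residue-pos 2 = sym (trans (ones-suc 1) (trans (cong (1F ⊕_) (trans (ones-suc 0) (trans (cong (1F ⊕_) ones-zero) (⊕-identityʳ 1F)))) 1+1≡2))
residue-pos (suc (suc (suc m))) = trans (toℕ-injective (begin
  toℕ (residue (ℤ.+ (3 + m)))  ≡⟨ toℕ-fromℕ< (n%ℕd<d (ℤ.+ (3 + m)) 3) ⟩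
  (3 + m) % 3                ≡⟨ cong (_% 3) (ℕ.+-comm 3 m) ⟩
  (m + 3) % 3                ≡⟨ [m+n]%n≡m%n m 3 ⟩
  m % 3                      ≡⟨ toℕ-fromℕ< (n%ℕd<d (ℤ.+ m) 3) ⟨
  toℕ (residue (ℤ.+ m))        ∎)) (trans (residue-pos m) (sym (ones-periodic m)))
  where open ≡-Reasoning

residue-neg : ∀ m → residue -[1+ m ] ≡ -₃ ones (suc m)
residue-neg 0 = sym (cong -₃_ (sym (residue-pos 1)))
residue-neg 1 = sym (cong -₃_ (sym (residue-pos 2)))
residue-neg 2 = sym (cong -₃_ (sym (residue-pos 3)))
residue-neg (suc (suc (suc m))) = trans (toℕ-injective (begin
  toℕ (residue -[1+ 3 + m ])  ≡⟨ toℕ-fromℕ< (n%ℕd<d -[1+ 3 + m ] 3) ⟩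
  -[1+ 3 + m ] %ℕ 3           ≡⟨ negate-% (3 + m) ⟩
  negate ((4 + m) % 3)        ≡⟨ cong (λ k → negate (k % 3)) (ℕ.+-comm 3 (suc m)) ⟩
  negate ((suc m + 3) % 3)    ≡⟨ cong negate ([m+n]%n≡m%n (suc m) 3) ⟩
  negate (suc m % 3)          ≡⟨ negate-% m ⟨
  -[1+ m ] %ℕ 3               ≡⟨ toℕ-fromℕ< (n%ℕd<d -[1+ m ] 3) ⟨
  toℕ (residue -[1+ m ])      ∎)) (trans (residue-neg m) (cong -₃_ (sym (ones-periodic (suc m)))))
  where
  open ≡-Reasoning
  negate : ℕ → ℕ
  negate zero    = 0
  negate (suc r) = 3 ∸ suc r
  negate-% : ∀ m → -[1+ m ] %ℕ 3 ≡ negate (suc m % 3)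
  negate-% m with suc m % 3
  ... | zero  = refl
  ... | suc r = refl

residue-⊖ : ∀ a b → residue (a ⊖ b) ≡ ones a ⊕ -₃ ones b
residue-⊖ a zero = trans (residue-pos a) (sym (trans (cong (λ x → ones a ⊕ -₃ x) ones-zero) (⊕-identityʳ _)))
residue-⊖ zero (suc b) = trans (residue-neg b) (sym (trans (cong (_⊕ -₃ ones (suc b)) ones-zero) (⊕-identityˡ _)))
residue-⊖ (suc a) (suc b) = begin
  residue (suc a ⊖ suc b)                 ≡⟨ cong residue ([1+m]⊖[1+n]≡m⊖n a b) ⟩
  residue (a ⊖ b)                         ≡⟨ residue-⊖ a b ⟩
  ones a ⊕ -₃ ones b                      ≡⟨ ⊕-identityˡ _ ⟨
  0F ⊕ (ones a ⊕ -₃ ones b)               ≡⟨ cong (_⊕ (ones a ⊕ -₃ ones b)) (⊕-inverseʳ 1F) ⟨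
  (1F ⊕ 2F) ⊕ (ones a ⊕ -₃ ones b)        ≡⟨ ⊕-interchange 1F 2F (ones a) _ ⟩
  (1F ⊕ ones a) ⊕ (2F ⊕ -₃ ones b)        ≡⟨ cong ((1F ⊕ ones a) ⊕_) (-₃-⊕ 1F (ones b)) ⟨
  (1F ⊕ ones a) ⊕ -₃ (1F ⊕ ones b)        ≡⟨ cong₂ (λ x y → x ⊕ -₃ y) (ones-suc a) (ones-suc b) ⟨
  ones (suc a) ⊕ -₃ ones (suc b)          ∎
  where open ≡-Reasoning

-- Zero-sum functions as demands

copies : ℤ₃ → V → List V
copies 0F x = []
copies 1F x = x ∷ []
copies 2F x = x ∷ x ∷ []

net-copies-out : ∀ c {u v : V} S → S u ≡ true → S v ≡ false → net (copies c (u , v)) S ≡ c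
net-copies-out 0F S p q = refl
net-copies-out 1F S p q rewrite p | q = ⊕-identityʳ 1F
net-copies-out 2F S p q rewrite p | q = trans (cong (1F ⊕_) (⊕-identityʳ 1F)) 1+1≡2

net-copies-in : ∀ c {u v : V} S → S u ≡ false → S v ≡ true → net (copies c (u , v)) S ≡ -₃ c
net-copies-in 0F S p q = refl
net-copies-in 1F S p q rewrite p | q = ⊕-identityʳ 2F
net-copies-in 2F S p q rewrite p | q = trans (cong (2F ⊕_) (⊕-identityʳ 2F))
  (trans (sym (⊕-identityʳ _)) (trans (⊕-assoc 2F 2F 0F) (trans (2+2≡1 0F) (⊕-identityʳ 1F))))

net-copies-no : ∀ c {u v : V} S → S u ≡ false → S v ≡ false → net (copies c (u , v)) S ≡ 0F
net-copies-no 0F S p q = refl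
net-copies-no 1F S p q rewrite p | q = ⊕-identityʳ 0F
net-copies-no 2F S p q rewrite p | q = trans (cong (0F ⊕_) (⊕-identityʳ 0F)) (⊕-identityʳ 0F)

star : ∀ {k} → V → (Fin k → V) → (Fin k → ℤ₃) → List (Arc V)
star {k = zero}  r ι γ = []
star {k = suc k} r ι γ = copies (γ zero) (r , ι zero) ++ star r (ι ∘ suc) (γ ∘ suc)

star-in : ∀ {k} {X : Subset V} {r} {ι : Fin k → V} γ → X r ≡ true → (∀ i → X (ι i) ≡ true) → All (ArcIn X) (star r ι γ)
star-in {k = zero} γ Xr Xι = []
star-in {k = suc k} {X} {r} {ι} γ Xr Xι = All.++⁺ (copied (γ zero)) (star-in (γ ∘ suc) Xr (Xι ∘ suc))
  where
  copied : ∀ c → All (ArcIn X) (copies c (r , ι zero))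
  copied 0F = []
  copied 1F = (Xr , Xι zero) ∷ []
  copied 2F = (Xr , Xι zero) ∷ (Xr , Xι zero) ∷ []

star-root : ∀ {k} {r : V} {ι : Fin k → V} γ S → S r ≡ true → (∀ i → S (ι i) ≡ false) →
  net (star r ι γ) S ≡ foldr _⊕_ 0F γ
star-root {k = zero} γ S p q = refl
star-root {k = suc k} γ S p q = trans (net-++ (copies (γ zero) _) _ S)
  (cong₂ _⊕_ (net-copies-out (γ zero) S p (q zero)) (star-root (γ ∘ suc) S p (q ∘ suc)))

star-none : ∀ {k} {r : V} {ι : Fin k → V} γ S → S r ≡ false → (∀ i → S (ι i) ≡ false) → net (star r ι γ) S ≡ 0F
star-none {k = zero} γ S p q = refl
star-none {k = suc k} γ S p q = trans (net-++ (copies (γ zero) _) _ S)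
  (trans (cong₂ _⊕_ (net-copies-no (γ zero) S p (q zero)) (star-none (γ ∘ suc) S p (q ∘ suc))) (⊕-identityˡ 0F))

star-leaf : ∀ {k} {r : V} {ι : Fin k → V} γ S j → S r ≡ false → S (ι j) ≡ true → (∀ i → i ≢ j → S (ι i) ≡ false) →
  net (star r ι γ) S ≡ -₃ γ j
star-leaf γ S zero p q o = trans (net-++ (copies (γ zero) _) _ S)
  (trans (cong₂ _⊕_ (net-copies-in (γ zero) S p q) (star-none (γ ∘ suc) S p (λ i → o (suc i) λ ()))) (⊕-identityʳ _))
star-leaf γ S (suc j) p q o = trans (net-++ (copies (γ zero) _) _ S)
  (trans (cong₂ _⊕_ (net-copies-no (γ zero) S p (o zero λ ())) (star-leaf (γ ∘ suc) S j p q (λ i i≢j → o (suc i) (i≢j ∘ Fin.suc-injective))))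
    (⊕-identityˡ _))

-- A vertex v of the graph becomes `suc v`, and `zero` is the additional vertex z.
Proper : Subset (Fin (suc n))
Proper zero    = false
Proper (suc v) = true

opaque
  unfolding _⊕_

  ⊕≡+₃ : ∀ {m} (β : Fin m → ℤ₃) → foldr _⊕_ 0F β ≡ foldr _+₃_ 0F β
  ⊕≡+₃ {zero}  β = refl
  ⊕≡+₃ {suc m} β = cong (β zero +₃_) (⊕≡+₃ (β ∘ suc))

-- A star sends β arcs from the first vertex to each other vertex. The outflow of the root is then
-- the sum of the other values, which is minus its own because the total is zero. The sign is
-- negative since an orientation has to cancel the demand.
demand-for : ∀ {m} (β : Fin m → ℤ₃) → foldr _+₃_ 0F β ≡ 0F →
  ∃ λ H → All (ArcIn Proper) H × (∀ v → net H ⁅ suc v ⁆ ≡ -₃ β v)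
demand-for {zero} β balanced = [] , [] , λ ()
demand-for {suc m} β balanced = H , star-in {X = Proper} {root} {leaf} (β ∘ suc) refl (λ _ → refl) , nets
  where
  root : Fin (suc (suc m))
  root = suc zero
  leaf : Fin m → Fin (suc (suc m))
  leaf i = suc (suc i)
  H : List (Arc (Fin (suc (suc m))))
  H = star root leaf (β ∘ suc)
  nets : ∀ v → net H ⁅ suc v ⁆ ≡ -₃ β v
  nets zero = trans (star-root {r = root} {leaf} (β ∘ suc) ⁅ root ⁆ refl (λ i → refl))
    (⊕-zeroˡ⇒neg (β zero) _ (trans (⊕≡+₃ β) balanced))
  nets (suc v) = star-leaf {r = root} {leaf} (β ∘ suc) ⁅ leaf v ⁆ v refl (⁅⁆-refl (leaf v))
    (λ i i≢v → ⁅⁆-≢ (λ p → i≢v (sym (Fin.suc-injective (Fin.suc-injective p)))))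

-- From graphs to edge lists and back

orientation-tabulate : ∀ {m} {f : Fin m → Link V} {O} → Oriented (tabulate f) O →
  ∃ λ (g : Fin m → Arc V) → (∀ i → Orients (f i) (g i)) × O ≡ tabulate g
orientation-tabulate {m = zero} [] = (λ ()) , (λ ()) , refl
orientation-tabulate {m = suc m} {f} (_∷_ {y = a} o os) with orientation-tabulate {m = m} {f ∘ suc} os
... | g , p , eq = (λ { zero → a ; (suc i) → g i }) , (λ { zero → o ; (suc i) → p i }) , cong (a ∷_) eq

count-net : ∀ {m k} (t h : Fin m → Fin n) (ι : Fin k → Fin m) v →
  ones (Vec.count (λ e → t e Fin.≟ v) (Vec.tabulate ι)) ⊕ -₃ ones (Vec.count (λ e → h e Fin.≟ v) (Vec.tabulate ι)) ≡
  net (tabulate (λ i → suc (t (ι i)) , suc (h (ι i)))) ⁅ suc v ⁆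
count-net {k = zero} t h ι v = trans (cong (λ x → x ⊕ -₃ x) ones-zero) (⊕-identityˡ 0F)
count-net {k = suc k} t h ι v = trans (added (t (ι zero) Fin.≟ v) (h (ι zero) Fin.≟ v))
  (cong₂ _⊕_ (cong₂ flow (flipped (t (ι zero))) (flipped (h (ι zero)))) (count-net t h (ι ∘ suc) v))
  where
  flipped : ∀ u → does (u Fin.≟ v) ≡ does (v Fin.≟ u)
  flipped u with u Fin.≟ v
  ... | yes refl = sym (⁅⁆-refl u)
  ... | no u≢v   = sym (⁅⁆-≢ (≢-sym u≢v))
  a = Vec.count (λ e → t e Fin.≟ v) (Vec.tabulate (ι ∘ suc))
  b = Vec.count (λ e → h e Fin.≟ v) (Vec.tabulate (ι ∘ suc))
  open ≡-Reasoning
  added : ∀ (p : Dec (t (ι zero) ≡ v)) (q : Dec (h (ι zero) ≡ v)) →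
    ones ((if does p then suc else id) a) ⊕ -₃ ones ((if does q then suc else id) b) ≡
    flow (does p) (does q) ⊕ (ones a ⊕ -₃ ones b)
  added (yes _) (yes _) = begin
    ones (suc a) ⊕ -₃ ones (suc b)           ≡⟨ residue-⊖ (suc a) (suc b) ⟨
    residue (suc a ⊖ suc b)                  ≡⟨ cong residue ([1+m]⊖[1+n]≡m⊖n a b) ⟩
    residue (a ⊖ b)                          ≡⟨ residue-⊖ a b ⟩
    ones a ⊕ -₃ ones b                       ≡⟨ ⊕-identityˡ _ ⟨
    0F ⊕ (ones a ⊕ -₃ ones b)                ∎
  added (yes _) (no _) = trans (cong (_⊕ -₃ ones b) (ones-suc a)) (⊕-assoc 1F _ _)
  added (no _) (yes _) = trans (cong (λ x → ones a ⊕ -₃ x) (ones-suc b))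
    (trans (cong (ones a ⊕_) (-₃-⊕ 1F (ones b))) (⊕-swap (ones a) 2F _))
  added (no _) (no _) = sym (⊕-identityˡ _)

module FromGraph (G : Graph) where
  open Graph G

  edge : Fin size → Link (Fin (suc order))
  edge e = free (suc (proj₁ (ends e))) (suc (proj₂ (ends e)))

  edge-plain : ∀ e → Plain Proper (edge e)
  edge-plain e = plain refl refl (loopless e ∘ Fin.suc-injective)

  crosses : ∀ (A : Subset (Fin (suc order))) {e u v} → Joins G e u v → A (suc u) ≡ true → A (suc v) ≡ false →
    crossing A (edge e) ≡ 1
  crosses A {e} (inj₁ p) Au Av rewrite p | Au | Av = refl
  crosses A {e} (inj₂ p) Au Av rewrite p | Au | Av = refl

  walk-crosses : ∀ {S} (A : Subset (Fin (suc order))) {u v} → Walk G S u v → A (suc u) ≡ true → A (suc v) ≡ false →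
    ∃ λ e → e Sub.∈ S × crossing A (edge e) ≡ 1
  walk-crosses A ε Au Av = ⊥-elim (true≢false Au Av)
  walk-crosses A (_◅_ {j = w} (e , e∈S , joins) walk) Au Av with A (suc w) in Aw
  ... | false = e , e∈S , crosses A joins Au Aw
  ... | true  = walk-crosses A walk Aw Av

  total-∈ : ∀ (f : Link (Fin (suc order)) → ℕ) {e es} → e ∈ es → f (edge e) ≤ total f (map edge es)
  total-∈ f (here refl)            = ℕ.m≤m+n _ _
  total-∈ f {es = e ∷ _} (there p) = ℕ.≤-trans (total-∈ f p) (ℕ.m≤n+m _ (f (edge e)))

  Complete : List (Fin size) → EdgeSet G → Set
  Complete es S = ∀ e → e Sub.∈ S → e ∈ es

  spanning-tree : ∀ {S es} → Connected G S → Complete es S → Spanning Proper (map edge (filter (Sub._∈? S) es))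
  spanning-tree {S} {es} connected complete = spanning (All.map⁺ (All.universal edge-plain _)) spans′
    where
    spans′ : Spans Proper (map edge (filter (Sub._∈? S) es))
    spans′ A (suc u , _ , Au) (suc v , _ , Av) with A (suc v) in Av′
    ... | false with walk-crosses A (connected u v) Au Av′
    ... | e , e∈S , c = subst (_≤ _) c (total-∈ (crossing A) (∈-filter⁺ (Sub._∈? S) (complete e e∈S) e∈S))

  separate : ∀ S es → map edge es ⟶ map edge (filter (Sub._∈? S) es) ++ map edge (filter (¬? ∘ (Sub._∈? S)) es)
  separate S [] = done
  separate S (e ∷ es) with e Sub.∈? S
  ... | yes _ = keep (edge e) (separate S es)
  ... | no _  = keep (edge e) (separate S es) ⟫ ⟶-shift (map edge (filter (Sub._∈? S) es)) (edge e)

  -- The edges of each set are filtered out of those that earlier sets left over, so the classes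
  -- partition a list; as the sets are disjoint, none loses an edge to an earlier one.
  classes : List (EdgeSet G) → List (Fin size) → List (List (Link (Fin (suc order))))
  classes []       es = []
  classes (S ∷ Ss) es = map edge (filter (Sub._∈? S) es) ∷ classes Ss (filter (¬? ∘ (Sub._∈? S)) es)

  remaining : List (EdgeSet G) → List (Fin size) → List (Fin size)
  remaining []       es = es
  remaining (S ∷ Ss) es = remaining Ss (filter (¬? ∘ (Sub._∈? S)) es)

  classes-⟶ : ∀ Ss es → map edge es ⟶ concat (classes Ss es) ++ map edge (remaining Ss es)
  classes-⟶ [] es = done
  classes-⟶ (S ∷ Ss) es = separate S es ⟫ subst (map edge (filter (Sub._∈? S) es) ++ map edge _ ⟶_)
    (sym (++-assoc (map edge (filter (Sub._∈? S) es)) _ _))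
    (⟶-++ˡ (map edge (filter (Sub._∈? S) es)) (classes-⟶ Ss (filter (¬? ∘ (Sub._∈? S)) es)))

  length-classes : ∀ Ss es → length (classes Ss es) ≡ length Ss
  length-classes []       es = refl
  length-classes (S ∷ Ss) es = cong suc (length-classes Ss _)

  classes-spanning : ∀ {Ss es} → AllPairs (EdgeDisjoint G) Ss → All (Connected G) Ss → All (Complete es) Ss →
    All (Spanning Proper) (classes Ss es)
  classes-spanning [] [] [] = []
  classes-spanning {S ∷ Ss} {es} (d ∷ ds) (c ∷ cs) (p ∷ ps) = spanning-tree c p ∷ classes-spanning ds cs
    (All.zipWith (λ (disjoint , complete) e e∈S′ → ∈-filter⁺ (¬? ∘ (Sub._∈? S)) (complete e e∈S′)
      (λ e∈S → disjoint (_ , Sub.x∈p∩q⁺ (e∈S , e∈S′)))) (d , ps))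

  orient : ∀ Ss → length Ss ≡ 4 → AllPairs (EdgeDisjoint G) Ss → All (Connected G) Ss → ∀ {H} → All (ArcIn Proper) H →
    Solvable (tabulate edge) H
  orient Ss four disjoint connected {H} H-in = subst (λ L → Solvable L H) (map-tabulate id edge)
    (solvable-⟶ (classes-⟶ Ss (allFin size) ⟫ ⟶-++-comm (concat (classes Ss (allFin size))) R)
      -- The edges in no tree are oriented arbitrarily and their arcs join the demand.
      (solvable-prefix os (TreePacking.solve zero _
        (refl , trans (length-classes Ss _) four ,
          classes-spanning disjoint connected (All.universal (λ S e _ → ∈-allFin e) Ss) ,
          All.++⁺ (orientation-inside os (All.map⁺ (All.universal (λ e → refl) (remaining Ss (allFin size))))) H-in) (ℕ.n<1+n _))))
    where
    R = map edge (remaining Ss (allFin size))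
    os = proj₂ (anyOrientation R)

  ends-of : ∀ {e a} → Orients (edge e) a → ∃ λ u → ∃ λ v → a ≡ (suc u , suc v) × Joins G e u v
  ends-of forth = _ , _ , refl , inj₁ refl
  ends-of back  = _ , _ , refl , inj₂ refl

  oriented : ∀ {β} → IsZeroSum G β → (∀ {H} → All (ArcIn Proper) H → Solvable (tabulate edge) H) → ∃ λ D → IsβOrientation G β D
  oriented {β} balanced solvable with demand-for β balanced
  ... | H , H-in , nets with solvable H-in
  ... | solved O os eq with orientation-tabulate os
  ... | g , p , refl = D , λ v → begin
      residue (outdeg v ⊖ indeg v)                                         ≡⟨ residue-⊖ (outdeg v) (indeg v) ⟩
      ones (outdeg v) ⊕ -₃ ones (indeg v)                                  ≡⟨ count-net tail head id v ⟩
      net (tabulate (λ e → suc (tail e) , suc (head e))) ⁅ suc v ⁆         ≡⟨ cong (λ K → net K ⁅ suc v ⁆) (tabulate-cong arcs-eq) ⟨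
      net (tabulate g) ⁅ suc v ⁆                                           ≡⟨ meets v ⟩
      β v                                                                  ∎
    where
    D : Orientation G
    D = record
      { tail  = λ e → proj₁ (ends-of (p e))
      ; head  = λ e → proj₁ (proj₂ (ends-of (p e)))
      ; joins = λ e → proj₂ (proj₂ (proj₂ (ends-of (p e))))
      }
    open Orientation D
    open ≡-Reasoning
    arcs-eq : ∀ e → g e ≡ (suc (tail e) , suc (head e))
    arcs-eq e = proj₁ (proj₂ (proj₂ (ends-of (p e))))
    meets : ∀ v → net (tabulate g) ⁅ suc v ⁆ ≡ β v
    meets v = trans (⊕-zeroˡ⇒neg (net H ⁅ suc v ⁆) _ (trans (⊕-comm (net H ⁅ suc v ⁆) _) (eq (suc v))))
      (trans (cong -₃_ (nets v)) (-₃-involutive (β v)))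

theorem1p7 : (G : Graph) (T : Fin 4 → EdgeSet G) →
    (∀ i → IsSpanningTree G (T i)) →
    (∀ i j → i ≢ j → EdgeDisjoint G (T i) (T j)) →
    ℤ₃-Connected G
theorem1p7 G T trees disjoint β balanced = oriented balanced
  (orient (tabulate T) refl (AllPairs.tabulate⁺ (λ {i} {j} → disjoint i j)) (All.tabulate⁺ (λ i → proj₁ (trees i))))
  where open FromGraph G
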